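{- Let $s,p\in\mathbb{N}$. For all $n\in\mathbb{N}'$, the partial derivatives of bivariate $s$-Fibopolynomials satisfy $$\frac{\partial}{\partial x}\binom{n}{p}_{F_s}=s\binom{n}{p}_{F_s}\ast\sum_{k=0}^{\lfloor (p+1)/2\rfloor-1}(p-2k)(-y)^{skn}F_{s(p-2k)n}$$ and $$\frac{\partial}{\partial y}\binom{n+1}{p}_{F_s}=sp\binom{n}{p}_{F_s}\ast\left(\sum_{k=0}^{\lfloor (p+1)/2\rfloor-1}(-y)^{sk(n+1)}\left(F_{s(p-2k)(n+1)-1}+\frac{kx}{py}F_{s(p-2k)(n+1)}\right)-\frac{1+(-1)^p}{4}(-y)^{\frac{sp}{2}(n+1)-1}\right),$$ where $\ast$ is convolution of sequences indexed by $n\ge0$.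
   Context: $\mathbb{N}=\{1,2,\dots\}$, $\mathbb{N}'=\mathbb{N}\cup\{0\}$. $x,y$ are indeterminates and we abbreviate $F_n=F_n(x,y)$. The bivariate Fibonacci polynomials are $F_0=0$, $F_1=1$, $F_{n+2}=xF_{n+1}+yF_n$. For $n,k\in\mathbb{N}'$ the bivariate $s$-Fibopolynomial (a polynomial in $x,y$) is $\binom{n}{k}_{F_s}=\frac{F_{sn}F_{s(n-1)}\cdots F_{s(n-k+1)}}{F_sF_{2s}\cdots F_{ks}}$ (equal to $1$ for $k=0$ and $k=n$, and to $0$ if $k>n$). Convolution: $a_n\ast b_n=\sum_{t=0}^na_tb_{n-t}$, where $a_n$, $b_n$ denote whole sequences in $n$. When $p$ is odd the last term, containing $\frac{1+(-1)^p}{4}$, is $0$. -}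

module Defs where

open import Level using (Level; 0ℓ; _⊔_) renaming (suc to lsuc)
open import Algebra.Bundles using (AbelianGroup; CommutativeRing; Semiring)
open import Algebra.Structures
import Algebra.Definitions.RawSemiring as RawSemiringDefs
import Algebra.Properties.CommutativeSemigroup as CommutativeSemigroupProperties
import Algebra.Properties.Group as GroupProperties
import Algebra.Properties.Ring as RingProperties
import Algebra.Properties.Semiring.Mult as SemiringMult
import Algebra.Solver.Ring.NaturalCoefficients.Default as SemiringSolver
open import Data.Empty using (⊥-elim)
open import Data.Fin.Base as Fin using (toℕ)
open import Data.Integer.Base as ℤ using (ℤ; +_)
import Data.Integer.Properties as ℤ
open import Data.List.Base using (List; []; _∷_; map)
open import Data.Nat.Base as ℕ using (ℕ; zero; suc; NonZero)
import Data.Nat.Properties as ℕ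
open import Data.Product.Base using (_,_)
open import Data.Sum.Base using (_⊎_; inj₁; inj₂; [_,_]′)
open import Data.Vec.Functional using (Vector)
open import Function.Base using (_∘_)
open import Relation.Binary.PropositionalEquality as ≡ using (_≡_)
import Relation.Binary.Reasoning.Setoid as SetoidReasoning
open import Relation.Binary.Structures using (IsEquivalence)

record IntegralDomain (c ℓ : Level) : Set (lsuc (c ⊔ ℓ)) where
  field
    commutativeRing : CommutativeRing c ℓ

  open CommutativeRing commutativeRing public

  field
    1≉0            : 1# ≉ 0#
    noZeroDivisors : ∀ x y → x * y ≈ 0# → x ≈ 0# ⊎ y ≈ 0#

  *-≉0 : ∀ {x y} → x ≉ 0# → y ≉ 0# → x * y ≉ 0#
  *-≉0 {x} {y} x≉0 y≉0 xy≈0 = [ x≉0 , y≉0 ]′ (noZeroDivisors x y xy≈0)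

-- The polynomial ring R[t]: a polynomial is the list of its coefficients,
-- constant term first, trailing zeros being allowed.

module Polynomial {c ℓ} (R : CommutativeRing c ℓ) where

  open CommutativeRing R
  open CommutativeSemigroupProperties +-commutativeSemigroup using (interchange)
  open RingProperties ring using (-0#≈0#)

  Poly : Set c
  Poly = List Carrier

  coeff : Poly → ℕ → Carrier
  coeff []      _           = 0#
  coeff (a ∷ _) zero        = a
  coeff (_ ∷ p) (suc i) = coeff p i

  infix 4 _≈ᵖ_

  record _≈ᵖ_ (p q : Poly) : Set ℓ where
    constructor mk≈ᵖ
    field
      coeff-≈ : ∀ i → coeff p i ≈ coeff q i

  open _≈ᵖ_ public

  infixl 6 _+ᵖ_
  infixl 7 _*ᵖ_ _·ᵖ_
  infix  8 -ᵖ_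

  _+ᵖ_ : Poly → Poly → Poly
  []      +ᵖ q       = q
  (a ∷ p) +ᵖ []      = a ∷ p
  (a ∷ p) +ᵖ (b ∷ q) = (a + b) ∷ (p +ᵖ q)

  -ᵖ_ : Poly → Poly
  -ᵖ_ = map (-_)

  _·ᵖ_ : Carrier → Poly → Poly
  a ·ᵖ p = map (a *_) p

  _*ᵖ_ : Poly → Poly → Poly
  []      *ᵖ q = []
  (a ∷ p) *ᵖ q = a ·ᵖ q +ᵖ (0# ∷ p *ᵖ q)

  const : Carrier → Poly
  const a = a ∷ []

  0ᵖ 1ᵖ indeterminate : Poly
  0ᵖ            = []
  1ᵖ            = const 1#
  indeterminate = 0# ∷ 1# ∷ []

  -- d/dt (a + t p) = p + t (dp/dt)
  derivative : Poly → Poly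
  derivative []      = []
  derivative (a ∷ p) = p +ᵖ (0# ∷ derivative p)

  coeff-+ : ∀ p q i → coeff (p +ᵖ q) i ≈ coeff p i + coeff q i
  coeff-+ []      q       i         = sym (+-identityˡ _)
  coeff-+ (a ∷ p) []      i         = sym (+-identityʳ _)
  coeff-+ (a ∷ p) (b ∷ q) zero      = refl
  coeff-+ (a ∷ p) (b ∷ q) (suc i) = coeff-+ p q i

  coeff-neg : ∀ p i → coeff (-ᵖ p) i ≈ - coeff p i
  coeff-neg []      i         = sym -0#≈0#
  coeff-neg (a ∷ p) zero      = refl
  coeff-neg (a ∷ p) (suc i) = coeff-neg p i

  coeff-· : ∀ a p i → coeff (a ·ᵖ p) i ≈ a * coeff p i
  coeff-· a []      i         = sym (zeroʳ a)
  coeff-· a (b ∷ p) zero      = refl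
  coeff-· a (b ∷ p) (suc i) = coeff-· a p i

  ≈ᵖ-isEquivalence : IsEquivalence _≈ᵖ_
  ≈ᵖ-isEquivalence = record
    { refl  = mk≈ᵖ λ i → refl
    ; sym   = λ e → mk≈ᵖ λ i → sym (coeff-≈ e i)
    ; trans = λ e f → mk≈ᵖ λ i → trans (coeff-≈ e i) (coeff-≈ f i)
    }

  +ᵖ-isAbelianGroup : IsAbelianGroup _≈ᵖ_ _+ᵖ_ 0ᵖ -ᵖ_
  +ᵖ-isAbelianGroup = record
    { isGroup = record
      { isMonoid = record
        { isSemigroup = record
          { isMagma = record
            { isEquivalence = ≈ᵖ-isEquivalence
            ; ∙-cong = λ {p} {p′} {q} {q′} e f → mk≈ᵖ λ i →
                trans (coeff-+ p q i)
                  (trans (+-cong (coeff-≈ e i) (coeff-≈ f i)) (sym (coeff-+ p′ q′ i)))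
            }
          ; assoc = λ p q r → mk≈ᵖ λ i →
              trans (trans (coeff-+ (p +ᵖ q) r i) (+-congʳ (coeff-+ p q i)))
                (trans (+-assoc _ _ _)
                  (sym (trans (coeff-+ p (q +ᵖ r) i) (+-congˡ (coeff-+ q r i)))))
          }
        ; identity = (λ p → mk≈ᵖ λ i → refl)
                   , (λ p → mk≈ᵖ λ i → trans (coeff-+ p [] i) (+-identityʳ _))
        }
      ; inverse = (λ p → mk≈ᵖ λ i →
                     trans (coeff-+ (-ᵖ p) p i)
                       (trans (+-congʳ (coeff-neg p i)) (-‿inverseˡ _)))
                , (λ p → mk≈ᵖ λ i →
                     trans (coeff-+ p (-ᵖ p) i)
                       (trans (+-congˡ (coeff-neg p i)) (-‿inverseʳ _)))
      ; ⁻¹-cong = λ {p} {q} e → mk≈ᵖ λ i →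
          trans (coeff-neg p i) (trans (-‿cong (coeff-≈ e i)) (sym (coeff-neg q i)))
      }
    ; comm = λ p q → mk≈ᵖ λ i →
        trans (coeff-+ p q i) (trans (+-comm _ _) (sym (coeff-+ q p i)))
    }

  private
    +ᵖ-abelianGroup : AbelianGroup c ℓ
    +ᵖ-abelianGroup = record { isAbelianGroup = +ᵖ-isAbelianGroup }

    module P = AbelianGroup +ᵖ-abelianGroup
    module PS = CommutativeSemigroupProperties P.commutativeSemigroup
    open SetoidReasoning P.setoid

  ∷-cong : ∀ {a b p q} → a ≈ b → p ≈ᵖ q → (a ∷ p) ≈ᵖ (b ∷ q)
  ∷-cong e f = mk≈ᵖ λ { zero → e ; (suc i) → coeff-≈ f i }

  tail-≈ : ∀ {a b p q} → (a ∷ p) ≈ᵖ (b ∷ q) → p ≈ᵖ q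
  tail-≈ e = mk≈ᵖ λ i → coeff-≈ e (suc i)

  0∷[]≈0 : (0# ∷ []) ≈ᵖ 0ᵖ
  0∷[]≈0 = mk≈ᵖ λ { zero → refl ; (suc i) → refl }

  0∷-+ : ∀ p q → (0# ∷ (p +ᵖ q)) ≈ᵖ ((0# ∷ p) +ᵖ (0# ∷ q))
  0∷-+ p q = ∷-cong (sym (+-identityˡ 0#)) P.refl

  ·-cong : ∀ {a b p q} → a ≈ b → p ≈ᵖ q → a ·ᵖ p ≈ᵖ b ·ᵖ q
  ·-cong {a} {b} {p} {q} e f = mk≈ᵖ λ i →
    trans (coeff-· a p i) (trans (*-cong e (coeff-≈ f i)) (sym (coeff-· b q i)))

  ·-distribˡ : ∀ a p q → a ·ᵖ (p +ᵖ q) ≈ᵖ a ·ᵖ p +ᵖ a ·ᵖ q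
  ·-distribˡ a p q = mk≈ᵖ λ i →
    trans (coeff-· a (p +ᵖ q) i) (trans (*-congˡ (coeff-+ p q i))
      (trans (distribˡ _ _ _) (sym (trans (coeff-+ (a ·ᵖ p) (a ·ᵖ q) i)
        (+-cong (coeff-· a p i) (coeff-· a q i))))))

  ·-distribʳ : ∀ a b p → (a + b) ·ᵖ p ≈ᵖ a ·ᵖ p +ᵖ b ·ᵖ p
  ·-distribʳ a b p = mk≈ᵖ λ i →
    trans (coeff-· (a + b) p i) (trans (distribʳ _ _ _)
      (sym (trans (coeff-+ (a ·ᵖ p) (b ·ᵖ p) i)
        (+-cong (coeff-· a p i) (coeff-· b p i)))))

  ·-assoc : ∀ a b p → (a * b) ·ᵖ p ≈ᵖ a ·ᵖ (b ·ᵖ p)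
  ·-assoc a b p = mk≈ᵖ λ i →
    trans (coeff-· (a * b) p i) (trans (*-assoc _ _ _)
      (sym (trans (coeff-· a (b ·ᵖ p) i) (*-congˡ (coeff-· b p i)))))

  ·-identity : ∀ p → 1# ·ᵖ p ≈ᵖ p
  ·-identity p = mk≈ᵖ λ i → trans (coeff-· 1# p i) (*-identityˡ _)

  ·-zero : ∀ p → 0# ·ᵖ p ≈ᵖ 0ᵖ
  ·-zero p = mk≈ᵖ λ i → trans (coeff-· 0# p i) (zeroˡ _)

  ·-0∷ : ∀ a p → a ·ᵖ (0# ∷ p) ≈ᵖ (0# ∷ a ·ᵖ p)
  ·-0∷ a p = ∷-cong (zeroʳ a) P.refl

  *ᵖ-zeroʳ : ∀ p → p *ᵖ 0ᵖ ≈ᵖ 0ᵖ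
  *ᵖ-zeroʳ []      = P.refl
  *ᵖ-zeroʳ (a ∷ p) = P.trans (∷-cong refl (*ᵖ-zeroʳ p)) 0∷[]≈0

  *ᵖ-congˡ : ∀ p {q r} → q ≈ᵖ r → p *ᵖ q ≈ᵖ p *ᵖ r
  *ᵖ-congˡ []      e = P.refl
  *ᵖ-congˡ (a ∷ p) e = P.∙-cong (·-cong refl e) (∷-cong refl (*ᵖ-congˡ p e))

  *ᵖ-∷ : ∀ p b q → p *ᵖ (b ∷ q) ≈ᵖ b ·ᵖ p +ᵖ (0# ∷ p *ᵖ q)
  *ᵖ-∷ []      b q = P.sym 0∷[]≈0
  *ᵖ-∷ (a ∷ p) b q = ∷-cong (+-congʳ (*-comm a b)) (begin
    a ·ᵖ q +ᵖ p *ᵖ (b ∷ q)               ≈⟨ P.∙-congˡ (*ᵖ-∷ p b q) ⟩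
    a ·ᵖ q +ᵖ (b ·ᵖ p +ᵖ (0# ∷ p *ᵖ q))  ≈⟨ PS.x∙yz≈y∙xz (a ·ᵖ q) (b ·ᵖ p) (0# ∷ p *ᵖ q) ⟩
    b ·ᵖ p +ᵖ (a ·ᵖ q +ᵖ (0# ∷ p *ᵖ q))  ∎)

  *ᵖ-comm : ∀ p q → p *ᵖ q ≈ᵖ q *ᵖ p
  *ᵖ-comm []      q = P.sym (*ᵖ-zeroʳ q)
  *ᵖ-comm (a ∷ p) q =
    P.trans (P.∙-congˡ (∷-cong refl (*ᵖ-comm p q))) (P.sym (*ᵖ-∷ q a p))

  *ᵖ-cong : ∀ {p q r s} → p ≈ᵖ q → r ≈ᵖ s → p *ᵖ r ≈ᵖ q *ᵖ s
  *ᵖ-cong {p} {q} {r} {s} e f = begin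
    p *ᵖ r  ≈⟨ *ᵖ-congˡ p f ⟩
    p *ᵖ s  ≈⟨ *ᵖ-comm p s ⟩
    s *ᵖ p  ≈⟨ *ᵖ-congˡ s e ⟩
    s *ᵖ q  ≈⟨ *ᵖ-comm s q ⟩
    q *ᵖ s  ∎

  *ᵖ-distribˡ : ∀ p q r → p *ᵖ (q +ᵖ r) ≈ᵖ p *ᵖ q +ᵖ p *ᵖ r
  *ᵖ-distribˡ []      q r = P.refl
  *ᵖ-distribˡ (a ∷ p) q r = begin
    a ·ᵖ (q +ᵖ r) +ᵖ (0# ∷ p *ᵖ (q +ᵖ r))
      ≈⟨ P.∙-cong (·-distribˡ a q r)
           (P.trans (∷-cong refl (*ᵖ-distribˡ p q r)) (0∷-+ (p *ᵖ q) (p *ᵖ r))) ⟩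
    (a ·ᵖ q +ᵖ a ·ᵖ r) +ᵖ ((0# ∷ p *ᵖ q) +ᵖ (0# ∷ p *ᵖ r))
      ≈⟨ PS.interchange (a ·ᵖ q) (a ·ᵖ r) (0# ∷ p *ᵖ q) (0# ∷ p *ᵖ r) ⟩
    (a ·ᵖ q +ᵖ (0# ∷ p *ᵖ q)) +ᵖ (a ·ᵖ r +ᵖ (0# ∷ p *ᵖ r)) ∎

  *ᵖ-distribʳ : ∀ p q r → (q +ᵖ r) *ᵖ p ≈ᵖ q *ᵖ p +ᵖ r *ᵖ p
  *ᵖ-distribʳ p q r = begin
    (q +ᵖ r) *ᵖ p        ≈⟨ *ᵖ-comm (q +ᵖ r) p ⟩
    p *ᵖ (q +ᵖ r)        ≈⟨ *ᵖ-distribˡ p q r ⟩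
    p *ᵖ q +ᵖ p *ᵖ r     ≈⟨ P.∙-cong (*ᵖ-comm p q) (*ᵖ-comm p r) ⟩
    q *ᵖ p +ᵖ r *ᵖ p     ∎

  ·-*-assoc : ∀ a p q → (a ·ᵖ p) *ᵖ q ≈ᵖ a ·ᵖ (p *ᵖ q)
  ·-*-assoc a []      q = P.refl
  ·-*-assoc a (b ∷ p) q = begin
    (a * b) ·ᵖ q +ᵖ (0# ∷ (a ·ᵖ p) *ᵖ q)
      ≈⟨ P.∙-cong (·-assoc a b q) (P.trans (∷-cong refl (·-*-assoc a p q))
           (P.sym (·-0∷ a (p *ᵖ q)))) ⟩
    a ·ᵖ (b ·ᵖ q) +ᵖ a ·ᵖ (0# ∷ p *ᵖ q)
      ≈⟨ P.sym (·-distribˡ a (b ·ᵖ q) (0# ∷ p *ᵖ q)) ⟩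
    a ·ᵖ (b ·ᵖ q +ᵖ (0# ∷ p *ᵖ q)) ∎

  *ᵖ-assoc : ∀ p q r → (p *ᵖ q) *ᵖ r ≈ᵖ p *ᵖ (q *ᵖ r)
  *ᵖ-assoc []      q r = P.refl
  *ᵖ-assoc (a ∷ p) q r = begin
    (a ·ᵖ q +ᵖ (0# ∷ p *ᵖ q)) *ᵖ r
      ≈⟨ *ᵖ-distribʳ r (a ·ᵖ q) (0# ∷ p *ᵖ q) ⟩
    (a ·ᵖ q) *ᵖ r +ᵖ (0# ·ᵖ r +ᵖ (0# ∷ (p *ᵖ q) *ᵖ r))
      ≈⟨ P.∙-cong (·-*-assoc a q r)
           (P.trans (P.∙-congʳ (·-zero r)) (∷-cong refl (*ᵖ-assoc p q r))) ⟩
    a ·ᵖ (q *ᵖ r) +ᵖ (0# ∷ p *ᵖ (q *ᵖ r)) ∎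

  *ᵖ-identityˡ : ∀ p → 1ᵖ *ᵖ p ≈ᵖ p
  *ᵖ-identityˡ p =
    P.trans (P.∙-cong (·-identity p) 0∷[]≈0) (P.identityʳ p)

  polynomialRing : CommutativeRing c ℓ
  polynomialRing = record
    { isCommutativeRing = record
      { isRing = record
        { +-isAbelianGroup = +ᵖ-isAbelianGroup
        ; *-cong           = *ᵖ-cong
        ; *-assoc          = *ᵖ-assoc
        ; *-identity       = *ᵖ-identityˡ
                           , λ p → P.trans (*ᵖ-comm p 1ᵖ) (*ᵖ-identityˡ p)
        ; distrib          = *ᵖ-distribˡ , *ᵖ-distribʳ
        }
      ; *-comm = *ᵖ-comm
      }
    }

module PolynomialDomain {c ℓ} (D : IntegralDomain c ℓ) where

  open IntegralDomain D
  open Polynomial commutativeRing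

  private
    module P = CommutativeRing polynomialRing

    head-* : ∀ a p b q → coeff ((a ∷ p) *ᵖ (b ∷ q)) 0 ≈ a * b
    head-* a p b q = +-identityʳ (a * b)

  noZeroDivisorsᵖ : ∀ p q → p *ᵖ q ≈ᵖ 0ᵖ → p ≈ᵖ 0ᵖ ⊎ q ≈ᵖ 0ᵖ
  noZeroDivisorsᵖ []      _ _ = inj₁ P.refl
  noZeroDivisorsᵖ (a ∷ p) = go
    where
    unshift : ∀ {r v} → (0# ∷ r) ≈ᵖ v → v ≈ᵖ 0ᵖ → r ≈ᵖ 0ᵖ
    unshift f e = tail-≈ (P.trans f (P.trans e (P.sym 0∷[]≈0)))

    go : ∀ q → (a ∷ p) *ᵖ q ≈ᵖ 0ᵖ → (a ∷ p) ≈ᵖ 0ᵖ ⊎ q ≈ᵖ 0ᵖ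
    go []      e = inj₂ P.refl
    go (b ∷ q) e = [
      (λ a≈0 → [ (λ p≈0 → inj₁ (P.trans (∷-cong a≈0 p≈0) 0∷[]≈0)) , inj₂ ]′
        (noZeroDivisorsᵖ p (b ∷ q) (unshift
          (P.sym (P.+-congʳ (P.trans (·-cong a≈0 P.refl) (·-zero (b ∷ q))))) e))) ,
      (λ b≈0 → [ inj₁ , (λ q≈0 → inj₂ (P.trans (∷-cong b≈0 q≈0) 0∷[]≈0)) ]′
        (go q (unshift (P.sym (P.trans (*ᵖ-∷ (a ∷ p) b q)
          (P.+-congʳ (P.trans (·-cong b≈0 P.refl) (·-zero (a ∷ p)))))) e))) ]′
      (noZeroDivisors a b (trans (sym (head-* a p b q)) (coeff-≈ e 0)))

  polynomialDomain : IntegralDomain c ℓ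
  polynomialDomain = record
    { commutativeRing = polynomialRing
    ; 1≉0             = λ e → 1≉0 (coeff-≈ e 0)
    ; noZeroDivisors  = noZeroDivisorsᵖ
    }

module FractionField {c ℓ} (D : IntegralDomain c ℓ) where

  open IntegralDomain D
  open GroupProperties +-group using (x∙y⁻¹≈ε⇒x≈y)
  open SetoidReasoning setoid
  open RingProperties ring using (-‿distribˡ-*; x[y-z]≈xy-xz)
  open SemiringSolver commutativeSemiring
    using (solve) renaming (_:=_ to infix 4 _⊜_; _:+_ to _⊕_; _:*_ to _⊗_)

  infix 7 _/_[_]

  record Fraction : Set (c ⊔ ℓ) where
    constructor _/_[_]
    field
      num   : Carrier
      den   : Carrier
      den≉0 : den ≉ 0#

  open Fraction public

  infix  4 _≃_
  infixl 6 _+ᶠ_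
  infixl 7 _*ᶠ_
  infix  8 -ᶠ_

  record _≃_ (u v : Fraction) : Set ℓ where
    constructor mk≃
    field
      cross : num u * den v ≈ num v * den u

  open _≃_ public

  embed : Carrier → Fraction
  embed a = a / 1# [ 1≉0 ]

  _+ᶠ_ : Fraction → Fraction → Fraction
  (a / b [ b≉0 ]) +ᶠ (c / d [ d≉0 ]) = (a * d + c * b) / b * d [ *-≉0 b≉0 d≉0 ]

  _*ᶠ_ : Fraction → Fraction → Fraction
  (a / b [ b≉0 ]) *ᶠ (c / d [ d≉0 ]) = (a * c) / b * d [ *-≉0 b≉0 d≉0 ]

  -ᶠ_ : Fraction → Fraction
  -ᶠ (a / b [ b≉0 ]) = (- a) / b [ b≉0 ]

  -- Extension of a derivation of D by the quotient rule.
  quotientRule : (Carrier → Carrier) → Fraction → Fraction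
  quotientRule ∂ (a / b [ b≉0 ]) = (∂ a * b - a * ∂ b) / b * b [ *-≉0 b≉0 b≉0 ]

  private
    cancel : ∀ {k a b} → k ≉ 0# → k * a ≈ k * b → a ≈ b
    cancel {k} {a} {b} k≉0 e =
      [ (λ k≈0 → ⊥-elim (k≉0 k≈0)) , x∙y⁻¹≈ε⇒x≈y a b ]′
        (noZeroDivisors k (a - b) (trans
          (x[y-z]≈xy-xz k a b)
          (trans (+-congʳ e) (-‿inverseʳ _))))

  ≃-trans : ∀ {u v w} → u ≃ v → v ≃ w → u ≃ w
  ≃-trans {a / b [ _ ]} {c / d [ d≉0 ]} {e / f [ _ ]} (mk≃ ad≈cb) (mk≃ cf≈ed) =
    mk≃ (cancel d≉0 (begin
      d * (a * f)  ≈⟨ solve 3 (λ d a f → d ⊗ (a ⊗ f) ⊜ a ⊗ d ⊗ f) refl d a f ⟩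
      a * d * f    ≈⟨ *-congʳ ad≈cb ⟩
      c * b * f    ≈⟨ solve 3 (λ c b f → c ⊗ b ⊗ f ⊜ c ⊗ f ⊗ b) refl c b f ⟩
      c * f * b    ≈⟨ *-congʳ cf≈ed ⟩
      e * d * b    ≈⟨ solve 3 (λ e d b → e ⊗ d ⊗ b ⊜ d ⊗ (e ⊗ b)) refl e d b ⟩
      d * (e * b)  ∎))

  +ᶠ-cong : ∀ {u u′ v v′} → u ≃ u′ → v ≃ v′ → u +ᶠ v ≃ u′ +ᶠ v′
  +ᶠ-cong {a / b [ _ ]} {a′ / b′ [ _ ]} {c / d [ _ ]} {c′ / d′ [ _ ]} (mk≃ e) (mk≃ f) =
    mk≃ (begin
      (a * d + c * b) * (b′ * d′)
        ≈⟨ solve 6 (λ a b c d b′ d′ → (a ⊗ d ⊕ c ⊗ b) ⊗ (b′ ⊗ d′)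
             ⊜ (a ⊗ b′) ⊗ (d ⊗ d′) ⊕ (c ⊗ d′) ⊗ (b ⊗ b′)) refl a b c d b′ d′ ⟩
      (a * b′) * (d * d′) + (c * d′) * (b * b′)
        ≈⟨ +-cong (*-congʳ e) (*-congʳ f) ⟩
      (a′ * b) * (d * d′) + (c′ * d) * (b * b′)
        ≈⟨ solve 6 (λ a′ b c′ d b′ d′ → (a′ ⊗ b) ⊗ (d ⊗ d′) ⊕ (c′ ⊗ d) ⊗ (b ⊗ b′)
             ⊜ (a′ ⊗ d′ ⊕ c′ ⊗ b′) ⊗ (b ⊗ d)) refl a′ b c′ d b′ d′ ⟩
      (a′ * d′ + c′ * b′) * (b * d) ∎)

  *ᶠ-cong : ∀ {u u′ v v′} → u ≃ u′ → v ≃ v′ → u *ᶠ v ≃ u′ *ᶠ v′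
  *ᶠ-cong {a / b [ _ ]} {a′ / b′ [ _ ]} {c / d [ _ ]} {c′ / d′ [ _ ]} (mk≃ e) (mk≃ f) =
    mk≃ (begin
      (a * c) * (b′ * d′)
        ≈⟨ solve 4 (λ a c b′ d′ → (a ⊗ c) ⊗ (b′ ⊗ d′) ⊜ (a ⊗ b′) ⊗ (c ⊗ d′))
             refl a c b′ d′ ⟩
      (a * b′) * (c * d′)
        ≈⟨ *-cong e f ⟩
      (a′ * b) * (c′ * d)
        ≈⟨ solve 4 (λ a′ b c′ d → (a′ ⊗ b) ⊗ (c′ ⊗ d) ⊜ (a′ ⊗ c′) ⊗ (b ⊗ d))
             refl a′ b c′ d ⟩
      (a′ * c′) * (b * d) ∎)

  -ᶠ-cong : ∀ {u v} → u ≃ v → -ᶠ u ≃ -ᶠ v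
  -ᶠ-cong {a / b [ _ ]} {c / d [ _ ]} (mk≃ e) = mk≃ (begin
    - a * d    ≈⟨ sym (-‿distribˡ-* a d) ⟩
    - (a * d)  ≈⟨ -‿cong e ⟩
    - (c * b)  ≈⟨ -‿distribˡ-* c b ⟩
    - c * b    ∎)

  fractionField : CommutativeRing (c ⊔ ℓ) ℓ
  fractionField = record
    { Carrier = Fraction
    ; _≈_ = _≃_
    ; _+_ = _+ᶠ_
    ; _*_ = _*ᶠ_
    ; -_  = -ᶠ_
    ; 0#  = embed 0#
    ; 1#  = embed 1#
    ; isCommutativeRing = record
      { isRing = record
        { +-isAbelianGroup = record
          { isGroup = record
            { isMonoid = record
              { isSemigroup = record
                { isMagma = record
                  { isEquivalence = record
                    { refl  = mk≃ refl
                    ; sym   = λ (mk≃ e) → mk≃ (sym e)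
                    ; trans = ≃-trans
                    }
                  ; ∙-cong = +ᶠ-cong
                  }
                ; assoc = λ (a / b [ _ ]) (c / d [ _ ]) (e / f [ _ ]) → mk≃
                    (solve 6 (λ a b c d e f →
                      ((a ⊗ d ⊕ c ⊗ b) ⊗ f ⊕ e ⊗ (b ⊗ d)) ⊗ (b ⊗ (d ⊗ f))
                      ⊜ (a ⊗ (d ⊗ f) ⊕ (c ⊗ f ⊕ e ⊗ d) ⊗ b) ⊗ (b ⊗ d ⊗ f))
                      refl a b c d e f)
                }
              ; identity = (λ (a / b [ _ ]) → mk≃ (*-cong
                             (trans (+-cong (zeroˡ b) (*-identityʳ a)) (+-identityˡ a))
                             (sym (*-identityˡ b))))
                         , (λ (a / b [ _ ]) → mk≃ (*-cong
                             (trans (+-cong (*-identityʳ a) (zeroˡ b)) (+-identityʳ a))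
                             (sym (*-identityʳ b))))
              }
            ; inverse = (λ (a / b [ _ ]) → mk≃ (trans (*-identityʳ _)
                          (trans (trans (sym (distribʳ b (- a) a))
                            (trans (*-congʳ (-‿inverseˡ a)) (zeroˡ b))) (sym (zeroˡ _)))))
                      , (λ (a / b [ _ ]) → mk≃ (trans (*-identityʳ _)
                          (trans (trans (sym (distribʳ b a (- a)))
                            (trans (*-congʳ (-‿inverseʳ a)) (zeroˡ b))) (sym (zeroˡ _)))))
            ; ⁻¹-cong = -ᶠ-cong
            }
          ; comm = λ (a / b [ _ ]) (c / d [ _ ]) → mk≃
              (*-cong (+-comm _ _) (*-comm d b))
          }
        ; *-cong  = *ᶠ-cong
        ; *-assoc = λ (a / b [ _ ]) (c / d [ _ ]) (e / f [ _ ]) → mk≃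
            (*-cong (*-assoc a c e) (sym (*-assoc b d f)))
        ; *-identity = (λ (a / b [ _ ]) → mk≃
                         (*-cong (*-identityˡ a) (sym (*-identityˡ b))))
                     , (λ (a / b [ _ ]) → mk≃
                         (*-cong (*-identityʳ a) (sym (*-identityʳ b))))
        ; distrib = (λ (a / b [ _ ]) (c / d [ _ ]) (e / f [ _ ]) → mk≃
                      (solve 6 (λ a b c d e f →
                        a ⊗ (c ⊗ f ⊕ e ⊗ d) ⊗ (b ⊗ d ⊗ (b ⊗ f))
                        ⊜ ((a ⊗ c) ⊗ (b ⊗ f) ⊕ (a ⊗ e) ⊗ (b ⊗ d)) ⊗ (b ⊗ (d ⊗ f)))
                        refl a b c d e f))
                  , (λ (a / b [ _ ]) (c / d [ _ ]) (e / f [ _ ]) → mk≃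
                      (solve 6 (λ a b c d e f →
                        (c ⊗ f ⊕ e ⊗ d) ⊗ a ⊗ (d ⊗ b ⊗ (f ⊗ b))
                        ⊜ ((c ⊗ a) ⊗ (f ⊗ b) ⊕ (e ⊗ a) ⊗ (d ⊗ b)) ⊗ (d ⊗ f ⊗ b))
                        refl a b c d e f))
        }
      ; *-comm = λ (a / b [ _ ]) (c / d [ _ ]) → mk≃ (*-cong (*-comm a c) (*-comm d b))
      }
    }

ℤ-domain : IntegralDomain 0ℓ 0ℓ
ℤ-domain = record
  { commutativeRing = ℤ.+-*-commutativeRing
  ; 1≉0             = λ ()
  ; noZeroDivisors  = λ i j → ℤ.i*j≡0⇒i≡0∨j≡0 i
  }

-- ℤ[x,y] is built as ℤ[x][y], and the field ℚ(x,y) as its field of fractions.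

module ℤ[x] where
  open Polynomial ℤ.+-*-commutativeRing public
  open PolynomialDomain ℤ-domain public

module ℤ[x,y] where
  open Polynomial ℤ[x].polynomialRing public
  open PolynomialDomain ℤ[x].polynomialDomain public
  open IntegralDomain polynomialDomain public
    using ( Carrier; _≈_; _≉_; _+_; _*_; _-_; -_; 0#; 1#; 1≉0; *-≉0; semiring
          ; sym; trans )
  open RawSemiringDefs (Semiring.rawSemiring semiring) public
    using (_^_; sum; product) renaming (_×_ to _·_)

  x y : Carrier
  x = const ℤ[x].indeterminate
  y = indeterminate

  ∂/∂x ∂/∂y : Carrier → Carrier
  ∂/∂x = map ℤ[x].derivative
  ∂/∂y = derivative

  F : ℕ → Carrier
  F 0             = 0#
  F 1             = 1#
  F (suc (suc n)) = x * F (suc n) + y * F n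

  y≉0 : y ≉ 0#
  y≉0 e with () ← ℤ[x].coeff-≈ (coeff-≈ e 1) 0

  ·-≉0 : ∀ n .{{_ : NonZero n}} {a} → a ≉ 0# → n · a ≉ 0#
  ·-≉0 n {a} a≉0 na≈0 = *-≉0 n·1≉0 a≉0
    (trans (SemiringMult.×-assoc-* semiring n 1# a)
      (trans (SemiringMult.×-congʳ semiring n (IntegralDomain.*-identityˡ polynomialDomain a))
        na≈0))
    where
    constantTerm : Carrier → ℤ
    constantTerm p = ℤ[x].coeff (coeff p 0) 0

    constantTerm-·1 : ∀ m → constantTerm (m · 1#) ≡ + m
    constantTerm-·1 zero      = ≡.refl
    constantTerm-·1 (suc m) =
      ≡.trans (ℤ[x].coeff-≈ (coeff-+ 1# (m · 1#) 0) 0)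
        (≡.trans (ℤ[x].coeff-+ (ℤ[x].1ᵖ) (coeff (m · 1#) 0) 0)
          (≡.cong (λ z → + 1 ℤ.+ z) (constantTerm-·1 m)))

    n·1≉0 : n · 1# ≉ 0#
    n·1≉0 e = ℕ.≢-nonZero⁻¹ n (ℤ.+-injective
      (≡.trans (≡.sym (constantTerm-·1 n)) (ℤ[x].coeff-≈ (coeff-≈ e 0) 0)))

  -- Fₙ(x,0) = xⁿ⁻¹ for n ≥ 1.
  F≉0 : ∀ n .{{_ : NonZero n}} → F n ≉ 0#
  F≉0 (suc n) e = at0 n (coeff-≈ e 0)
    where
    module X = IntegralDomain ℤ[x].polynomialDomain

    xX≉0 : ℤ[x].indeterminate X.≉ X.0#
    xX≉0 e with () ← ℤ[x].coeff-≈ e 1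

    coeff₀-x* : ∀ p → coeff (x * p) 0 X.≈ ℤ[x].indeterminate X.* coeff p 0
    coeff₀-x* p = X.trans (coeff-+ (ℤ[x].indeterminate ·ᵖ p) (X.0# ∷ 0ᵖ) 0)
      (X.trans (X.+-cong (coeff-· ℤ[x].indeterminate p 0) X.refl) (X.+-identityʳ _))

    coeff₀-y* : ∀ p → coeff (y * p) 0 X.≈ X.0#
    coeff₀-y* p = X.trans (coeff-+ (X.0# ·ᵖ p) (X.0# ∷ (X.1# ∷ []) *ᵖ p) 0)
      (X.trans (X.+-identityʳ _) (X.trans (coeff-· X.0# p 0) (X.zeroˡ (coeff p 0))))

    at0 : ∀ n → coeff (F (suc n)) 0 X.≉ X.0#
    at0 zero      e = X.1≉0 e
    at0 (suc n) e = X.*-≉0 xX≉0 (at0 n)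
      (X.trans (X.sym (coeff₀-x* (F (suc n))))
        (X.trans (X.sym (X.+-identityʳ _))
          (X.trans (X.+-congˡ (X.sym (coeff₀-y* (F n))))
            (X.trans (X.sym (coeff-+ (x * F (suc n)) (y * F n) 0)) e))))

  product≉0 : ∀ {k} (v : Vector Carrier k) → (∀ i → v i ≉ 0#) → product v ≉ 0#
  product≉0 {zero}    v v≉0 = 1≉0
  product≉0 {suc k} v v≉0 =
    *-≉0 (v≉0 Fin.zero) (product≉0 (v ∘ Fin.suc) (v≉0 ∘ Fin.suc))

module ℚ⟨x,y⟩ where
  open FractionField ℤ[x,y].polynomialDomain public
  open CommutativeRing fractionField public
    using (Carrier; _≈_; _+_; _*_; _-_; -_; 0#; 1#; semiring)
  open RawSemiringDefs (Semiring.rawSemiring semiring) public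
    using (_^_; sum) renaming (_×_ to _·_)

  x y : Carrier
  x = embed ℤ[x,y].x
  y = embed ℤ[x,y].y

  ∂/∂x ∂/∂y : Carrier → Carrier
  ∂/∂x = quotientRule ℤ[x,y].∂/∂x
  ∂/∂y = quotientRule ℤ[x,y].∂/∂y

  F : ℕ → Carrier
  F n = embed (ℤ[x,y].F n)

  -- This element of ℚ(x,y) happens to be a polynomial; it is kept as a quotient.
  -- For k > n the truncated subtraction is harmless: the factor with i = n is
  -- F 0 = 0, so the numerator vanishes.
  fibopolynomial : (s : ℕ) .{{_ : NonZero s}} → (n k : ℕ) → Carrier
  fibopolynomial s n k =
    ℤ[x,y].product {k} (λ i → ℤ[x,y].F (s ℕ.* (n ℕ.∸ toℕ i)))
      / ℤ[x,y].product {k} (λ i → ℤ[x,y].F (s ℕ.* suc (toℕ i)))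
      [ ℤ[x,y].product≉0 {k} _ (λ i → ℤ[x,y].F≉0 (s ℕ.* suc (toℕ i))
          {{ℕ.m*n≢0 s (suc (toℕ i))}}) ]

  sumBelow : ℕ → (ℕ → Carrier) → Carrier
  sumBelow n a = sum {n} (a ∘ toℕ)

  infix 5 sumBelow
  syntax sumBelow n (λ k → a) = ∑[ k < n ] a

  infixl 7 _∗_

  _∗_ : (ℕ → Carrier) → (ℕ → Carrier) → ℕ → Carrier
  (a ∗ b) n = ∑[ t < suc n ] a t * b (n ℕ.∸ t)

module ℙ = ℤ[x,y]

{-# OPTIONS --safe #-}

-- Let αβ = -y and α + β = x. The power series G = ∑ₙ C(n,p) zⁿ of the s-Fibopolynomials is
-- zᵖ / ∏ⱼ (1 - α^(sj) β^(s(p-j)) z). Pairing j with p - j turns the denominator into a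
-- product of quadratics 1 - t z + q z² over ℤ[x,y], times one linear factor if p is
-- even. For a derivation ∂, applied to coefficients, ∂G / G is therefore minus the sum of
-- the logarithmic derivatives of these factors, and the n-th coefficient of such a
-- logarithmic derivative satisfies the recurrence with characteristic polynomial
-- λ² - t λ + q: it is an explicit combination of Fibonacci polynomials. The formulas of the
-- theorem are this convolution identity for ∂/∂x and y ∂/∂y.
module Submission where

open import Algebra.Bundles using (CommutativeRing; Semiring)
import Algebra.Definitions.RawSemiring as RawSemiringDefs
import Algebra.Properties.AbelianGroup as AbelianGroupProperties
import Algebra.Properties.CommutativeMonoid.Mult as CommutativeMonoidMult
import Algebra.Properties.CommutativeSemigroup as CommutativeSemigroupProperties
import Algebra.Properties.Group as GroupProperties
import Algebra.Properties.Ring as RingProperties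
import Algebra.Properties.Semiring.Exp as SemiringExp
import Algebra.Properties.Semiring.Mult as SemiringMult
import Algebra.Properties.Semiring.Mult.TCOptimised as SemiringMultTCO
import Algebra.Solver.Ring as RingSolver
open import Algebra.Solver.Ring.AlmostCommutativeRing using (fromCommutativeRing; _-Raw-AlmostCommutative⟶_)
open import Data.Empty using (⊥-elim)
open import Data.Fin.Base as Fin using (toℕ)
open import Data.Integer.Base as ℤ using (ℤ; +_; -[1+_]; _⊖_; _◃_)
import Data.Integer.Properties as ℤ
open import Data.List.Base using ([]; _∷_; map)
open import Data.Maybe.Base using (Maybe; just; nothing)
open import Data.Nat.Base as ℕ using (ℕ; zero; suc; z≤n; s≤s; NonZero; ⌊_/2⌋; _∸_)
import Data.Nat.Properties as ℕ
open import Data.Product.Base using (_,_)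
import Data.Sign.Base as Sign
open import Data.Sum.Base using (_⊎_; inj₁; inj₂; [_,_]′)
open import Data.Vec.Functional using (Vector)
open import Defs
open import Function.Base using (_∘_; it)
open import Level using (_⊔_)
open import Relation.Binary.PropositionalEquality as ≡ using (_≡_)
import Relation.Binary.Reasoning.Setoid as SetoidReasoning
open import Relation.Nullary using (yes; no)

-- The roots α and β do not lie in ℚ(x,y). Expressions symmetric in them are therefore written in
-- the coordinates of αⁿ, and the product formula for G is proved by induction from p to p + 2: the
-- factor with eigenvalues α^(s(p+2)) and β^(s(p+2)) is split off, and what remains is the
-- denominator for p with z replaced by (αβ)^s z. This would bring in the power (αβ)^(-sp);
-- multiplying by (αβ)^(sp) and cancelling it at the end avoids negative exponents. One computation
-- serves both variables because a derivation with D x = ξ and D y = η y has the powers of - y as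
-- eigenvectors: ∂/∂x has ξ = 1, η = 0, and y ∂/∂y has ξ = 0, η = 1. The factor sp in the second
-- formula is the exponent in λμ = (αβ)^(sp), which is the same for every pair of eigenvalues λ, μ.
-- The index n + 1 there has its origin at m = 0: a logarithmic derivative of a series with constant
-- term 1 has no constant term, while the closed form would contain (-y)^(-1).

-- Integer coefficients, unlike natural ones, let the solver cancel x against - x.
module IntegerCoefficients {c ℓ} (R : CommutativeRing c ℓ) where
  open CommutativeRing R
  open RingProperties ring
  open AbelianGroupProperties +-abelianGroup using (⁻¹-∙-comm)
  open CommutativeSemigroupProperties +-commutativeSemigroup using (interchange)
  open SemiringMultTCO semiring
  open SetoidReasoning setoid

  fromℤ : ℤ → Carrier
  fromℤ (+ n)    = n × 1#
  fromℤ -[1+ n ] = - (suc n × 1#)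

  private
    fromℤ-⊖ : ∀ m n → fromℤ (m ⊖ n) ≈ m × 1# - n × 1#
    fromℤ-⊖ zero    zero    = sym (-‿inverseʳ 0#)
    fromℤ-⊖ zero    (suc n) = sym (+-identityˡ _)
    fromℤ-⊖ (suc m) zero    = sym (trans (+-congˡ -0#≈0#) (+-identityʳ _))
    fromℤ-⊖ (suc m) (suc n) = begin
      fromℤ (suc m ⊖ suc n)                      ≡⟨ ≡.cong fromℤ (ℤ.[1+m]⊖[1+n]≡m⊖n m n) ⟩
      fromℤ (m ⊖ n)                              ≈⟨ fromℤ-⊖ m n ⟩
      m × 1# - n × 1#                            ≈⟨ +-identityˡ _ ⟨
      0# + (m × 1# - n × 1#)                     ≈⟨ +-congʳ (-‿inverseʳ 1#) ⟨
      (1# - 1#) + (m × 1# - n × 1#)              ≈⟨ interchange 1# (- 1#) (m × 1#) (- (n × 1#)) ⟩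
      (1# + m × 1#) + (- 1# - n × 1#)            ≈⟨ +-cong (sym (1+× m 1#))
          (trans (⁻¹-∙-comm 1# (n × 1#)) (-‿cong (sym (1+× n 1#)))) ⟩
      suc m × 1# - suc n × 1#                    ∎

    fromℤ-+ : ∀ i j → fromℤ (i ℤ.+ j) ≈ fromℤ i + fromℤ j
    fromℤ-+ (+ m)    (+ n)    = ×-homo-+ 1# m n
    fromℤ-+ (+ m)    -[1+ n ] = fromℤ-⊖ m (suc n)
    fromℤ-+ -[1+ m ] (+ n)    = trans (fromℤ-⊖ n (suc m)) (+-comm _ _)
    fromℤ-+ -[1+ m ] -[1+ n ] = begin
      - (suc (suc (m ℕ.+ n)) × 1#)        ≡⟨ ≡.cong (λ k → - (k × 1#)) (≡.cong suc (≡.sym (ℕ.+-suc m n))) ⟩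
      - ((suc m ℕ.+ suc n) × 1#)          ≈⟨ -‿cong (×-homo-+ 1# (suc m) (suc n)) ⟩
      - (suc m × 1# + suc n × 1#)         ≈⟨ ⁻¹-∙-comm _ _ ⟨
      - (suc m × 1#) - suc n × 1#         ∎

    fromℤ-neg : ∀ i → fromℤ (ℤ.- i) ≈ - fromℤ i
    fromℤ-neg (+ zero)    = sym -0#≈0#
    fromℤ-neg (+ (suc n)) = refl
    fromℤ-neg -[1+ n ]    = sym (-‿involutive _)

    fromℤ-- : ∀ n → fromℤ (Sign.- ◃ n) ≈ - (n × 1#)
    fromℤ-- zero    = sym -0#≈0#
    fromℤ-- (suc n) = refl

    fromℤ-◃ : ∀ n → fromℤ (Sign.+ ◃ n) ≈ n × 1#
    fromℤ-◃ zero    = refl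
    fromℤ-◃ (suc n) = refl

    fromℤ-* : ∀ i j → fromℤ (i ℤ.* j) ≈ fromℤ i * fromℤ j
    fromℤ-* (+ m)    (+ n)    = trans (fromℤ-◃ (m ℕ.* n)) (×1-homo-* m n)
    fromℤ-* (+ m)    -[1+ n ] = trans (fromℤ-- (m ℕ.* suc n))
        (trans (-‿cong (×1-homo-* m (suc n))) (-‿distribʳ-* _ _))
    fromℤ-* -[1+ m ] (+ n)    = trans (fromℤ-- (suc m ℕ.* n))
        (trans (-‿cong (×1-homo-* (suc m) n)) (-‿distribˡ-* _ _))
    fromℤ-* -[1+ m ] -[1+ n ] = trans (fromℤ-◃ (suc m ℕ.* suc n))
        (trans (×1-homo-* (suc m) (suc n)) (sym (-x*-y≈x*y _ _)))
      where
      -x*-y≈x*y : ∀ x y → - x * - y ≈ x * y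
      -x*-y≈x*y x y = trans (sym (-‿distribˡ-* x (- y)))
          (trans (-‿cong (sym (-‿distribʳ-* x y))) (-‿involutive _))

    homomorphism : CommutativeRing.rawRing ℤ.+-*-commutativeRing -Raw-AlmostCommutative⟶ fromCommutativeRing R
    homomorphism = record
      { ⟦_⟧    = fromℤ
      ; +-homo = fromℤ-+
      ; *-homo = fromℤ-*
      ; -‿homo = fromℤ-neg
      ; 0-homo = refl
      ; 1-homo = refl
      }

    equal? : ∀ i j → Maybe (fromℤ i ≈ fromℤ j)
    equal? i j with i ℤ.≟ j
    ... | yes i≡j = just (reflexive (≡.cong fromℤ i≡j))
    ... | no _    = nothing

  open RingSolver _ _ homomorphism equal? public
    using (solve; con) renaming (_:=_ to infix 4 _⊜_; _:+_ to infixl 6 _⊕_; _:*_ to infixl 7 _⊗_; :-_ to infix 8 ⊝_)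

-- Formal power series in z over a commutative ring.

module PowerSeries {c ℓ} (R : CommutativeRing c ℓ) where
  open CommutativeRing R
  open CommutativeSemigroupProperties +-commutativeSemigroup using (interchange)
  open RawSemiringDefs (Semiring.rawSemiring semiring) using (sum)
  open SetoidReasoning setoid
  open IntegerCoefficients R

  Series : Set c
  Series = ℕ → Carrier

  infix 4 _≋_

  record _≋_ (a b : Series) : Set ℓ where
    constructor mk≋
    field
      at : ∀ n → a n ≈ b n

  open _≋_ public

  infixl 6 _⊞_
  infixl 7 _∗_ _•_

  _⊞_ : Series → Series → Series
  (a ⊞ b) n = a n + b n

  _•_ : Carrier → Series → Series
  (k • a) n = k * a n

  opaque
    _∗_ : Series → Series → Series
    (a ∗ b) n = sum {suc n} (λ i → a (toℕ i) * b (n ∸ toℕ i))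

    ∗-def : ∀ a b n → (a ∗ b) n ≈ sum {suc n} (λ i → a (toℕ i) * b (n ∸ toℕ i))
    ∗-def a b n = refl

  1ˢ : Series
  1ˢ zero    = 1#
  1ˢ (suc n) = 0#

  tail : Series → Series
  tail a n = a (suc n)

  opaque
    unfolding _∗_

    -- Unfolding the sum gives `(a ∗ b) (suc n)` as `a 0 * b (suc n) + (tail a ∗ b) n` by
    -- computation, so the laws of convolution are inductions on n that generalize over the left
    -- series.
    ∗-cong-at : ∀ {a a′ b b′} → (∀ n → a n ≈ a′ n) → (∀ n → b n ≈ b′ n) → ∀ n → (a ∗ b) n ≈ (a′ ∗ b′) n
    ∗-cong-at e f zero    = +-congʳ (*-cong (e 0) (f 0))
    ∗-cong-at e f (suc n) = +-cong (*-cong (e 0) (f (suc n))) (∗-cong-at (e ∘ suc) f n)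

    ∗-zeroˡ-at : ∀ {a} b → (∀ n → a n ≈ 0#) → ∀ n → (a ∗ b) n ≈ 0#
    ∗-zeroˡ-at b e zero    = trans (+-identityʳ _) (trans (*-congʳ (e 0)) (zeroˡ _))
    ∗-zeroˡ-at b e (suc n) =
      trans (+-cong (trans (*-congʳ (e 0)) (zeroˡ _)) (∗-zeroˡ-at b (e ∘ suc) n)) (+-identityˡ 0#)

    ∗-distribʳ-at : ∀ c a b n → ((a ⊞ b) ∗ c) n ≈ (a ∗ c) n + (b ∗ c) n
    ∗-distribʳ-at c a b zero    =
      trans (+-cong (distribʳ _ _ _) (sym (+-identityˡ 0#))) (interchange _ _ _ _)
    ∗-distribʳ-at c a b (suc n) =
      trans (+-cong (distribʳ _ _ _) (∗-distribʳ-at c (tail a) (tail b) n)) (interchange _ _ _ _)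

    •-∗-at : ∀ k a b n → ((k • a) ∗ b) n ≈ k * (a ∗ b) n
    •-∗-at k a b zero    =
      trans (+-cong (*-assoc _ _ _) (sym (zeroʳ k))) (sym (distribˡ _ _ _))
    •-∗-at k a b (suc n) =
      trans (+-cong (*-assoc _ _ _) (•-∗-at k (tail a) b n)) (sym (distribˡ _ _ _))

    ∗-assoc-at : ∀ a b c n → ((a ∗ b) ∗ c) n ≈ (a ∗ (b ∗ c)) n
    ∗-assoc-at a b c zero    = +-congʳ (begin
      (a 0 * b 0 + 0#) * c 0  ≈⟨ *-congʳ (+-identityʳ _) ⟩
      a 0 * b 0 * c 0         ≈⟨ *-assoc _ _ _ ⟩
      a 0 * (b 0 * c 0)       ≈⟨ *-congˡ (+-identityʳ _) ⟨
      a 0 * (b 0 * c 0 + 0#)  ∎)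
    ∗-assoc-at a b c (suc n) = begin
      (a 0 * b 0 + 0#) * c (suc n) + ((a 0 • tail b ⊞ tail a ∗ b) ∗ c) n
        ≈⟨ +-cong (trans (*-congʳ (+-identityʳ _)) (*-assoc _ _ _))
             (∗-distribʳ-at c (a 0 • tail b) (tail a ∗ b) n) ⟩
      a 0 * (b 0 * c (suc n)) + (((a 0 • tail b) ∗ c) n + ((tail a ∗ b) ∗ c) n)
        ≈⟨ +-congˡ (+-cong (•-∗-at (a 0) (tail b) c n) (∗-assoc-at (tail a) b c n)) ⟩
      a 0 * (b 0 * c (suc n)) + (a 0 * (tail b ∗ c) n + (tail a ∗ (b ∗ c)) n)
        ≈⟨ +-assoc _ _ _ ⟨
      a 0 * (b 0 * c (suc n)) + a 0 * (tail b ∗ c) n + (tail a ∗ (b ∗ c)) n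
        ≈⟨ +-congʳ (distribˡ _ _ _) ⟨
      a 0 * (b ∗ c) (suc n) + (tail a ∗ (b ∗ c)) n ∎

    -- Peels off the last summand where unfolding peels off the first. Commutativity compares the
    -- two, and the passage to n + 1 in the formula for ∂/∂y uses it again.
    ∗-suc : ∀ a b n → (a ∗ b) (suc n) ≈ (a ∗ tail b) n + a (suc n) * b 0
    ∗-suc a b zero    = trans (+-congˡ (+-identityʳ _)) (+-congʳ (sym (+-identityʳ _)))
    ∗-suc a b (suc n) = trans (+-congˡ (∗-suc (tail a) b n)) (sym (+-assoc _ _ _))

    ∗-comm-at : ∀ a b n → (a ∗ b) n ≈ (b ∗ a) n
    ∗-comm-at a b zero    = +-congʳ (*-comm _ _)
    ∗-comm-at a b (suc n) = trans (+-comm _ _)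
      (trans (+-cong (∗-comm-at (tail a) b n) (*-comm _ _)) (sym (∗-suc b a n)))

    ∗-identityˡ-at : ∀ a n → (1ˢ ∗ a) n ≈ a n
    ∗-identityˡ-at a zero    = trans (+-identityʳ _) (*-identityˡ _)
    ∗-identityˡ-at a (suc n) =
      trans (+-cong (*-identityˡ _) (∗-zeroˡ-at a (λ _ → refl) n)) (+-identityʳ _)

  seriesRing : CommutativeRing c ℓ
  seriesRing = record
    { Carrier = Series
    ; _≈_     = _≋_
    ; _+_     = _⊞_
    ; _*_     = _∗_
    ; -_      = λ a n → - a n
    ; 0#      = λ _ → 0#
    ; 1#      = 1ˢ
    ; isCommutativeRing = record
      { isRing = record
        { +-isAbelianGroup = record
          { isGroup = record
            { isMonoid = record
              { isSemigroup = record
                { isMagma = record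
                  { isEquivalence = record
                    { refl  = mk≋ λ _ → refl
                    ; sym   = λ e → mk≋ λ n → sym (at e n)
                    ; trans = λ e f → mk≋ λ n → trans (at e n) (at f n)
                    }
                  ; ∙-cong = λ e f → mk≋ λ n → +-cong (at e n) (at f n)
                  }
                ; assoc = λ a b c → mk≋ λ n → +-assoc _ _ _
                }
              ; identity = (λ a → mk≋ λ n → +-identityˡ _) , (λ a → mk≋ λ n → +-identityʳ _)
              }
            ; inverse = (λ a → mk≋ λ n → -‿inverseˡ _) , (λ a → mk≋ λ n → -‿inverseʳ _)
            ; ⁻¹-cong = λ e → mk≋ λ n → -‿cong (at e n)
            }
          ; comm = λ a b → mk≋ λ n → +-comm _ _
          }
        ; *-cong     = λ e f → mk≋ (∗-cong-at (at e) (at f))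
        ; *-assoc    = λ a b c → mk≋ (∗-assoc-at a b c)
        ; *-identity = (λ a → mk≋ (∗-identityˡ-at a))
                     , (λ a → mk≋ λ n → trans (∗-comm-at a 1ˢ n) (∗-identityˡ-at a n))
        ; distrib    = (λ a b c → mk≋ λ n → trans (∗-comm-at a (b ⊞ c) n)
                          (trans (∗-distribʳ-at a b c n) (+-cong (∗-comm-at b a n) (∗-comm-at c a n))))
                     , (λ c a b → mk≋ (∗-distribʳ-at c a b))
        }
      ; *-comm = λ a b → mk≋ (∗-comm-at a b)
      }
    }

  module S = CommutativeRing seriesRing

  shift : Series → Series
  shift a zero    = 0#
  shift a (suc n) = a n

  opaque
    unfolding _∗_

    shift-∗ : ∀ a b → shift a ∗ b ≋ shift (a ∗ b)
    shift-∗ a b = mk≋ λ where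
      zero    → trans (+-identityʳ _) (zeroˡ _)
      (suc n) → trans (+-congʳ (zeroˡ _)) (+-identityˡ _)

  shift-cong : ∀ {a b} → a ≋ b → shift a ≋ shift b
  shift-cong e = mk≋ λ { zero → refl ; (suc n) → at e n }

  monomial : ℕ → Series
  monomial zero    = 1ˢ
  monomial (suc p) = shift (monomial p)

  -- Multiplication by z only moves the coefficients up by one place, so no information is lost.
  monomial-cancelˡ : ∀ p {a} → monomial p ∗ a ≋ S.0# → a ≋ S.0#
  monomial-cancelˡ zero    e = S.trans (S.sym (S.*-identityˡ _)) e
  monomial-cancelˡ (suc p) e = monomial-cancelˡ p (mk≋ λ n →
    trans (sym (at (shift-∗ (monomial p) _) (suc n))) (at e (suc n)))

  module Scaling (w : Carrier) where
    open RawSemiringDefs (Semiring.rawSemiring semiring) using (_^_)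
    open CommutativeSemigroupProperties *-commutativeSemigroup using (x∙yz≈y∙xz)
    open RawSemiringDefs (Semiring.rawSemiring S.semiring) using (product)

    -- The substitution of w z for z, an endomorphism of the ring of series.
    σ : Series → Series
    σ a n = w ^ n * a n

    σ-cong : ∀ {a b} → a ≋ b → σ a ≋ σ b
    σ-cong e = mk≋ λ n → *-congˡ (at e n)

    opaque
      unfolding _∗_

      tail-σ-∗ : ∀ a b n → (tail (σ a) ∗ b) n ≈ w * (σ (tail a) ∗ b) n
      tail-σ-∗ a b n = trans (∗-cong-at {b = b} (λ m → *-assoc w (w ^ m) (a (suc m))) (λ _ → refl) n)
          (•-∗-at w (σ (tail a)) b n)

      σ-∗-at : ∀ a b n → σ (a ∗ b) n ≈ (σ a ∗ σ b) n
      σ-∗-at a b zero    = trans (*-identityˡ _) (+-congʳ (sym (*-cong (*-identityˡ _) (*-identityˡ _))))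
      σ-∗-at a b (suc n) = begin
        w ^ suc n * (a 0 * b (suc n) + (tail a ∗ b) n)
          ≈⟨ distribˡ _ _ _ ⟩
        w ^ suc n * (a 0 * b (suc n)) + w * w ^ n * (tail a ∗ b) n
          ≈⟨ +-cong (trans (x∙yz≈y∙xz _ _ _) (*-congʳ (sym (*-identityˡ _))))
              (trans (*-assoc _ _ _) (*-congˡ (σ-∗-at (tail a) b n))) ⟩
        1# * a 0 * (w ^ suc n * b (suc n)) + w * (σ (tail a) ∗ σ b) n
          ≈⟨ +-congˡ (tail-σ-∗ a (σ b) n) ⟨
        1# * a 0 * (w ^ suc n * b (suc n)) + (tail (σ a) ∗ σ b) n ∎

    σ-∗ : ∀ a b → σ (a ∗ b) ≋ σ a ∗ σ b
    σ-∗ a b = mk≋ (σ-∗-at a b)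

    σ-1 : σ 1ˢ ≋ 1ˢ
    σ-1 = mk≋ λ { zero → *-identityˡ _ ; (suc n) → zeroʳ _ }

    σ-product : ∀ n (v : Vector Series n) → σ (product v) ≋ product (λ i → σ (v i))
    σ-product zero    v = σ-1
    σ-product (suc n) v = S.trans (σ-∗ _ _) (S.*-congˡ (σ-product n (v ∘ Fin.suc)))

    σ-monomial : ∀ p → σ (monomial p) ≋ w ^ p • monomial p
    σ-monomial zero    = S.trans σ-1 (mk≋ λ n → sym (*-identityˡ _))
    σ-monomial (suc p) = mk≋ λ where
      zero    → trans (zeroʳ _) (sym (zeroʳ _))
      (suc n) → trans (*-assoc _ _ _) (trans (*-congˡ (at (σ-monomial p) n)) (sym (*-assoc _ _ _)))

  linear : Carrier → Series
  linear r zero          = 1#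
  linear r (suc zero)    = - r
  linear r (suc (suc n)) = 0#

  -- If t and q are the sum and the product of λ and μ, this is (1 - λ z)(1 - μ z).
  quadratic : Carrier → Carrier → Series
  quadratic t q zero                = 1#
  quadratic t q (suc zero)          = - t
  quadratic t q (suc (suc zero))    = q
  quadratic t q (suc (suc (suc n))) = 0#

  opaque
    unfolding _∗_

    linear-∗-suc : ∀ r a n → (linear r ∗ a) (suc n) ≈ a (suc n) - r * a n
    linear-∗-suc r a n = trans (+-congˡ (r-at n))
      (solve 3 (λ r a₀ a₁ → con (+ 1) ⊗ a₁ ⊕ ⊝ r ⊗ a₀ ⊜ a₁ ⊕ ⊝ (r ⊗ a₀)) refl r (a n) (a (suc n)))
      where
      r-at : ∀ n → (tail (linear r) ∗ a) n ≈ - r * a n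
      r-at zero    = +-identityʳ _
      r-at (suc n) = trans (+-congˡ (∗-zeroˡ-at a (λ _ → refl) n)) (+-identityʳ _)

    quadratic-∗-1 : ∀ t q a → (quadratic t q ∗ a) 1 ≈ a 1 - t * a 0
    quadratic-∗-1 t q a = linear-∗-suc t a 0

    quadratic-∗-suc² : ∀ t q a n → (quadratic t q ∗ a) (2 ℕ.+ n) ≈ a (2 ℕ.+ n) - t * a (suc n) + q * a n
    quadratic-∗-suc² t q a n =
      trans (+-congˡ (+-congˡ (q-at n)))
        (solve 5 (λ t q a₀ a₁ a₂ → con (+ 1) ⊗ a₂ ⊕ (⊝ t ⊗ a₁ ⊕ q ⊗ a₀) ⊜ a₂ ⊕ ⊝ (t ⊗ a₁) ⊕ q ⊗ a₀)
          refl t q (a n) (a (suc n)) (a (2 ℕ.+ n)))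
      where
      q-at : ∀ n → (tail (tail (quadratic t q)) ∗ a) n ≈ q * a n
      q-at zero    = +-identityʳ _
      q-at (suc n) = trans (+-congˡ (∗-zeroˡ-at a (λ _ → refl) n)) (+-identityʳ _)

-- Derivations and logarithmic derivatives.

record IsDerivation {c ℓ} (R : CommutativeRing c ℓ)
                    (D : CommutativeRing.Carrier R → CommutativeRing.Carrier R) : Set (c ⊔ ℓ) where
  open CommutativeRing R
  open RawSemiringDefs (Semiring.rawSemiring semiring) using (sum; product)
  open GroupProperties +-group using (identityʳ-unique; inverseˡ-unique)
  open SetoidReasoning setoid

  field
    D-cong : ∀ {a b} → a ≈ b → D a ≈ D b
    D-+    : ∀ a b → D (a + b) ≈ D a + D b
    D-*    : ∀ a b → D (a * b) ≈ D a * b + a * D b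

  D-0 : D 0# ≈ 0#
  D-0 = identityʳ-unique (D 0#) (D 0#) (trans (sym (D-+ 0# 0#)) (D-cong (+-identityˡ 0#)))

  D-1 : D 1# ≈ 0#
  D-1 = identityʳ-unique (D 1#) (D 1#) (trans
    (+-cong (sym (*-identityʳ _)) (sym (*-identityˡ _))) (trans (sym (D-* 1# 1#)) (D-cong (*-identityˡ 1#))))

  D-neg : ∀ a → D (- a) ≈ - D a
  D-neg a = inverseˡ-unique (D (- a)) (D a)
    (trans (sym (D-+ (- a) a)) (trans (D-cong (-‿inverseˡ a)) D-0))

  -- c is the logarithmic derivative of 1 / a.
  infix 4 _LogDerivative⁻¹_

  _LogDerivative⁻¹_ : Carrier → Carrier → Set ℓ
  a LogDerivative⁻¹ c = D a + a * c ≈ 0#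

  open IntegerCoefficients R

  log-1 : 1# LogDerivative⁻¹ 0#
  log-1 = trans (+-cong D-1 (zeroʳ 1#)) (+-identityʳ 0#)

  log-* : ∀ {a b c d} → a LogDerivative⁻¹ c → b LogDerivative⁻¹ d → a * b LogDerivative⁻¹ c + d
  log-* {a} {b} {c} {d} e f = begin
    D (a * b) + a * b * (c + d)
      ≈⟨ +-congʳ (D-* a b) ⟩
    D a * b + a * D b + a * b * (c + d)
      ≈⟨ solve 6 (λ a b c d a′ b′ → a′ ⊗ b ⊕ a ⊗ b′ ⊕ a ⊗ b ⊗ (c ⊕ d)
           ⊜ (a′ ⊕ a ⊗ c) ⊗ b ⊕ a ⊗ (b′ ⊕ b ⊗ d)) refl a b c d (D a) (D b) ⟩
    (D a + a * c) * b + a * (D b + b * d)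
      ≈⟨ +-cong (trans (*-congʳ e) (zeroˡ b)) (trans (*-congˡ f) (zeroʳ a)) ⟩
    0# + 0#
      ≈⟨ +-identityˡ 0# ⟩
    0# ∎

  log-product : ∀ {n} (v c : Vector Carrier n) → (∀ i → v i LogDerivative⁻¹ c i) → product v
      LogDerivative⁻¹ sum c
  log-product {zero}  v c e = log-1
  log-product {suc n} v c e = log-* (e Fin.zero) (log-product (v ∘ Fin.suc) (c ∘ Fin.suc) (e ∘ Fin.suc))

  -- Applying `D` to a b = m and using D a = - a c gives a (D b - b c) = 0. One more factor b
  -- replaces a by m, so that only m has to be cancelled later; in the application it is a power of
  -- z.
  D-reciprocal : ∀ {a b m c} → a * b ≈ m → D m ≈ 0# → a LogDerivative⁻¹ c → m * (D b - b * c) ≈ 0#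
  D-reciprocal {a} {b} {m} {c} ab≈m Dm≈0 e = begin
    m * (D b - b * c)
      ≈⟨ *-congʳ ab≈m ⟨
    a * b * (D b - b * c)
      ≈⟨ solve 5 (λ a b c a′ b′ → a ⊗ b ⊗ (b′ ⊕ ⊝ (b ⊗ c))
           ⊜ b ⊗ (a′ ⊗ b ⊕ a ⊗ b′ ⊕ ⊝ ((a′ ⊕ a ⊗ c) ⊗ b))) refl a b c (D a) (D b) ⟩
    b * (D a * b + a * D b - (D a + a * c) * b)
      ≈⟨ *-congˡ (+-cong (trans (sym (D-* a b)) (trans (D-cong ab≈m) Dm≈0))
           (-‿cong (trans (*-congʳ e) (zeroˡ b)))) ⟩
    b * (0# - 0#)
      ≈⟨ trans (*-congˡ (-‿inverseʳ 0#)) (zeroʳ b) ⟩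
    0# ∎

module SeriesDerivation {c ℓ} (R : CommutativeRing c ℓ)
                        (D : CommutativeRing.Carrier R → CommutativeRing.Carrier R)
                        (isDerivation : IsDerivation R D) where
  open CommutativeRing R
  open PowerSeries R
  open IsDerivation isDerivation
  open CommutativeSemigroupProperties +-commutativeSemigroup using (interchange)
  open SetoidReasoning setoid
  open IntegerCoefficients R

  Dˢ : Series → Series
  Dˢ a n = D (a n)

  opaque
    unfolding _∗_

    Dˢ-∗ : ∀ a b n → D ((a ∗ b) n) ≈ (Dˢ a ∗ b) n + (a ∗ Dˢ b) n
    Dˢ-∗ a b zero    = trans (D-+ _ _)
        (trans (+-cong (D-* _ _) (trans D-0 (sym (+-identityˡ 0#)))) (interchange _ _ _ _))
    Dˢ-∗ a b (suc n) = trans (D-+ _ _) (trans (+-cong (D-* _ _) (Dˢ-∗ (tail a) b n)) (interchange _ _ _ _))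

  isDerivationˢ : IsDerivation seriesRing Dˢ
  isDerivationˢ = record
    { D-cong = λ e → mk≋ λ n → D-cong (at e n)
    ; D-+    = λ a b → mk≋ λ n → D-+ (a n) (b n)
    ; D-*    = λ a b → mk≋ (Dˢ-∗ a b)
    }

  open IsDerivation isDerivationˢ public using () renaming (_LogDerivative⁻¹_ to _LogDerivative⁻¹ˢ_)

  Dˢ-monomial : ∀ p → Dˢ (monomial p) ≋ S.0#
  Dˢ-monomial zero    = mk≋ λ { zero → D-1 ; (suc n) → D-0 }
  Dˢ-monomial (suc p) = mk≋ λ { zero → D-0 ; (suc n) → at (Dˢ-monomial p) n }

  constantTerm-∗ : ∀ a {b} → b 0 ≈ 0# → (a ∗ b) 0 ≈ 0#
  constantTerm-∗ a {b} e = trans (∗-def a b 0) (trans (+-identityʳ _) (trans (*-congˡ e) (zeroʳ _)))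

  -- For m ≥ 1, `u m` is D r times r^(m-1), the coefficient of zᵐ in D r z / (1 - r z). That series
  -- has no constant term, hence `shift (tail u)`.
  log-linear : ∀ {r} u → (∀ n → u (suc n) ≈ r * u n) → D r ≈ u 1 →
               linear r LogDerivative⁻¹ˢ shift (tail u)
  log-linear {r} u rec Dr = mk≋ λ where
    zero          → trans (+-cong D-1 (constantTerm-∗ (linear r) refl)) (+-identityˡ 0#)
    (suc zero)    → trans (+-cong (trans (D-neg r) (-‿cong Dr)) (linear-∗-suc r (shift (tail u)) 0))
                      (solve 2 (λ r u → ⊝ u ⊕ (u ⊕ ⊝ (r ⊗ con (+ 0))) ⊜ con (+ 0)) refl r (u 1))
    (suc (suc n)) → trans (+-cong D-0 (linear-∗-suc r (shift (tail u)) (suc n)))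
                      (trans (+-identityˡ _) (trans (+-congʳ (rec (suc n))) (-‿inverseʳ _)))

  -- With t = λ + μ and q = λ μ, `u m` plays the role of D λ λ^(m-1) + D μ μ^(m-1). The value `u 0`,
  -- in effect D q / q, extends the recurrence down to index 0 and so accounts for D q in the
  -- coefficient of z²; `shift (tail u)` then removes it.
  log-quadratic : ∀ {t q} u → (∀ n → u (2 ℕ.+ n) - t * u (suc n) + q * u n ≈ 0#) →
                  D t ≈ u 1 → D q ≈ u 0 * q →
                  quadratic t q LogDerivative⁻¹ˢ shift (tail u)
  log-quadratic {t} {q} u rec Dt Dq = mk≋ λ where
    zero                → trans (+-cong D-1 (constantTerm-∗ (quadratic t q) refl)) (+-identityˡ 0#)
    (suc zero)          → trans (+-cong (trans (D-neg t) (-‿cong Dt)) (quadratic-∗-1 t q (shift (tail u))))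
                            (solve 2 (λ t u → ⊝ u ⊕ (u ⊕ ⊝ (t ⊗ con (+ 0))) ⊜ con (+ 0)) refl t (u 1))
    (suc (suc zero))    → trans (+-cong Dq (quadratic-∗-suc² t q (shift (tail u)) 0))
                            (trans (solve 5 (λ t q u₀ u₁ u₂ → u₀ ⊗ q ⊕ (u₂ ⊕ ⊝ (t ⊗ u₁) ⊕ q ⊗ con (+ 0))
                                 ⊜ u₂ ⊕ ⊝ (t ⊗ u₁) ⊕ q ⊗ u₀) refl t q (u 0) (u 1) (u 2))
                              (rec 0))
    (suc (suc (suc n))) → trans (+-cong D-0 (quadratic-∗-suc² t q (shift (tail u)) (suc n)))
                            (trans (+-identityˡ _) (rec (suc n)))

-- Fibonacci identities through the quadratic extension by α.

record FibonacciSequence {c ℓ} (R : CommutativeRing c ℓ) : Set (c ⊔ ℓ) where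
  open CommutativeRing R

  field
    x y    : Carrier
    F      : ℕ → Carrier
    F-0    : F 0 ≈ 0#
    F-1    : F 1 ≈ 1#
    F-suc² : ∀ n → F (suc (suc n)) ≈ x * F (suc n) + y * F n

-- If α² = x α + y then αⁿ = E n + F n α, where E n = y Fₙ₋₁ for n ≥ 1. Addition
-- formulas and norms in the quadratic extension thereby become identities between
-- E and F; L n is the trace of αⁿ.
module Fibonacci {c ℓ} (R : CommutativeRing c ℓ) (𝔽 : FibonacciSequence R) where
  open CommutativeRing R
  open FibonacciSequence 𝔽
  open RawSemiringDefs (Semiring.rawSemiring semiring) using (_^_; _×_)
  open SemiringExp semiring using (^-homo-*; ^-assocʳ; ^-congʳ; ^-congˡ)
  open SemiringMult semiring using (×-assoc-*; ×-congʳ)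
  open SetoidReasoning setoid
  open IntegerCoefficients R

  E : ℕ → Carrier
  E zero    = 1#
  E (suc n) = y * F n

  L : ℕ → Carrier
  L n = E n + E n + x * F n

  F-suc : ∀ n → F (suc n) ≈ E n + x * F n
  F-suc zero    = trans F-1 (sym (trans (+-congˡ (trans (*-congˡ F-0) (zeroʳ x))) (+-identityʳ 1#)))
  F-suc (suc n) = trans (F-suc² n) (+-comm _ _)

  -- Compares coordinates in αᵐ αⁿ = αᵐ⁺ⁿ. Multiplication by α mixes the two coordinates, so both
  -- formulas are proved by one simultaneous induction on m.
  F-E-+ : ∀ m n → F (m ℕ.+ n) ≈ F m * E n + E m * F n + x * (F m * F n)
  E-F-+ : ∀ m n → E (m ℕ.+ n) ≈ E m * E n + y * (F m * F n)

  F-E-+ zero    n = sym (begin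
    F 0 * E n + 1# * F n + x * (F 0 * F n)  ≈⟨ +-cong (+-congʳ (*-congʳ F-0)) (*-congˡ (*-congʳ F-0)) ⟩
    0# * E n + 1# * F n + x * (0# * F n)    ≈⟨ solve 3
        (λ x e f → con (+ 0) ⊗ e ⊕ con (+ 1) ⊗ f ⊕ x ⊗ (con (+ 0) ⊗ f) ⊜ f) refl x (E n) (F n) ⟩
    F n                                     ∎)
  F-E-+ (suc m) n = begin
    F (suc (m ℕ.+ n))
      ≈⟨ F-suc (m ℕ.+ n) ⟩
    E (m ℕ.+ n) + x * F (m ℕ.+ n)
      ≈⟨ +-cong (E-F-+ m n) (*-congˡ (F-E-+ m n)) ⟩
    E m * E n + y * (F m * F n) + x * (F m * E n + E m * F n + x * (F m * F n))
      ≈⟨ solve 6 (λ x y e f e′ f′ → e ⊗ e′ ⊕ y ⊗ (f ⊗ f′) ⊕ x ⊗ (f ⊗ e′ ⊕ e ⊗ f′ ⊕ x ⊗ (f ⊗ f′))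
           ⊜ (e ⊕ x ⊗ f) ⊗ e′ ⊕ y ⊗ f ⊗ f′ ⊕ x ⊗ ((e ⊕ x ⊗ f) ⊗ f′)) refl x y (E m) (F m) (E n) (F n) ⟩
    (E m + x * F m) * E n + y * F m * F n + x * ((E m + x * F m) * F n)
      ≈⟨ +-cong (+-congʳ (*-congʳ (F-suc m))) (*-congˡ (*-congʳ (F-suc m))) ⟨
    F (suc m) * E n + E (suc m) * F n + x * (F (suc m) * F n) ∎

  E-F-+ zero    n = sym (begin
    1# * E n + y * (F 0 * F n)  ≈⟨ +-congˡ (*-congˡ (*-congʳ F-0)) ⟩
    1# * E n + y * (0# * F n)   ≈⟨ solve 3 (λ y e f → con (+ 1) ⊗ e ⊕ y ⊗ (con (+ 0) ⊗ f) ⊜ e) refl y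
        (E n) (F n) ⟩
    E n                         ∎)
  E-F-+ (suc m) n = begin
    y * F (m ℕ.+ n)
      ≈⟨ *-congˡ (F-E-+ m n) ⟩
    y * (F m * E n + E m * F n + x * (F m * F n))
      ≈⟨ solve 6 (λ x y e f e′ f′ → y ⊗ (f ⊗ e′ ⊕ e ⊗ f′ ⊕ x ⊗ (f ⊗ f′))
           ⊜ y ⊗ f ⊗ e′ ⊕ y ⊗ ((e ⊕ x ⊗ f) ⊗ f′)) refl x y (E m) (F m) (E n) (F n) ⟩
    y * F m * E n + y * ((E m + x * F m) * F n)
      ≈⟨ +-congˡ (*-congˡ (*-congʳ (F-suc m))) ⟨
    E (suc m) * E n + y * (F (suc m) * F n) ∎

  -- The left side is (E n + F n α)(E n + F n β), that is, (αβ)ⁿ.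
  norm : ∀ n → E n * E n + x * (E n * F n) - y * (F n * F n) ≈ (- y) ^ n
  norm zero    = begin
    1# * 1# + x * (1# * F 0) - y * (F 0 * F 0)  ≈⟨ +-cong (+-congˡ (*-congˡ (*-congˡ F-0)))
        (-‿cong (*-congˡ (*-cong F-0 F-0))) ⟩
    1# * 1# + x * (1# * 0#) - y * (0# * 0#)     ≈⟨ solve 2
        (λ x y → con (+ 1) ⊗ con (+ 1) ⊕ x ⊗ (con (+ 1) ⊗ con (+ 0)) ⊕ ⊝ (y ⊗ (con (+ 0) ⊗ con (+ 0)))
        ⊜ con (+ 1)) refl x y ⟩
    1#                                          ∎
  norm (suc n) = begin
    y * F n * (y * F n) + x * (y * F n * F (suc n)) - y * (F (suc n) * F (suc n))
      ≈⟨ +-cong (+-congˡ (*-congˡ (*-congˡ (F-suc n)))) (-‿cong (*-congˡ (*-cong (F-suc n) (F-suc n)))) ⟩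
    y * F n * (y * F n) + x * (y * F n * (E n + x * F n)) - y * ((E n + x * F n) * (E n + x * F n))
      ≈⟨ solve 4 (λ x y e f → y ⊗ f ⊗ (y ⊗ f) ⊕ x ⊗ (y ⊗ f ⊗ (e ⊕ x ⊗ f)) ⊕ ⊝ (y ⊗ ((e ⊕ x ⊗ f) ⊗ (e ⊕ x ⊗ f)))
           ⊜ ⊝ y ⊗ (e ⊗ e ⊕ x ⊗ (e ⊗ f) ⊕ ⊝ (y ⊗ (f ⊗ f)))) refl x y (E n) (F n) ⟩
    - y * (E n * E n + x * (E n * F n) - y * (F n * F n))
      ≈⟨ *-congˡ (norm n) ⟩
    - y * (- y) ^ n ∎

  -- The element α^a is a root of its characteristic polynomial λ² - L a λ + (- y)^a. Multiplying by
  -- α^m and taking the coefficient of α gives this identity; `E-trace` is the other coordinate.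
  F-trace : ∀ a m → F (a ℕ.+ (a ℕ.+ m)) - L a * F (a ℕ.+ m) + (- y) ^ a * F m ≈ 0#
  F-trace a m = begin
    F (a ℕ.+ (a ℕ.+ m)) - L a * F (a ℕ.+ m) + (- y) ^ a * F m
      ≈⟨ +-cong (+-cong (trans (F-E-+ a (a ℕ.+ m))
          (+-cong (+-cong (*-congˡ (E-F-+ a m)) (*-congˡ (F-E-+ a m))) (*-congˡ (*-congˡ (F-E-+ a m)))))
           (-‿cong (*-congˡ (F-E-+ a m)))) (*-congʳ (sym (norm a))) ⟩
    _
      ≈⟨ solve 6 (λ x y e f e′ f′ →
           let e″ = e ⊗ e′ ⊕ y ⊗ (f ⊗ f′); f″ = f ⊗ e′ ⊕ e ⊗ f′ ⊕ x ⊗ (f ⊗ f′) in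
           f ⊗ e″ ⊕ e ⊗ f″ ⊕ x ⊗ (f ⊗ f″) ⊕ ⊝ ((e ⊕ e ⊕ x ⊗ f) ⊗ f″)
             ⊕ (e ⊗ e ⊕ x ⊗ (e ⊗ f) ⊕ ⊝ (y ⊗ (f ⊗ f))) ⊗ f′ ⊜ con (+ 0)) refl x y (E a) (F a) (E m) (F m) ⟩
    0# ∎

  E-trace : ∀ a m → E (a ℕ.+ (a ℕ.+ m)) - L a * E (a ℕ.+ m) + (- y) ^ a * E m ≈ 0#
  E-trace a m = begin
    E (a ℕ.+ (a ℕ.+ m)) - L a * E (a ℕ.+ m) + (- y) ^ a * E m
      ≈⟨ +-cong (+-cong (trans (E-F-+ a (a ℕ.+ m))
          (+-cong (*-congˡ (E-F-+ a m)) (*-congˡ (*-congˡ (F-E-+ a m)))))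
           (-‿cong (*-congˡ (E-F-+ a m)))) (*-congʳ (sym (norm a))) ⟩
    _
      ≈⟨ solve 6 (λ x y e f e′ f′ →
           let e″ = e ⊗ e′ ⊕ y ⊗ (f ⊗ f′); f″ = f ⊗ e′ ⊕ e ⊗ f′ ⊕ x ⊗ (f ⊗ f′) in
           e ⊗ e″ ⊕ y ⊗ (f ⊗ f″) ⊕ ⊝ ((e ⊕ e ⊕ x ⊗ f) ⊗ e″)
             ⊕ (e ⊗ e ⊕ x ⊗ (e ⊗ f) ⊕ ⊝ (y ⊗ (f ⊗ f))) ⊗ e′ ⊜ con (+ 0)) refl x y (E a) (F a) (E m) (F m) ⟩
    0# ∎

  -- The left side is the determinant of the coordinates, in the order F, E, of α^(a+t) and α^(b+t),
  -- and multiplication by α^t has determinant (- y)^t.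
  docagne : ∀ a b t → F (a ℕ.+ t) * E (b ℕ.+ t) - E (a ℕ.+ t) * F (b ℕ.+ t)
      ≈ (- y) ^ t * (F a * E b - E a * F b)
  docagne a b t = begin
    F (a ℕ.+ t) * E (b ℕ.+ t) - E (a ℕ.+ t) * F (b ℕ.+ t)
      ≈⟨ +-cong (*-cong (F-E-+ a t) (E-F-+ b t)) (-‿cong (*-cong (E-F-+ a t) (F-E-+ b t))) ⟩
    _
      ≈⟨ solve 8 (λ x y e f e′ f′ e″ f″ →
           (f ⊗ e″ ⊕ e ⊗ f″ ⊕ x ⊗ (f ⊗ f″)) ⊗ (e′ ⊗ e″ ⊕ y ⊗ (f′ ⊗ f″))
               ⊕ ⊝ ((e ⊗ e″ ⊕ y ⊗ (f ⊗ f″)) ⊗ (f′ ⊗ e″ ⊕ e′ ⊗ f″ ⊕ x ⊗ (f′ ⊗ f″)))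
           ⊜ (e″ ⊗ e″ ⊕ x ⊗ (e″ ⊗ f″) ⊕ ⊝ (y ⊗ (f″ ⊗ f″))) ⊗ (f ⊗ e′ ⊕ ⊝ (e ⊗ f′))) refl x y (E a) (F a)
               (E b) (F b) (E t) (F t) ⟩
    (E t * E t + x * (E t * F t) - y * (F t * F t)) * (F a * E b - E a * F b)
      ≈⟨ *-congʳ (norm t) ⟩
    (- y) ^ t * (F a * E b - E a * F b) ∎

  -- The bracket is (α^a β^b - β^a α^b) / (α - β), which is (- y)^b F (a - b) when b ≤ a. Written
  -- with E it contains no difference of indices, and no comparison of a with b is required.
  docagne-* : ∀ a b t → F (a ℕ.+ b ℕ.+ t) * (F a * E b - E a * F b) + (- y) ^ a * (F (b ℕ.+ t) * F b)
                        ≈ (- y) ^ b * (F (a ℕ.+ t) * F a)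
  docagne-* a b t = begin
    F (a ℕ.+ b ℕ.+ t) * (F a * E b - E a * F b) + (- y) ^ a * (F (b ℕ.+ t) * F b)
      ≈⟨ +-cong (*-congʳ (trans (F-E-+ (a ℕ.+ b) t)
          (+-cong (+-cong (*-congʳ (F-E-+ a b)) (*-congʳ (E-F-+ a b))) (*-congˡ (*-congʳ (F-E-+ a b))))))
           (*-cong (sym (norm a)) (*-congʳ (F-E-+ b t))) ⟩
    _
      ≈⟨ solve 8 (λ x y e f e′ f′ e″ f″ →
           let E = e ⊗ e′ ⊕ y ⊗ (f ⊗ f′); F = f ⊗ e′ ⊕ e ⊗ f′ ⊕ x ⊗ (f ⊗ f′) in
           (F ⊗ e″ ⊕ E ⊗ f″ ⊕ x ⊗ (F ⊗ f″)) ⊗ (f ⊗ e′ ⊕ ⊝ (e ⊗ f′))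
             ⊕ (e ⊗ e ⊕ x ⊗ (e ⊗ f) ⊕ ⊝ (y ⊗ (f ⊗ f))) ⊗ ((f′ ⊗ e″ ⊕ e′ ⊗ f″ ⊕ x ⊗ (f′ ⊗ f″)) ⊗ f′)
           ⊜ (e′ ⊗ e′ ⊕ x ⊗ (e′ ⊗ f′) ⊕ ⊝ (y ⊗ (f′ ⊗ f′))) ⊗ ((f ⊗ e″ ⊕ e ⊗ f″ ⊕ x ⊗ (f ⊗ f″)) ⊗ f))
           refl x y (E a) (F a) (E b) (F b) (E t) (F t) ⟩
    (E b * E b + x * (E b * F b) - y * (F b * F b)) * ((F a * E t + E a * F t + x * (F a * F t)) * F a)
      ≈⟨ *-cong (norm b) (*-congʳ (sym (F-E-+ a t))) ⟩
    (- y) ^ b * (F (a ℕ.+ t) * F a) ∎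

  -- For A = a + t and B = b + t, F (A + B) is L A F B plus the determinant F A E B - E A F B, which
  -- `docagne` and `docagne-*` rewrite. This is the three-term recurrence of the Fibopolynomials
  -- after their common factors are removed.
  F-trace-* : ∀ a b t →
    F ((a ℕ.+ t) ℕ.+ (b ℕ.+ t)) * F (a ℕ.+ b ℕ.+ t) + (- y) ^ (a ℕ.+ t) * (F (b ℕ.+ t) * F b)
    ≈ L (a ℕ.+ t) * (F (a ℕ.+ b ℕ.+ t) * F (b ℕ.+ t)) + (- y) ^ (b ℕ.+ t) * (F (a ℕ.+ t) * F a)
  F-trace-* a b t = begin
    F (A ℕ.+ B) * G + (- y) ^ A * (F B * F b)
      ≈⟨ +-cong (*-congʳ (F-E-+ A B)) (*-congʳ (^-homo-* (- y) a t)) ⟩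
    (F A * E B + E A * F B + x * (F A * F B)) * G + (- y) ^ a * (- y) ^ t * (F B * F b)
      ≈⟨ solve 9 (λ x E F E′ F′ G f w z → (F ⊗ E′ ⊕ E ⊗ F′ ⊕ x ⊗ (F ⊗ F′)) ⊗ G ⊕ w ⊗ z ⊗ (F′ ⊗ f)
           ⊜ (E ⊕ E ⊕ x ⊗ F) ⊗ (G ⊗ F′) ⊕ ((F ⊗ E′ ⊕ ⊝ (E ⊗ F′)) ⊗ G ⊕ w ⊗ z ⊗ (F′ ⊗ f)))
           refl x (E A) (F A) (E B) (F B) G (F b) ((- y) ^ a) ((- y) ^ t) ⟩
    L A * (G * F B) + ((F A * E B - E A * F B) * G + (- y) ^ a * (- y) ^ t * (F B * F b))
      ≈⟨ +-congˡ (+-congʳ (*-congʳ (docagne a b t))) ⟩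
    L A * (G * F B) + ((- y) ^ t * (F a * E b - E a * F b) * G + (- y) ^ a * (- y) ^ t * (F B * F b))
      ≈⟨ solve 7 (λ l z d G w F′ f → l ⊕ (z ⊗ d ⊗ G ⊕ w ⊗ z ⊗ (F′ ⊗ f)) ⊜ l ⊕ z ⊗ (G ⊗ d ⊕ w ⊗ (F′ ⊗ f)))
           refl (L A * (G * F B)) ((- y) ^ t) (F a * E b - E a * F b) G ((- y) ^ a) (F B) (F b) ⟩
    L A * (G * F B) + (- y) ^ t * (G * (F a * E b - E a * F b) + (- y) ^ a * (F B * F b))
      ≈⟨ +-congˡ (*-congˡ (docagne-* a b t)) ⟩
    L A * (G * F B) + (- y) ^ t * ((- y) ^ b * (F A * F a))
      ≈⟨ +-congˡ (trans (sym (*-assoc _ _ _)) (*-congʳ (trans (*-comm _ _) (sym (^-homo-* (- y) b t))))) ⟩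
    L A * (G * F B) + (- y) ^ B * (F A * F a) ∎
    where
    A = a ℕ.+ t
    B = b ℕ.+ t
    G = F (a ℕ.+ b ℕ.+ t)

  ι : ℕ → Carrier
  ι n = n × 1#

  ×≈ι* : ∀ n a → n × a ≈ ι n * a
  ×≈ι* n a = sym (trans (×-assoc-* n 1# a) (×-congʳ n (*-identityˡ a)))

  module _ (D : Carrier → Carrier) (isDerivation : IsDerivation R D) {ξ η : Carrier}
           (D-x : D x ≈ ξ) (D-y : D y ≈ η * y) where
    open IsDerivation isDerivation

    D-^ : ∀ {a b} → D a ≈ b * a → ∀ n → D (a ^ n) ≈ (n × b) * a ^ n
    D-^ e zero = trans D-1 (sym (zeroˡ _))
    D-^ {a} {b} e (suc n) = begin
      D (a * a ^ n)                        ≈⟨ D-* a (a ^ n) ⟩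
      D a * a ^ n + a * D (a ^ n)          ≈⟨ +-cong (*-congʳ e) (*-congˡ (D-^ e n)) ⟩
      b * a * a ^ n + a * ((n × b) * a ^ n)  ≈⟨ solve 4
          (λ a b n z → b ⊗ a ⊗ z ⊕ a ⊗ (n ⊗ z) ⊜ (b ⊕ n) ⊗ (a ⊗ z)) refl a b (n × b) (a ^ n) ⟩
      (b + n × b) * (a * a ^ n)            ∎

    D-[-y]^ : ∀ n → D ((- y) ^ n) ≈ (n × η) * (- y) ^ n
    D-[-y]^ = D-^ (trans (D-neg y) (trans (-‿cong D-y)
      (solve 2 (λ η y → ⊝ (η ⊗ y) ⊜ η ⊗ ⊝ y) refl η y)))

    L-suc² : ∀ n → L (2 ℕ.+ n) ≈ x * L (suc n) + y * L n
    L-suc² n = begin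
      y * F (suc n) + y * F (suc n) + x * F (2 ℕ.+ n)
        ≈⟨ +-congˡ (*-congˡ (F-suc² n)) ⟩
      y * F (suc n) + y * F (suc n) + x * (x * F (suc n) + y * F n)
        ≈⟨ +-cong (+-cong (*-congˡ (F-suc n)) (*-congˡ (F-suc n))) (*-congˡ (+-congʳ (*-congˡ (F-suc n)))) ⟩
      _
        ≈⟨ solve 4 (λ x y e f → let f′ = e ⊕ x ⊗ f in y ⊗ f′ ⊕ y ⊗ f′ ⊕ x ⊗ (x ⊗ f′ ⊕ y ⊗ f)
             ⊜ x ⊗ (y ⊗ f ⊕ y ⊗ f ⊕ x ⊗ f′) ⊕ y ⊗ (e ⊕ e ⊕ x ⊗ f)) refl x y (E n) (F n) ⟩
      x * (y * F n + y * F n + x * (E n + x * F n)) + y * L n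
        ≈⟨ +-congʳ (*-congˡ (+-congˡ (*-congˡ (F-suc n)))) ⟨
      x * L (suc n) + y * L n ∎

    -- Differentiating α² = x α + y gives (α - β) D α = ξ α + η y, so D αⁿ = n (ξ αⁿ + η y αⁿ⁻¹) /
    -- (α - β); adding the conjugate turns the quotients into F n and F (n - 1). Without the roots,
    -- the same follows by induction along the recurrence of `L`.
    D-L : ∀ n → D (L n) ≈ n × (ξ * F n + η * E n)
    D-L 0 = begin
      D (1# + 1# + x * F 0)  ≈⟨ D-cong (trans (+-congˡ (trans (*-congˡ F-0) (zeroʳ x))) (+-identityʳ _)) ⟩
      D (1# + 1#)            ≈⟨ D-+ 1# 1# ⟩
      D 1# + D 1#            ≈⟨ +-cong D-1 D-1 ⟩
      0# + 0#                ≈⟨ +-identityˡ 0# ⟩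
      0#                     ∎
    D-L 1 = begin
      D (y * F 0 + y * F 0 + x * F 1)
        ≈⟨ D-cong (trans (+-cong (+-cong (*-congˡ F-0) (*-congˡ F-0)) (*-congˡ F-1))
             (solve 2 (λ x y → y ⊗ con (+ 0) ⊕ y ⊗ con (+ 0) ⊕ x ⊗ con (+ 1) ⊜ x) refl x y)) ⟩
      D x
        ≈⟨ D-x ⟩
      ξ
        ≈⟨ solve 3 (λ ξ η y → ξ ⊗ con (+ 1) ⊕ η ⊗ (y ⊗ con (+ 0)) ⊕ con (+ 0) ⊜ ξ) refl ξ η y ⟨
      ξ * 1# + η * (y * 0#) + 0#
        ≈⟨ +-congʳ (+-cong (*-congˡ F-1) (*-congˡ (*-congˡ F-0))) ⟨
      ξ * F 1 + η * (y * F 0) + 0# ∎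
    D-L (suc (suc n)) = begin
      D (L (2 ℕ.+ n))
        ≈⟨ trans (D-cong (L-suc² n)) (trans (D-+ _ _) (+-cong (D-* _ _) (D-* _ _))) ⟩
      D x * L (suc n) + x * D (L (suc n)) + (D y * L n + y * D (L n))
        ≈⟨ +-cong (+-cong (*-congʳ D-x) (*-congˡ (trans (D-L (suc n)) (×≈ι* (suc n) _))))
             (+-cong (*-congʳ D-y) (*-congˡ (trans (D-L n) (×≈ι* n _)))) ⟩
      ξ * L (suc n) + x * ((1# + ι n) * (ξ * F (suc n) + η * E (suc n)))
          + (η * y * L n + y * (ι n * (ξ * F n + η * E n)))
        ≈⟨ solve 8 (λ x y ξ η n e f f′ →
             ξ ⊗ (y ⊗ f ⊕ y ⊗ f ⊕ x ⊗ f′) ⊕ x ⊗ ((con (+ 1) ⊕ n) ⊗ (ξ ⊗ f′ ⊕ η ⊗ (y ⊗ f)))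
               ⊕ (η ⊗ y ⊗ (e ⊕ e ⊕ x ⊗ f) ⊕ y ⊗ (n ⊗ (ξ ⊗ f ⊕ η ⊗ e)))
             ⊜ (con (+ 1) ⊕ (con (+ 1) ⊕ n)) ⊗ (ξ ⊗ (x ⊗ f′ ⊕ y ⊗ f) ⊕ η ⊗ (y ⊗ (e ⊕ x ⊗ f))))
             refl x y ξ η (ι n) (E n) (F n) (F (suc n)) ⟩
      (1# + (1# + ι n)) * (ξ * (x * F (suc n) + y * F n) + η * (y * (E n + x * F n)))
        ≈⟨ *-congˡ (+-cong (*-congˡ (sym (F-suc² n))) (*-congˡ (*-congˡ (sym (F-suc n))))) ⟩
      ι (2 ℕ.+ n) * (ξ * F (2 ℕ.+ n) + η * E (2 ℕ.+ n))
        ≈⟨ ×≈ι* (2 ℕ.+ n) _ ⟨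
      (2 ℕ.+ n) × (ξ * F (2 ℕ.+ n) + η * E (2 ℕ.+ n)) ∎

-- Numerators and denominators of generalized binomial coefficients.

module FallingProduct {c ℓ} (R : CommutativeRing c ℓ) (f : ℕ → CommutativeRing.Carrier R)
                      (f-0 : CommutativeRing._≈_ R (f 0) (CommutativeRing.0# R)) where
  open CommutativeRing R
  open RawSemiringDefs (Semiring.rawSemiring semiring) using (product)

  falling : ℕ → ℕ → Carrier
  falling n k = product {k} (λ i → f (n ∸ toℕ i))

  factorial : ℕ → Carrier
  factorial k = product {k} (λ i → f (suc (toℕ i)))

  falling-0-suc : ∀ k → falling 0 (suc k) ≈ 0#
  falling-0-suc k = trans (*-congʳ f-0) (zeroˡ _)

  -- For n < k the factor f 0 = 0 occurs on both sides, so the truncated difference does no harm.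
  falling-snoc : ∀ n k → falling n (suc k) ≈ falling n k * f (n ∸ k)
  falling-snoc n       zero    = *-comm _ _
  falling-snoc zero    (suc k) = trans (falling-0-suc (suc k))
      (sym (trans (*-congʳ (falling-0-suc k)) (zeroˡ _)))
  falling-snoc (suc n) (suc k) = trans (*-congˡ (falling-snoc n k)) (sym (*-assoc _ _ _))

  falling-split : ∀ n k → falling n k ≈ 0# ⊎ n ≡ k ℕ.+ (n ∸ k)
  falling-split n       zero    = inj₂ ≡.refl
  falling-split zero    (suc k) = inj₁ (falling-0-suc k)
  falling-split (suc n) (suc k) with falling-split n k
  ... | inj₁ e = inj₁ (trans (*-congˡ e) (zeroʳ _))
  ... | inj₂ e = inj₂ (≡.cong suc e)

  product-snoc : ∀ k (g : ℕ → Carrier) → product {suc k} (g ∘ toℕ) ≈ product {k} (g ∘ toℕ) * g k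
  product-snoc zero    g = *-comm _ _
  product-snoc (suc k) g = trans (*-congˡ (product-snoc k (g ∘ suc))) (sym (*-assoc _ _ _))

  factorial-suc : ∀ k → factorial (suc k) ≈ factorial k * f (suc k)
  factorial-suc k = product-snoc k (f ∘ suc)

-- The three-term recurrence of the Fibopolynomials.

module Fibonomial {c ℓ} (R : CommutativeRing c ℓ) (𝔽 : FibonacciSequence R) (s : ℕ) where
  open CommutativeRing R
  open FibonacciSequence 𝔽
  open Fibonacci R 𝔽
  open RawSemiringDefs (Semiring.rawSemiring semiring) using (_^_; product)
  open SemiringExp semiring using (^-homo-*; ^-assocʳ; ^-congʳ; ^-congˡ)
  open CommutativeSemigroupProperties *-commutativeSemigroup using (x∙yz≈y∙xz)
  open SetoidReasoning setoid
  open IntegerCoefficients R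

  f : ℕ → Carrier
  f n = F (s ℕ.* n)

  f-0 : f 0 ≈ 0#
  f-0 = trans (reflexive (≡.cong F (ℕ.*-zeroʳ s))) F-0

  open FallingProduct R f f-0

  w : Carrier
  w = (- y) ^ s

  ℓ[_] : ℕ → Carrier
  ℓ[ n ] = L (s ℕ.* n)

  -- An instance of `F-trace-*` with t = s, since s (k + 1) = s k + s.
  f-trace-* : ∀ a b → f (suc a ℕ.+ suc b) * f (suc a ℕ.+ b) + w ^ suc a * (f (suc b) * f b)
                      ≈ ℓ[ suc a ] * (f (suc a ℕ.+ b) * f (suc b)) + w ^ suc b * (f (suc a) * f a)
  f-trace-* a b = begin
    f (suc a ℕ.+ suc b) * f (suc a ℕ.+ b) + w ^ suc a * (f (suc b) * f b)
      ≈⟨ +-cong (*-cong (F-≡ (≡.trans (ℕ.*-distribˡ-+ s (suc a) (suc b)) (≡.cong₂ ℕ._+_ (e a) (e b))))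
          (F-≡ e₂)) (*-cong (trans (^-assocʳ (- y) s (suc a)) (^-congʳ (- y) (e a))) (*-congʳ (F-≡ (e b)))) ⟩
    _
      ≈⟨ F-trace-* (s ℕ.* a) (s ℕ.* b) s ⟩
    _
      ≈⟨ +-cong (*-cong (reflexive (≡.cong L (e a))) (*-cong (F-≡ e₂) (F-≡ (e b))))
          (*-cong (trans (^-assocʳ (- y) s (suc b)) (^-congʳ (- y) (e b))) (*-congʳ (F-≡ (e a)))) ⟨
    ℓ[ suc a ] * (f (suc a ℕ.+ b) * f (suc b)) + w ^ suc b * (f (suc a) * f a) ∎
    where
    F-≡ : ∀ {m n} → m ≡ n → F m ≈ F n
    F-≡ = reflexive ∘ ≡.cong F
    e : ∀ k → s ℕ.* suc k ≡ s ℕ.* k ℕ.+ s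
    e k = ≡.trans (ℕ.*-suc s k) (ℕ.+-comm s _)
    e₂ : s ℕ.* (suc a ℕ.+ b) ≡ s ℕ.* a ℕ.+ s ℕ.* b ℕ.+ s
    e₂ = ≡.trans (e (a ℕ.+ b)) (≡.cong (ℕ._+ s) (ℕ.*-distribˡ-+ s a b))

  -- The recurrence naturally carries w^(n-p) in its last term. The factor w^p makes this w^n, which
  -- has a meaning for n < p too; there `falling n p` vanishes.
  falling-trace : ∀ n p →
    w ^ p * (falling (2 ℕ.+ n) (2 ℕ.+ p) + w ^ (2 ℕ.+ p) * falling n (2 ℕ.+ p))
    ≈ w ^ p * (ℓ[ 2 ℕ.+ p ] * falling (suc n) (2 ℕ.+ p)) + w ^ n * (falling n p * (f (2 ℕ.+ p) * f (suc p)))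
  falling-trace n p = begin
    w ^ p * (falling (2 ℕ.+ n) (2 ℕ.+ p) + w ^ (2 ℕ.+ p) * falling n (2 ℕ.+ p))
      ≈⟨ *-congˡ (+-congˡ (*-congˡ (trans (falling-snoc n (suc p)) (*-congʳ (falling-snoc n p))))) ⟩
    w ^ p * (f (2 ℕ.+ n) * (f (suc n) * P) + w ^ (2 ℕ.+ p) * (P * f (n ∸ p) * f (n ∸ suc p)))
      ≈⟨ solve 7 (λ wᵖ f₂ f₁ P w² f₀ f₋ → wᵖ ⊗ (f₂ ⊗ (f₁ ⊗ P) ⊕ w² ⊗ (P ⊗ f₀ ⊗ f₋))
          ⊜ P ⊗ (wᵖ ⊗ (f₂ ⊗ f₁ ⊕ w² ⊗ (f₀ ⊗ f₋))))
           refl (w ^ p) (f (2 ℕ.+ n)) (f (suc n)) P (w ^ (2 ℕ.+ p)) (f (n ∸ p)) (f (n ∸ suc p)) ⟩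
    P * (w ^ p * (f (2 ℕ.+ n) * f (suc n) + w ^ (2 ℕ.+ p) * (f (n ∸ p) * f (n ∸ suc p))))
      ≈⟨ main (falling-split n p) ⟩
    P * (w ^ p * (ℓ[ 2 ℕ.+ p ] * (f (suc n) * f (n ∸ p))) + w ^ n * (f (2 ℕ.+ p) * f (suc p)))
      ≈⟨ solve 8 (λ wᵖ l f₁ P f₀ wⁿ g₂ g₁ → P ⊗ (wᵖ ⊗ (l ⊗ (f₁ ⊗ f₀)) ⊕ wⁿ ⊗ (g₂ ⊗ g₁))
          ⊜ wᵖ ⊗ (l ⊗ (f₁ ⊗ (P ⊗ f₀))) ⊕ wⁿ ⊗ (P ⊗ (g₂ ⊗ g₁)))
           refl (w ^ p) ℓ[ 2 ℕ.+ p ] (f (suc n)) P (f (n ∸ p)) (w ^ n) (f (2 ℕ.+ p)) (f (suc p)) ⟩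
    w ^ p * (ℓ[ 2 ℕ.+ p ] * (f (suc n) * (P * f (n ∸ p)))) + w ^ n * (P * (f (2 ℕ.+ p) * f (suc p)))
      ≈⟨ +-congʳ (*-congˡ (*-congˡ (*-congˡ (falling-snoc n p)))) ⟨
    w ^ p * (ℓ[ 2 ℕ.+ p ] * falling (suc n) (2 ℕ.+ p)) + w ^ n * (P * (f (2 ℕ.+ p) * f (suc p))) ∎
    where
    P = falling n p

    at : ∀ b → w ^ p * (f (2 ℕ.+ (p ℕ.+ b)) * f (suc (p ℕ.+ b)) + w ^ (2 ℕ.+ p) * (f b * f (b ∸ 1)))
               ≈ w ^ p * (ℓ[ 2 ℕ.+ p ] * (f (suc (p ℕ.+ b)) * f b)) + w ^ (p ℕ.+ b) * (f (2 ℕ.+ p) * f (suc p))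
    -- Here n = p and b ∸ 1 is truncated to 0. As `f-trace-*` covers only b ≥ 1, this case rests on
    -- f 0 = 0 instead.
    at zero = begin
      w ^ p * (f (2 ℕ.+ (p ℕ.+ 0)) * f (suc (p ℕ.+ 0)) + w ^ (2 ℕ.+ p) * (f 0 * f 0))
        ≡⟨ ≡.cong (λ k → w ^ p * (f (2 ℕ.+ k) * f (suc k) + w ^ (2 ℕ.+ p) * (f 0 * f 0))) (ℕ.+-identityʳ p) ⟩
      w ^ p * (f (2 ℕ.+ p) * f (suc p) + w ^ (2 ℕ.+ p) * (f 0 * f 0))
        ≈⟨ *-congˡ (+-congˡ (*-congˡ (*-cong f-0 f-0))) ⟩
      w ^ p * (f (2 ℕ.+ p) * f (suc p) + w ^ (2 ℕ.+ p) * (0# * 0#))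
        ≈⟨ solve 4 (λ wᵖ ff w² lf → wᵖ ⊗ (ff ⊕ w² ⊗ (con (+ 0) ⊗ con (+ 0))) ⊜ wᵖ ⊗ (lf ⊗ con (+ 0)) ⊕ wᵖ ⊗ ff)
             refl (w ^ p) (f (2 ℕ.+ p) * f (suc p)) (w ^ (2 ℕ.+ p)) (ℓ[ 2 ℕ.+ p ] * f (suc (p ℕ.+ 0))) ⟩
      w ^ p * (ℓ[ 2 ℕ.+ p ] * f (suc (p ℕ.+ 0)) * 0#) + w ^ p * (f (2 ℕ.+ p) * f (suc p))
        ≈⟨ +-cong (*-congˡ (trans (*-congˡ (sym f-0)) (*-assoc _ _ _)))
            (*-congʳ (^-congʳ w (≡.sym (ℕ.+-identityʳ p)))) ⟩
      w ^ p * (ℓ[ 2 ℕ.+ p ] * (f (suc (p ℕ.+ 0)) * f 0)) + w ^ (p ℕ.+ 0) * (f (2 ℕ.+ p) * f (suc p)) ∎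
    at (suc b) = begin
      w ^ p * (f (2 ℕ.+ (p ℕ.+ suc b)) * f (suc (p ℕ.+ suc b)) + w ^ (2 ℕ.+ p) * (f (suc b) * f b))
        ≡⟨ ≡.cong (λ k → w ^ p * (f (2 ℕ.+ (p ℕ.+ suc b)) * f (suc k)
            + w ^ (2 ℕ.+ p) * (f (suc b) * f b))) (ℕ.+-suc p b) ⟩
      w ^ p * (f (suc (suc p) ℕ.+ suc b) * f (suc (suc p) ℕ.+ b) + w ^ (2 ℕ.+ p) * (f (suc b) * f b))
        ≈⟨ *-congˡ (f-trace-* (suc p) b) ⟩
      w ^ p * (ℓ[ 2 ℕ.+ p ] * (f (suc (suc p) ℕ.+ b) * f (suc b)) + w ^ suc b * (f (2 ℕ.+ p) * f (suc p)))
        ≈⟨ trans (distribˡ _ _ _) (+-congˡ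
            (trans (sym (*-assoc _ _ _)) (*-congʳ (sym (^-homo-* w p (suc b)))))) ⟩
      w ^ p * (ℓ[ 2 ℕ.+ p ] * (f (suc (suc p) ℕ.+ b) * f (suc b)))
          + w ^ (p ℕ.+ suc b) * (f (2 ℕ.+ p) * f (suc p))
        ≡⟨ ≡.cong (λ k → w ^ p * (ℓ[ 2 ℕ.+ p ] * (f (suc k) * f (suc b)))
            + w ^ (p ℕ.+ suc b) * (f (2 ℕ.+ p) * f (suc p))) (ℕ.+-suc p b) ⟨
      w ^ p * (ℓ[ 2 ℕ.+ p ] * (f (suc (p ℕ.+ suc b)) * f (suc b)))
          + w ^ (p ℕ.+ suc b) * (f (2 ℕ.+ p) * f (suc p)) ∎

    pred-∸ : n ∸ suc p ≡ (n ∸ p) ∸ 1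
    pred-∸ = ≡.trans (≡.cong (n ∸_) (ℕ.+-comm 1 p)) (≡.sym (ℕ.∸-+-assoc n p 1))

    main : P ≈ 0# ⊎ n ≡ p ℕ.+ (n ∸ p) →
           P * (w ^ p * (f (2 ℕ.+ n) * f (suc n) + w ^ (2 ℕ.+ p) * (f (n ∸ p) * f (n ∸ suc p))))
           ≈ P * (w ^ p * (ℓ[ 2 ℕ.+ p ] * (f (suc n) * f (n ∸ p))) + w ^ n * (f (2 ℕ.+ p) * f (suc p)))
    main (inj₁ P≈0) = trans (trans (*-congʳ P≈0) (zeroˡ _)) (sym (trans (*-congʳ P≈0) (zeroˡ _)))
    main (inj₂ n≡)  = *-congˡ (begin
      w ^ p * (f (2 ℕ.+ n) * f (suc n) + w ^ (2 ℕ.+ p) * (f (n ∸ p) * f (n ∸ suc p)))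
        ≡⟨ ≡.cong₂ (λ m k → w ^ p * (f (2 ℕ.+ m) * f (suc m) + w ^ (2 ℕ.+ p) * (f (n ∸ p) * f k))) n≡ pred-∸ ⟩
      _
        ≈⟨ at (n ∸ p) ⟩
      _
        ≡⟨ ≡.cong (λ m → w ^ p * (ℓ[ 2 ℕ.+ p ] * (f (suc m) * f (n ∸ p)))
            + w ^ m * (f (2 ℕ.+ p) * f (suc p))) n≡ ⟨
      w ^ p * (ℓ[ 2 ℕ.+ p ] * (f (suc n) * f (n ∸ p))) + w ^ n * (f (2 ℕ.+ p) * f (suc p)) ∎)

  -- The generating function as a monomial over a product of quadratic and linear factors.

  module GeneratingFunction
      (y-cancelˡ : ∀ {a b} → y * a ≈ y * b → a ≈ b)
      (factorial-cancelˡ : ∀ k {a b} → factorial k * a ≈ factorial k * b → a ≈ b)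
      (C : ℕ → ℕ → Carrier)
      (factorial-* : ∀ n k → factorial k * C n k ≈ falling n k) where

    open PowerSeries R
    open Scaling w
    module Sᴰ = RawSemiringDefs (Semiring.rawSemiring S.semiring)

    w^-cancelˡ : ∀ p {a b} → w ^ p * a ≈ w ^ p * b → a ≈ b
    w^-cancelˡ p {a} {b} e = cancel (s ℕ.* p)
      (trans (*-congʳ (sym (^-assocʳ (- y) s p))) (trans e (*-congʳ (^-assocʳ (- y) s p))))
      where
      -y-cancelˡ : ∀ {a b} → - y * a ≈ - y * b → a ≈ b
      -y-cancelˡ {a} {b} e = y-cancelˡ (begin
        y * a          ≈⟨ solve 2 (λ y a → y ⊗ a ⊜ ⊝ (⊝ y ⊗ a)) refl y a ⟩
        - (- y * a)    ≈⟨ -‿cong e ⟩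
        - (- y * b)    ≈⟨ solve 2 (λ y a → y ⊗ a ⊜ ⊝ (⊝ y ⊗ a)) refl y b ⟨
        y * b          ∎)
      cancel : ∀ n → (- y) ^ n * a ≈ (- y) ^ n * b → a ≈ b
      cancel zero    e = trans (sym (*-identityˡ a)) (trans e (*-identityˡ b))
      cancel (suc n) e = cancel n (-y-cancelˡ (trans (sym (*-assoc _ _ _)) (trans e (*-assoc _ _ _))))

    C-0-suc : ∀ p → C 0 (suc p) ≈ 0#
    C-0-suc p = factorial-cancelˡ (suc p)
        (trans (factorial-* 0 (suc p)) (trans (falling-0-suc p) (sym (zeroʳ _))))

    C-1-suc² : ∀ p → C 1 (2 ℕ.+ p) ≈ 0#
    C-1-suc² p = factorial-cancelˡ (2 ℕ.+ p) (trans (factorial-* 1 (2 ℕ.+ p))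
      (trans (*-congˡ (falling-0-suc p)) (trans (zeroʳ _) (sym (zeroʳ _)))))

    -- In terms of series: the quadratic factor with eigenvalues α^(s(p+2)) and β^(s(p+2)), times
    -- the generating function for p + 2 at z, is w^(-p) z² times the one for p at w z. The
    -- coefficients are compared after multiplication by w^p.
    C-trace : ∀ n p → w ^ p * (C (2 ℕ.+ n) (2 ℕ.+ p) - ℓ[ 2 ℕ.+ p ] * C (suc n) (2 ℕ.+ p)
        + w ^ (2 ℕ.+ p) * C n (2 ℕ.+ p))
                      ≈ w ^ n * C n p
    C-trace n p = factorial-cancelˡ (2 ℕ.+ p) (begin
      N! * (w ^ p * (C (2 ℕ.+ n) (2 ℕ.+ p) - ℓ[ 2 ℕ.+ p ] * C (suc n) (2 ℕ.+ p)
          + w ^ (2 ℕ.+ p) * C n (2 ℕ.+ p)))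
        ≈⟨ solve 7 (λ N w c₂ l c₁ w₂ c₀ → N ⊗ (w ⊗ (c₂ ⊕ ⊝ (l ⊗ c₁) ⊕ w₂ ⊗ c₀))
            ⊜ w ⊗ (N ⊗ c₂ ⊕ w₂ ⊗ (N ⊗ c₀)) ⊕ ⊝ (w ⊗ (l ⊗ (N ⊗ c₁))))
             refl N! (w ^ p) (C (2 ℕ.+ n) (2 ℕ.+ p)) ℓ[ 2 ℕ.+ p ] (C (suc n) (2 ℕ.+ p)) (w ^ (2 ℕ.+ p))
                 (C n (2 ℕ.+ p)) ⟩
      w ^ p * (N! * C (2 ℕ.+ n) (2 ℕ.+ p) + w ^ (2 ℕ.+ p) * (N! * C n (2 ℕ.+ p)))
          - w ^ p * (ℓ[ 2 ℕ.+ p ] * (N! * C (suc n) (2 ℕ.+ p)))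
        ≈⟨ +-cong (*-congˡ (+-cong (factorial-* _ _) (*-congˡ (factorial-* _ _))))
            (-‿cong (*-congˡ (*-congˡ (factorial-* _ _)))) ⟩
      w ^ p * (falling (2 ℕ.+ n) (2 ℕ.+ p) + w ^ (2 ℕ.+ p) * falling n (2 ℕ.+ p))
          - w ^ p * (ℓ[ 2 ℕ.+ p ] * falling (suc n) (2 ℕ.+ p))
        ≈⟨ +-congʳ (falling-trace n p) ⟩
      w ^ p * (ℓ[ 2 ℕ.+ p ] * falling (suc n) (2 ℕ.+ p))
          + w ^ n * (falling n p * (f (2 ℕ.+ p) * f (suc p)))
          - w ^ p * (ℓ[ 2 ℕ.+ p ] * falling (suc n) (2 ℕ.+ p))
        ≈⟨ +-congʳ (+-congˡ (*-congˡ (*-congʳ (factorial-* n p)))) ⟨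
      w ^ p * (ℓ[ 2 ℕ.+ p ] * falling (suc n) (2 ℕ.+ p))
          + w ^ n * (factorial p * C n p * (f (2 ℕ.+ p) * f (suc p)))
          - w ^ p * (ℓ[ 2 ℕ.+ p ] * falling (suc n) (2 ℕ.+ p))
        ≈⟨ solve 6 (λ l w p! c f₂ f₁ → l ⊕ w ⊗ (p! ⊗ c ⊗ (f₂ ⊗ f₁)) ⊕ ⊝ l ⊜ p! ⊗ f₁ ⊗ f₂ ⊗ (w ⊗ c))
             refl (w ^ p * (ℓ[ 2 ℕ.+ p ] * falling (suc n) (2 ℕ.+ p))) (w ^ n) (factorial p) (C n p)
                 (f (2 ℕ.+ p)) (f (suc p)) ⟩
      factorial p * f (suc p) * f (2 ℕ.+ p) * (w ^ n * C n p)
        ≈⟨ *-congʳ (trans (factorial-suc (suc p)) (*-congʳ (factorial-suc p))) ⟨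
      N! * (w ^ n * C n p) ∎)
      where
      N! = factorial (2 ℕ.+ p)

    -- Sum and product of the eigenvalues α^(s(p-k)) β^(sk) and α^(sk) β^(s(p-k)).
    trace determinant : ℕ → ℕ → Carrier
    trace p k = (- y) ^ (s ℕ.* k) * L (s ℕ.* (p ∸ 2 ℕ.* k))
    determinant p k = (- y) ^ (s ℕ.* k) * (- y) ^ (s ℕ.* k) * (- y) ^ (s ℕ.* (p ∸ 2 ℕ.* k))

    -- The eigenvalue (αβ)^(sp/2) left unpaired when p is even; 0 contributes no factor when
    -- p is odd.
    middle : ℕ → Carrier
    middle 0             = 1#
    middle 1             = 0#
    middle (suc (suc p)) = w * middle p

    quadraticFactor : ℕ → ℕ → Series
    quadraticFactor p k = quadratic (trace p k) (determinant p k)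

    denominator : ℕ → Series
    denominator p = Sᴰ.product {⌊ p ℕ.+ 1 /2⌋} (λ i → quadraticFactor p (toℕ i)) ∗ linear (middle p)

    G : ℕ → Series
    G p n = C n p

    linear-cong : ∀ {r r′} → r ≈ r′ → linear r ≋ linear r′
    linear-cong e = mk≋ λ { zero → refl ; (suc zero) → -‿cong e ; (suc (suc n)) → refl }

    quadratic-cong : ∀ {t t′ q q′} → t ≈ t′ → q ≈ q′ → quadratic t q ≋ quadratic t′ q′
    quadratic-cong e e′ = mk≋ λ where
      zero                → refl
      (suc zero)          → -‿cong e
      (suc (suc zero))    → e′
      (suc (suc (suc n))) → refl

    σ-linear : ∀ r → σ (linear r) ≋ linear (w * r)
    σ-linear r = mk≋ λ where
      zero          → *-identityˡ _
      (suc zero)    → solve 2 (λ w r → w ⊗ con (+ 1) ⊗ ⊝ r ⊜ ⊝ (w ⊗ r)) refl w r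
      (suc (suc n)) → zeroʳ _

    σ-quadratic : ∀ t q → σ (quadratic t q) ≋ quadratic (w * t) (w * w * q)
    σ-quadratic t q = mk≋ λ where
      zero                → *-identityˡ _
      (suc zero)          → solve 2 (λ w r → w ⊗ con (+ 1) ⊗ ⊝ r ⊜ ⊝ (w ⊗ r)) refl w t
      (suc (suc zero))    → solve 2 (λ w q → w ⊗ (w ⊗ con (+ 1)) ⊗ q ⊜ w ⊗ w ⊗ q) refl w q
      (suc (suc (suc n))) → zeroʳ _

    [-y]^-suc : ∀ k → (- y) ^ (s ℕ.* suc k) ≈ w * (- y) ^ (s ℕ.* k)
    [-y]^-suc k = trans (^-congʳ (- y) (ℕ.*-suc s k)) (^-homo-* (- y) s (s ℕ.* k))

    σ-quadraticFactor : ∀ p k → σ (quadraticFactor p k) ≋ quadraticFactor (2 ℕ.+ p) (suc k)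
    σ-quadraticFactor p k = S.trans (σ-quadratic _ _) (quadratic-cong
      (begin
        w * ((- y) ^ (s ℕ.* k) * L (s ℕ.* (p ∸ 2 ℕ.* k)))
          ≈⟨ *-assoc _ _ _ ⟨
        w * (- y) ^ (s ℕ.* k) * L (s ℕ.* (p ∸ 2 ℕ.* k))
          ≈⟨ *-cong (sym ([-y]^-suc k)) (reflexive (≡.cong (λ m → L (s ℕ.* m)) index)) ⟩
        trace (2 ℕ.+ p) (suc k) ∎)
      (begin
        w * w * (v * v * (- y) ^ (s ℕ.* (p ∸ 2 ℕ.* k)))
          ≈⟨ solve 3 (λ w v z → w ⊗ w ⊗ (v ⊗ v ⊗ z) ⊜ w ⊗ v ⊗ (w ⊗ v) ⊗ z) refl w v _ ⟩
        w * v * (w * v) * (- y) ^ (s ℕ.* (p ∸ 2 ℕ.* k))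
          ≈⟨ *-cong (sym (*-cong ([-y]^-suc k) ([-y]^-suc k))) (^-congʳ (- y) (≡.cong (s ℕ.*_) index)) ⟩
        determinant (2 ℕ.+ p) (suc k) ∎))
      where
      v = (- y) ^ (s ℕ.* k)
      index : p ∸ 2 ℕ.* k ≡ 2 ℕ.+ p ∸ 2 ℕ.* suc k
      index = ≡.cong (2 ℕ.+ p ∸_) (≡.sym (ℕ.*-suc 2 k))

    [-y]^s*0 : (- y) ^ (s ℕ.* 0) ≈ 1#
    [-y]^s*0 = ^-congʳ (- y) (ℕ.*-zeroʳ s)

    trace-0 : ∀ p → trace p 0 ≈ ℓ[ p ]
    trace-0 p = trans (*-congʳ [-y]^s*0) (*-identityˡ _)

    determinant-0 : ∀ p → determinant p 0 ≈ w ^ p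
    determinant-0 p = trans (*-cong (trans (*-cong [-y]^s*0 [-y]^s*0) (*-identityˡ _))
        (sym (^-assocʳ (- y) s p))) (*-identityˡ _)

    -- The factor k = 0 carries the eigenvalues α^(sp) and β^(sp); the other factors of
    -- the denominator for p + 2 are those for p, rescaled by αβ.
    denominator-suc² : ∀ p → denominator (2 ℕ.+ p) ≋ quadraticFactor (2 ℕ.+ p) 0 ∗ σ (denominator p)
    denominator-suc² p = S.trans (S.*-assoc _ _ _) (S.*-congˡ (S.sym (S.trans (σ-∗ _ _)
      (S.*-cong (S.trans (σ-product ⌊ p ℕ.+ 1 /2⌋ (λ i → quadraticFactor p (toℕ i)))
        (product-cong ⌊ p ℕ.+ 1 /2⌋ (λ i → σ-quadraticFactor p (toℕ i)))) (σ-linear _)))))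
      where
      product-cong : ∀ n {v v′ : Fin.Fin n → Series} → (∀ i → v i ≋ v′ i) → Sᴰ.product v ≋ Sᴰ.product v′
      product-cong zero    e = S.refl
      product-cong (suc n) e = S.*-cong (e Fin.zero) (product-cong n (e ∘ Fin.suc))

    -- From z² on the coefficients agree by `C-trace`; the first two vanish because `C 0 (2 ℕ.+ p)`
    -- and `C 1 (2 ℕ.+ p)` do.
    quadraticFactor-∗-G : ∀ p → w ^ p • (quadraticFactor (2 ℕ.+ p) 0 ∗ G (2 ℕ.+ p)) ≋ shift (shift (σ (G p)))
    quadraticFactor-∗-G p = S.trans
        (mk≋ λ n → *-congˡ (at (S.*-congʳ {G (2 ℕ.+ p)}
        (quadratic-cong (trace-0 (2 ℕ.+ p)) (determinant-0 (2 ℕ.+ p)))) n)) (mk≋ λ where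
      zero          → trans (*-congˡ (trans (∗-comm-at Q (G (2 ℕ.+ p)) 0) (trans (∗-def (G (2 ℕ.+ p)) Q 0)
                        (trans (+-identityʳ _) (trans (*-congʳ (C-0-suc (suc p))) (zeroˡ _)))))) (zeroʳ _)
      (suc zero)    → trans (*-congˡ (trans (quadratic-∗-1 _ _ (G (2 ℕ.+ p)))
                        (+-cong (C-1-suc² p) (-‿cong (*-congˡ (C-0-suc (suc p)))))))
                        (solve 2 (λ w l → w ⊗ (con (+ 0) ⊕ ⊝ (l ⊗ con (+ 0))) ⊜ con (+ 0)) refl (w ^ p) ℓ[
                            2 ℕ.+ p ])
      (suc (suc n)) → trans (*-congˡ (quadratic-∗-suc² _ _ (G (2 ℕ.+ p)) n)) (C-trace n p))
      where
      Q = quadratic ℓ[ 2 ℕ.+ p ] (w ^ (2 ℕ.+ p))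

    C-n-0 : ∀ n → C n 0 ≈ 1#
    C-n-0 n = factorial-cancelˡ 0 (trans (factorial-* n 0) (sym (*-identityˡ 1#)))

    -- Each step from p to p + 2 adds one pair of eigenvalues, so there are two base cases: a
    -- geometric series for p = 0, and for p = 1 the generating function of `f n` divided by `f 1`,
    -- whose recurrence is `F-trace`.
    denominator-∗-G : ∀ p → denominator p ∗ G p ≋ monomial p
    denominator-∗-G 0 = S.trans (S.*-congʳ (S.*-identityˡ _)) (mk≋ λ where
      zero    → trans (∗-def (linear 1#) (G 0) 0) (trans (+-identityʳ _) (trans (*-identityˡ _) (C-n-0 0)))
      (suc n) → trans (linear-∗-suc 1# (G 0) n)
          (trans (+-cong (C-n-0 (suc n)) (-‿cong (trans (*-identityˡ _) (C-n-0 n)))) (-‿inverseʳ 1#)))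
    denominator-∗-G 1 = S.trans (S.*-congʳ
        (S.trans (S.*-cong (S.*-identityʳ _) linear-0) (S.*-identityʳ _))) (mk≋ λ where
      zero          → trans (∗-comm-at Q (G 1) 0) (trans (∗-def (G 1) Q 0)
                        (trans (+-identityʳ _) (trans (*-congʳ (C-0-suc 0)) (zeroˡ _))))
      (suc zero)    → trans (quadratic-∗-1 _ _ (G 1))
          (trans (+-cong (C-1-1) (-‿cong (trans (*-congˡ (C-0-suc 0)) (zeroʳ _))))
                        (solve 0 (con (+ 1) ⊕ ⊝ con (+ 0) ⊜ con (+ 1)) refl))
      (suc (suc n)) → trans (quadratic-∗-suc² _ _ (G 1) n) (factorial-cancelˡ 1 (begin
        N! * (C (2 ℕ.+ n) 1 - trace 1 0 * C (suc n) 1 + determinant 1 0 * C n 1)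
          ≈⟨ solve 6 (λ N c₂ t c₁ q c₀ → N ⊗ (c₂ ⊕ ⊝ (t ⊗ c₁) ⊕ q ⊗ c₀) ⊜ N ⊗ c₂ ⊕ ⊝ (t ⊗ (N ⊗ c₁))
              ⊕ q ⊗ (N ⊗ c₀))
               refl N! (C (2 ℕ.+ n) 1) (trace 1 0) (C (suc n) 1) (determinant 1 0) (C n 1) ⟩
        N! * C (2 ℕ.+ n) 1 - trace 1 0 * (N! * C (suc n) 1) + determinant 1 0 * (N! * C n 1)
          ≈⟨ +-cong (+-cong (C-n-1 (2 ℕ.+ n)) (-‿cong (*-cong (trace-0 1) (C-n-1 (suc n)))))
               (*-cong (trans (determinant-0 1) (*-identityʳ w)) (C-n-1 n)) ⟩
        f (2 ℕ.+ n) - ℓ[ 1 ] * f (suc n) + w * f n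
          ≈⟨ +-cong (+-cong (reflexive (≡.cong
              F (≡.trans (ℕ.*-suc s (suc n)) (≡.cong (s ℕ.+_) (ℕ.*-suc s n)))))
               (-‿cong (*-cong (reflexive (≡.cong L (ℕ.*-identityʳ s)))
                   (reflexive (≡.cong F (ℕ.*-suc s n)))))) refl ⟩
        F (s ℕ.+ (s ℕ.+ s ℕ.* n)) - L s * F (s ℕ.+ s ℕ.* n) + w * F (s ℕ.* n)
          ≈⟨ F-trace s (s ℕ.* n) ⟩
        0#
          ≈⟨ zeroʳ _ ⟨
        N! * 0# ∎)))
      where
      N! = factorial 1
      Q = quadraticFactor 1 0
      linear-0 : linear 0# ≋ 1ˢ
      linear-0 = mk≋ λ { zero → refl ; (suc zero) → solve 0 (⊝ con (+ 0) ⊜ con (+ 0)) refl ;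
          (suc (suc n)) → refl }
      C-n-1 : ∀ n → N! * C n 1 ≈ f n
      C-n-1 n = trans (factorial-* n 1) (*-identityʳ _)
      C-1-1 : C 1 1 ≈ 1#
      C-1-1 = factorial-cancelˡ 1 (trans (C-n-1 1) (sym (trans (*-identityʳ _) (*-identityʳ _))))
    -- Rescaling zᵖ produces wᵖ zᵖ, which matches the factor wᵖ carried by `C-trace`; it is
    -- cancelled here.
    denominator-∗-G (suc (suc p)) = mk≋ λ n → w^-cancelˡ p (at scaled n)
      where
      Q = quadraticFactor (2 ℕ.+ p) 0
      scaled : w ^ p • (denominator (2 ℕ.+ p) ∗ G (2 ℕ.+ p)) ≋ w ^ p • monomial (2 ℕ.+ p)
      scaled = R.begin
        w ^ p • (denominator (2 ℕ.+ p) ∗ G (2 ℕ.+ p))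
          R.≈⟨ mk≋ (λ n → *-congˡ (at rearrange n)) ⟩
        w ^ p • ((Q ∗ G (2 ℕ.+ p)) ∗ σ (denominator p))
          R.≈⟨ mk≋ (λ n → sym (•-∗-at (w ^ p) (Q ∗ G (2 ℕ.+ p)) (σ (denominator p)) n)) ⟩
        (w ^ p • (Q ∗ G (2 ℕ.+ p))) ∗ σ (denominator p)
          R.≈⟨ S.*-congʳ (quadraticFactor-∗-G p) ⟩
        shift (shift (σ (G p))) ∗ σ (denominator p)
          R.≈⟨ S.trans (shift-∗ _ _) (shift-cong (shift-∗ _ _)) ⟩
        shift (shift (σ (G p) ∗ σ (denominator p)))
          R.≈⟨ shift-cong (shift-cong (S.trans (S.sym (σ-∗ _ _))
              (σ-cong (S.trans (S.*-comm _ _) (denominator-∗-G p))))) ⟩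
        shift (shift (σ (monomial p)))
          R.≈⟨ shift-cong (shift-cong (σ-monomial p)) ⟩
        shift (shift (w ^ p • monomial p))
          R.≈⟨ mk≋ (λ { zero → sym (zeroʳ _) ; (suc zero) → sym (zeroʳ _) ; (suc (suc n)) → refl }) ⟩
        w ^ p • monomial (2 ℕ.+ p) R.∎
        where
        module R = SetoidReasoning S.setoid
        rearrange : denominator (2 ℕ.+ p) ∗ G (2 ℕ.+ p) ≋ (Q ∗ G (2 ℕ.+ p)) ∗ σ (denominator p)
        rearrange = S.trans (S.*-congʳ (denominator-suc² p))
          (S.trans (S.*-assoc _ _ _) (S.trans (S.*-congˡ (S.*-comm _ _)) (S.sym (S.*-assoc _ _ _))))

    -- The logarithmic derivative of the generating function.

    open RawSemiringDefs (Semiring.rawSemiring semiring) using (sum; _×_)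
    open SemiringMult semiring using (×-assoc-*; ×-homo-+; ×1-homo-*)

    ι-+ : ∀ m n → ι (m ℕ.+ n) ≈ ι m + ι n
    ι-+ = ×-homo-+ 1#

    ι-≡ : ∀ {m n} → m ≡ n → ι m ≈ ι n
    ι-≡ = reflexive ∘ ≡.cong ι

    sum-cong : ∀ n {v v′ : ℕ → Carrier} → (∀ k → k ℕ.< n → v k ≈ v′ k) → sum {n} (v ∘ toℕ) ≈ sum {n} (v′ ∘ toℕ)
    sum-cong zero    e = refl
    sum-cong (suc n) e = +-cong (e 0 (s≤s z≤n)) (sum-cong n (λ k k<n → e (suc k) (s≤s k<n)))

    sum-zero : ∀ n {v : ℕ → Carrier} → (∀ k → v k ≈ 0#) → sum {n} (v ∘ toℕ) ≈ 0#
    sum-zero zero    e = refl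
    sum-zero (suc n) e = trans (+-cong (e 0) (sum-zero n (e ∘ suc))) (+-identityˡ 0#)

    *-distribˡ-sum : ∀ n a (v : ℕ → Carrier) → a * sum {n} (v ∘ toℕ) ≈ sum {n} ((λ k → a * v k) ∘ toℕ)
    *-distribˡ-sum zero    a v = zeroʳ a
    *-distribˡ-sum (suc n) a v = trans (distribˡ _ _ _) (+-congˡ (*-distribˡ-sum n a (v ∘ suc)))

    sumˢ-at : ∀ n (v : ℕ → Series) m → Sᴰ.sum {n} (v ∘ toℕ) m ≈ sum {n} (λ i → v (toℕ i) m)
    sumˢ-at zero    v m = refl
    sumˢ-at (suc n) v m = +-congˡ (sumˢ-at n (v ∘ suc) m)

    index : ℕ → ℕ → ℕ
    index p k = s ℕ.* (p ∸ 2 ℕ.* k)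

    module LogDerivative (D : Carrier → Carrier) (isDerivation : IsDerivation R D) {ξ η : Carrier}
                         (D-x : D x ≈ ξ) (D-y : D y ≈ η * y) where
      open IsDerivation isDerivation
      open SeriesDerivation R D isDerivation
      open IsDerivation isDerivationˢ using () renaming (log-product to log-productˢ; log-* to log-*ˢ; D-reciprocal to D-reciprocalˢ)

      D-[-y]^′ : ∀ n → D ((- y) ^ n) ≈ ι n * η * (- y) ^ n
      D-[-y]^′ n = trans (D-[-y]^ D isDerivation D-x D-y n) (*-congʳ (×≈ι* n η))

      -- For m ≥ 1 this is D (λᵐ + μᵐ) / m, where λ and μ are the eigenvalues paired in
      -- quadraticFactor p k.
      power : ℕ → ℕ → Series
      power p k m = (((- y) ^ (s ℕ.* k)) ^ m)
        * ( (ι (s ℕ.* k) + ι (s ℕ.* k) + ι (index p k)) * η * E (index p k ℕ.* m)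
          + (ι (s ℕ.* k) * η * x + ι (index p k) * ξ) * F (index p k ℕ.* m))

      -- The sequences E (N m) and F (N m) in m satisfy the recurrence with trace L N and norm (-
      -- y)^N. The factor vᵐ in `power` rescales these to v L N and v² (- y)^N, the coefficients of
      -- the quadratic factor.
      log-quadraticFactor : ∀ p k → quadraticFactor p k LogDerivative⁻¹ˢ shift (tail (power p k))
      log-quadraticFactor p k = log-quadratic (power p k) recurrence D-trace D-determinant
        where
        v = (- y) ^ (s ℕ.* k)
        N = index p k
        z = (- y) ^ N
        α = (ι (s ℕ.* k) + ι (s ℕ.* k) + ι N) * η
        β = ι (s ℕ.* k) * η * x + ι N * ξ

        N*suc : ∀ m → N ℕ.* suc m ≡ N ℕ.+ N ℕ.* m
        N*suc = ℕ.*-suc N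

        N*suc² : ∀ m → N ℕ.* (2 ℕ.+ m) ≡ N ℕ.+ (N ℕ.+ N ℕ.* m)
        N*suc² m = ≡.trans (N*suc (suc m)) (≡.cong (N ℕ.+_) (N*suc m))

        power-≡ : ∀ m {j} → N ℕ.* m ≡ j → power p k m ≈ v ^ m * (α * E j + β * F j)
        power-≡ m e = reflexive (≡.cong (λ j → v ^ m * (α * E j + β * F j)) e)

        recurrence : ∀ n → power p k (2 ℕ.+ n) - trace p k * power p k (suc n)
            + determinant p k * power p k n ≈ 0#
        recurrence n = begin
          power p k (2 ℕ.+ n) - trace p k * power p k (suc n) + determinant p k * power p k n
            ≈⟨ +-congʳ (+-cong (power-≡ (2 ℕ.+ n) (N*suc² n)) (-‿cong (*-congˡ (power-≡ (suc n) (N*suc n))))) ⟩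
          _
            ≈⟨ solve 12 (λ v vᵐ α β z l e₀ e₁ e₂ f₀ f₁ f₂ →
                 v ⊗ (v ⊗ vᵐ) ⊗ (α ⊗ e₂ ⊕ β ⊗ f₂) ⊕ ⊝ (v ⊗ l ⊗ (v ⊗ vᵐ ⊗ (α ⊗ e₁ ⊕ β ⊗ f₁)))
                     ⊕ v ⊗ v ⊗ z ⊗ (vᵐ ⊗ (α ⊗ e₀ ⊕ β ⊗ f₀))
                 ⊜ v ⊗ v ⊗ vᵐ ⊗ (α ⊗ (e₂ ⊕ ⊝ (l ⊗ e₁) ⊕ z ⊗ e₀) ⊕ β ⊗ (f₂ ⊕ ⊝ (l ⊗ f₁) ⊕ z ⊗ f₀)))
                 refl v (v ^ n) α β z (L N) (E j) (E (N ℕ.+ j)) (E (N ℕ.+ (N ℕ.+ j))) (F j) (F (N ℕ.+ j))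
                     (F (N ℕ.+ (N ℕ.+ j))) ⟩
          _
            ≈⟨ *-congˡ (+-cong (*-congˡ (E-trace N j)) (*-congˡ (F-trace N j))) ⟩
          v * v * v ^ n * (α * 0# + β * 0#)
            ≈⟨ solve 3 (λ v α β → v ⊗ (α ⊗ con (+ 0) ⊕ β ⊗ con (+ 0)) ⊜ con (+ 0)) refl (v * v * v ^ n) α β ⟩
          0# ∎
          where
          j = N ℕ.* n

        D-trace : D (trace p k) ≈ power p k 1
        D-trace = begin
          D (v * L N)
            ≈⟨ D-* v (L N) ⟩
          D v * L N + v * D (L N)
            ≈⟨ +-cong (*-congʳ (D-[-y]^′ (s ℕ.* k)))
                (*-congˡ (trans (D-L D isDerivation D-x D-y N) (×≈ι* N _))) ⟩
          ι (s ℕ.* k) * η * v * L N + v * (ι N * (ξ * F N + η * E N))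
            ≈⟨ solve 8 (λ a b η ξ v e f x → a ⊗ η ⊗ v ⊗ (e ⊕ e ⊕ x ⊗ f) ⊕ v ⊗ (b ⊗ (ξ ⊗ f ⊕ η ⊗ e))
                 ⊜ v ⊗ con (+ 1) ⊗ ((a ⊕ a ⊕ b) ⊗ η ⊗ e ⊕ (a ⊗ η ⊗ x ⊕ b ⊗ ξ) ⊗ f))
                 refl (ι (s ℕ.* k)) (ι N) η ξ v (E N) (F N) x ⟩
          v ^ 1 * (α * E N + β * F N)
            ≈⟨ power-≡ 1 (ℕ.*-identityʳ N) ⟨
          power p k 1 ∎

        -- At m = 0 the F-term of `power` vanishes and E 0 = 1, which leaves η times the exponent of
        -- - y in the determinant.
        D-determinant : D (determinant p k) ≈ power p k 0 * determinant p k
        D-determinant = begin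
          D (v * v * z)
            ≈⟨ trans (D-* (v * v) z) (+-congʳ (*-congʳ (D-* v v))) ⟩
          (D v * v + v * D v) * z + v * v * D z
            ≈⟨ +-cong (*-congʳ (+-cong (*-congʳ (D-[-y]^′ (s ℕ.* k))) (*-congˡ (D-[-y]^′ (s ℕ.* k)))))
                (*-congˡ (D-[-y]^′ N)) ⟩
          (ι (s ℕ.* k) * η * v * v + v * (ι (s ℕ.* k) * η * v)) * z + v * v * (ι N * η * z)
            ≈⟨ solve 6 (λ a b η v z β → (a ⊗ η ⊗ v ⊗ v ⊕ v ⊗ (a ⊗ η ⊗ v)) ⊗ z ⊕ v ⊗ v ⊗ (b ⊗ η ⊗ z)
                 ⊜ con (+ 1) ⊗ ((a ⊕ a ⊕ b) ⊗ η ⊗ con (+ 1) ⊕ β ⊗ con (+ 0)) ⊗ (v ⊗ v ⊗ z))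
                 refl (ι (s ℕ.* k)) (ι N) η v z β ⟩
          1# * (α * 1# + β * 0#) * (v * v * z)
            ≈⟨ *-congʳ (trans (power-≡ 0 (ℕ.*-zeroʳ N)) (*-congˡ (+-congˡ (*-congˡ F-0)))) ⟨
          power p k 0 * (v * v * z) ∎

      D-middle : ∀ p → D (middle p) ≈ ι (s ℕ.* ⌊ p /2⌋) * η * middle p
      D-middle 0 = trans D-1 (sym (trans (*-congʳ (trans (*-congʳ (ι-≡ (ℕ.*-zeroʳ s))) (zeroˡ _))) (zeroˡ _)))
      D-middle 1 = trans D-0 (sym (zeroʳ _))
      D-middle (suc (suc p)) = begin
        D (w * middle p)
          ≈⟨ trans (D-* w (middle p)) (+-cong (*-congʳ (D-[-y]^′ s)) (*-congˡ (D-middle p))) ⟩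
        ι s * η * w * middle p + w * (ι (s ℕ.* ⌊ p /2⌋) * η * middle p)
          ≈⟨ solve 5 (λ a b η w r → a ⊗ η ⊗ w ⊗ r ⊕ w ⊗ (b ⊗ η ⊗ r) ⊜ (a ⊕ b) ⊗ η ⊗ (w ⊗ r)) refl (ι s)
              (ι (s ℕ.* ⌊ p /2⌋)) η w (middle p) ⟩
        (ι s + ι (s ℕ.* ⌊ p /2⌋)) * η * (w * middle p)
          ≈⟨ *-congʳ (*-congʳ (trans (ι-≡ (ℕ.*-suc s ⌊ p /2⌋)) (ι-+ s _))) ⟨
        ι (s ℕ.* suc ⌊ p /2⌋) * η * (w * middle p) ∎

      middlePower : ℕ → Series
      middlePower p m = ι (s ℕ.* ⌊ p /2⌋) * η * middle p ^ m

      log-middle : ∀ p → linear (middle p) LogDerivative⁻¹ˢ shift (tail (middlePower p))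
      log-middle p = log-linear (middlePower p) (λ n → x∙yz≈y∙xz _ _ _)
        (trans (D-middle p) (*-congˡ (sym (*-identityʳ _))))

      logSeries : ℕ → Series
      logSeries p = Sᴰ.sum {⌊ p ℕ.+ 1 /2⌋} (λ i → shift (tail (power p (toℕ i))))
        ⊞ shift (tail (middlePower p))

      logSeries-0 : ∀ p → logSeries p 0 ≈ 0#
      logSeries-0 p = trans (+-identityʳ _)
          (trans (sumˢ-at ⌊ p ℕ.+ 1 /2⌋ (λ k → shift (tail (power p k))) 0)
          (sum-zero ⌊ p ℕ.+ 1 /2⌋ {λ _ → 0#} (λ _ → refl)))

      logSeries-suc : ∀ p m → logSeries p (suc m) ≈ sum {⌊ p ℕ.+ 1 /2⌋} (λ i → power p (toℕ i) (suc m))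
          + middlePower p (suc m)
      logSeries-suc p m = +-congʳ (sumˢ-at ⌊ p ℕ.+ 1 /2⌋ (λ k → shift (tail (power p k))) (suc m))

      -- The derivation acts on coefficients only, so it annihilates zᵖ = denominator · G;
      -- `D-reciprocal` applies, and zᵖ is cancelled.
      D-C : ∀ p → Dˢ (G p) ≋ G p ∗ logSeries p
      D-C p = mk≋ λ n → x∙y⁻¹≈ε⇒x≈y _ _ (at (monomial-cancelˡ p
        (D-reciprocalˢ (denominator-∗-G p) (Dˢ-monomial p)
          (log-*ˢ (log-productˢ {⌊ p ℕ.+ 1 /2⌋} (λ i → quadraticFactor p (toℕ i))
              (λ i → shift (tail (power p (toℕ i)))) (λ i → log-quadraticFactor p (toℕ i)))
              (log-middle p)))) n)
        where open GroupProperties +-group using (x∙y⁻¹≈ε⇒x≈y)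

    -- Moves the scalar from the logarithmic series to the Fibopolynomial, where the theorem has it.
    scalar-∗ : ∀ k (b : Series) p {c} → (∀ m → k × b m ≈ c m) → ∀ n →
               (G p ∗ c) n ≈ sum {suc n} (λ i → (k × G p (toℕ i)) * b (n ∸ toℕ i))
    scalar-∗ k b p {c} e n = trans (∗-cong-at {G p} {G p} {c} {λ m → k × b m} (λ _ → refl) (λ m → sym (e m)) n)
      (trans (∗-def (G p) (λ m → k × b m) n)
        (sum-cong (suc n) (λ t _ → trans (×-comm-* k (C t p) (b (n ∸ t)))
            (sym (×-assoc-* k (C t p) (b (n ∸ t)))))))
      where open SemiringMult semiring using (×-comm-*)

    ι-* : ∀ m n → ι (m ℕ.* n) ≈ ι m * ι n
    ι-* = ×1-homo-*

    [-y]^-index : ∀ k m → (- y) ^ (s ℕ.* k ℕ.* m) ≈ ((- y) ^ (s ℕ.* k)) ^ m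
    [-y]^-index k m = sym (^-assocʳ (- y) (s ℕ.* k) m)

    -- The partial derivative with respect to x.

    module ∂x (∂ : Carrier → Carrier) (isDerivation : IsDerivation R ∂) (∂-x : ∂ x ≈ 1#) (∂-y : ∂ y ≈ 0#) where
      open LogDerivative ∂ isDerivation ∂-x (trans ∂-y (sym (zeroˡ y)))

      summand : ℕ → ℕ → ℕ → Carrier
      summand p m k = (p ∸ 2 ℕ.* k) × ((- y) ^ (s ℕ.* k ℕ.* m) * F (index p k ℕ.* m))

      -- With ξ = 1 and η = 0 only the F-term of `power` survives. Its coefficient s (p - 2k) is
      -- divided between the scalar s in front of the convolution and the summand.
      s×summand : ∀ p k m → ι s * summand p m k ≈ power p k m
      s×summand p k m = begin
        ι s * summand p m k
          ≈⟨ *-congˡ (trans (×≈ι* (p ∸ 2 ℕ.* k) _) (*-congˡ (*-congʳ ([-y]^-index k m)))) ⟩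
        ι s * (ι (p ∸ 2 ℕ.* k) * (vᵐ * F M))
          ≈⟨ solve 7 (λ a b v f x e c → a ⊗ (b ⊗ (v ⊗ f))
               ⊜ v ⊗ ((c ⊕ c ⊕ a ⊗ b) ⊗ con (+ 0) ⊗ e ⊕ (c ⊗ con (+ 0) ⊗ x ⊕ a ⊗ b ⊗ con (+ 1)) ⊗ f))
               refl (ι s) (ι (p ∸ 2 ℕ.* k)) vᵐ (F M) x (E M) (ι (s ℕ.* k)) ⟩
        vᵐ * ((ι (s ℕ.* k) + ι (s ℕ.* k) + ι s * ι (p ∸ 2 ℕ.* k)) * 0# * E M
            + (ι (s ℕ.* k) * 0# * x + ι s * ι (p ∸ 2 ℕ.* k) * 1#) * F M)
          ≈⟨ *-congˡ (+-cong (*-congʳ (*-congʳ (+-congˡ (ι-* s _)))) (*-congʳ (+-congˡ (*-congʳ (ι-* s _))))) ⟨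
        power p k m ∎
        where
        vᵐ = ((- y) ^ (s ℕ.* k)) ^ m
        M = index p k ℕ.* m

      s×sum : ∀ p m → s × sum {⌊ p ℕ.+ 1 /2⌋} (λ i → summand p m (toℕ i)) ≈ logSeries p m
      s×sum p m = trans (×≈ι* s _) (trans (*-distribˡ-sum ⌊ p ℕ.+ 1 /2⌋ (ι s) (summand p m))
        (trans (sum-cong ⌊ p ℕ.+ 1 /2⌋ (λ k _ → s×summand p k m)) (powers m)))
        where
        powers : ∀ m → sum {⌊ p ℕ.+ 1 /2⌋} (λ i → power p (toℕ i) m) ≈ logSeries p m
        -- The series `logSeries` has no constant term by construction. The closed form agrees with
        -- it at index 0 because F 0 = 0, so this formula holds without a shift of n.
        powers zero    = trans (sum-zero ⌊ p ℕ.+ 1 /2⌋ (λ k → trans (sym (s×summand p k 0))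
            (trans (*-congˡ (trans (×≈ι* (p ∸ 2 ℕ.* k) _) (trans (*-congˡ (trans (*-congˡ
              (trans (reflexive (≡.cong F (ℕ.*-zeroʳ (index p k)))) F-0)) (zeroʳ _))) (zeroʳ _)))) (zeroʳ _))))
          (sym (logSeries-0 p))
        -- The unpaired eigenvalue is a power of - y or 0, hence a constant for ∂/∂x.
        powers (suc m) = sym (trans (logSeries-suc p m)
          (trans (+-congˡ (trans (*-congʳ (zeroʳ _)) (zeroˡ _))) (+-identityʳ _)))

      ∂-C : ∀ p n → ∂ (C n p) ≈ sum {suc n} (λ i → (s × C (toℕ i) p)
              * sum {⌊ p ℕ.+ 1 /2⌋} (λ j → summand p (n ∸ toℕ i) (toℕ j)))
      ∂-C p n = trans (at (D-C p) n)
        (scalar-∗ s (λ m → sum {⌊ p ℕ.+ 1 /2⌋} (λ i → summand p m (toℕ i))) p (s×sum p) n)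

    -- The partial derivative with respect to y.

    data Parity (p : ℕ) : Set ℓ where
      even : p ≡ 2 ℕ.* ⌊ p /2⌋ → middle p ≈ w ^ ⌊ p /2⌋ → (- 1#) ^ p ≈ 1# → Parity p
      odd  : middle p ≈ 0# → (- 1#) ^ p ≈ - 1# → Parity p

    -1*-1* : ∀ a → - 1# * (- 1# * a) ≈ a
    -1*-1* a = solve 1 (λ a → ⊝ con (+ 1) ⊗ (⊝ con (+ 1) ⊗ a) ⊜ a) refl a

    parity : ∀ p → Parity p
    parity 0 = even ≡.refl refl refl
    parity 1 = odd refl (*-identityʳ _)
    parity (suc (suc p)) with parity p
    ... | even e e′ e″ = even (≡.trans (≡.cong (2 ℕ.+_) e) (≡.sym (ℕ.*-suc 2 ⌊ p /2⌋))) (*-congˡ e′)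
        (trans (-1*-1* _) e″)
    ... | odd e e′     = odd (trans (*-congˡ e) (zeroʳ w)) (trans (-1*-1* _) e′)

    -- Ensures that the truncated difference `p ∸ 2 ℕ.* k` is positive throughout the range of
    -- summation, so that the predecessors of its multiples are genuine.
    2k<p : ∀ p k → k ℕ.< ⌊ p ℕ.+ 1 /2⌋ → 2 ℕ.* k ℕ.< p
    2k<p 1             zero    _         = s≤s z≤n
    2k<p 1             (suc k) (s≤s ())
    2k<p (suc (suc p)) zero    _         = s≤s z≤n
    2k<p (suc (suc p)) (suc k) (s≤s k<p) =
      ≡.subst (ℕ._< 2 ℕ.+ p) (≡.sym (ℕ.*-suc 2 k)) (s≤s (s≤s (2k<p p k k<p)))

    y*F-pred : ∀ m → .{{_ : ℕ.NonZero m}} → y * F (m ∸ 1) ≈ E m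
    y*F-pred (suc m) = refl

    -- The quotients k x / (p y) and (1 + (-1)^p) / 4 are represented by `u` and `κ`, which enter
    -- through the equations obtained by clearing denominators.
    module ∂y .{{_ : ℕ.NonZero s}} (∂ : Carrier → Carrier) (isDerivation : IsDerivation R ∂)
        (∂-x : ∂ x ≈ 0#) (∂-y : ∂ y ≈ 1#)
              (p : ℕ) .{{_ : ℕ.NonZero p}}
              (u : ℕ → Carrier) (p×y*u : ∀ k → (p × y) * u k ≈ k × x)
              (4-cancelˡ : ∀ {a b} → (4 × 1#) * a ≈ (4 × 1#) * b → a ≈ b)
              (κ : Carrier) (4×κ : (4 × 1#) * κ ≈ 1# + (- 1#) ^ p) where

      -- y ∂/∂y is a derivation under which y, unlike under ∂/∂y, is an eigenvector.
      y∂-isDerivation : IsDerivation R (λ a → y * ∂ a)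
      y∂-isDerivation = record
        { D-cong = λ e → *-congˡ (D-cong e)
        ; D-+    = λ a b → trans (*-congˡ (D-+ a b)) (distribˡ y _ _)
        ; D-*    = λ a b → trans (*-congˡ (D-* a b))
            (solve 5 (λ y a b a′ b′ → y ⊗ (a′ ⊗ b ⊕ a ⊗ b′) ⊜ y ⊗ a′ ⊗ b ⊕ a ⊗ (y ⊗ b′)) refl y a b (∂ a)
                (∂ b))
        }
        where open IsDerivation isDerivation

      open LogDerivative (λ a → y * ∂ a) y∂-isDerivation (trans (*-congˡ ∂-x) (zeroʳ y))
          (trans (*-congˡ ∂-y) (*-comm y 1#))

      summand : ℕ → ℕ → Carrier
      summand m k = (- y) ^ (s ℕ.* k ℕ.* m) * (F (index p k ℕ.* m ∸ 1) + u k * F (index p k ℕ.* m))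

      middleTerm : ℕ → Carrier
      middleTerm m = κ * (- y) ^ (⌊ s ℕ.* p /2⌋ ℕ.* m ∸ 1)

      coefficient : ℕ → Carrier
      coefficient m = sum {⌊ p ℕ.+ 1 /2⌋} (λ i → summand m (toℕ i)) - middleTerm m

      -- The product of the two eigenvalues in each pair is (- y)^(s p), independently of k; this
      -- lets s p be taken out of the whole sum.
      sp-split : ∀ k → 2 ℕ.* k ℕ.≤ p → ι (s ℕ.* p) ≈ ι (s ℕ.* k) + ι (s ℕ.* k) + ι (index p k)
      sp-split k 2k≤p = begin
        ι (s ℕ.* p)
          ≈⟨ ι-≡ (≡.cong (s ℕ.*_) (≡.sym (ℕ.m+[n∸m]≡n 2k≤p))) ⟩
        ι (s ℕ.* (2 ℕ.* k ℕ.+ (p ∸ 2 ℕ.* k)))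
          ≈⟨ trans (ι-≡ (ℕ.*-distribˡ-+ s (2 ℕ.* k) (p ∸ 2 ℕ.* k))) (ι-+ (s ℕ.* (2 ℕ.* k)) (index p k)) ⟩
        ι (s ℕ.* (2 ℕ.* k)) + ι (index p k)
          ≈⟨ +-congʳ (trans (ι-≡ (≡.trans (≡.cong (s ℕ.*_) (≡.cong (k ℕ.+_) (ℕ.+-identityʳ k)))
              (ℕ.*-distribˡ-+ s k k))) (ι-+ (s ℕ.* k) (s ℕ.* k))) ⟩
        ι (s ℕ.* k) + ι (s ℕ.* k) + ι (index p k) ∎

      -- Multiplication by y turns F (M ∸ 1) into E M, as M is positive. The correction `u k` is
      -- what the F-term of `power` demands: s p y times it is s k x.
      y*summand : ∀ m k → k ℕ.< ⌊ p ℕ.+ 1 /2⌋ → y * ι (s ℕ.* p) * summand (suc m) k ≈ power p k (suc m)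
      y*summand m k k<p = begin
        y * ι (s ℕ.* p) * ((- y) ^ (s ℕ.* k ℕ.* suc m) * (F (M ∸ 1) + u k * F M))
          ≈⟨ *-congˡ (*-congʳ ([-y]^-index k (suc m))) ⟩
        y * ι (s ℕ.* p) * (vᵐ * (F (M ∸ 1) + u k * F M))
          ≈⟨ solve 6 (λ y a v f′ u f → y ⊗ a ⊗ (v ⊗ (f′ ⊕ u ⊗ f)) ⊜ v ⊗ (a ⊗ (y ⊗ f′) ⊕ a ⊗ y ⊗ u ⊗ f))
               refl y (ι (s ℕ.* p)) vᵐ (F (M ∸ 1)) (u k) (F M) ⟩
        vᵐ * (ι (s ℕ.* p) * (y * F (M ∸ 1)) + ι (s ℕ.* p) * y * u k * F M)
          ≈⟨ *-congˡ (+-cong (*-cong (sp-split k (ℕ.<⇒≤ (2k<p p k k<p))) (y*F-pred M {{M≢0}}))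
              (*-congʳ sp*y*u)) ⟩
        vᵐ * ((ι (s ℕ.* k) + ι (s ℕ.* k) + ι (index p k)) * E M + ι (s ℕ.* k) * x * F M)
          ≈⟨ solve 6 (λ a b v e f x → v ⊗ ((a ⊕ a ⊕ b) ⊗ e ⊕ a ⊗ x ⊗ f)
               ⊜ v ⊗ ((a ⊕ a ⊕ b) ⊗ con (+ 1) ⊗ e ⊕ (a ⊗ con (+ 1) ⊗ x ⊕ b ⊗ con (+ 0)) ⊗ f))
               refl (ι (s ℕ.* k)) (ι (index p k)) vᵐ (E M) (F M) x ⟩
        power p k (suc m) ∎
        where
        vᵐ = ((- y) ^ (s ℕ.* k)) ^ suc m
        M = index p k ℕ.* suc m
        M≢0 : ℕ.NonZero M
        M≢0 = ℕ.m*n≢0 (index p k) (suc m)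
          {{ℕ.m*n≢0 s (p ∸ 2 ℕ.* k) {{it}} {{ℕ.>-nonZero (ℕ.m<n⇒0<n∸m (2k<p p k k<p))}}}}
        sp*y*u : ι (s ℕ.* p) * y * u k ≈ ι (s ℕ.* k) * x
        sp*y*u = begin
          ι (s ℕ.* p) * y * u k      ≈⟨ *-congʳ (*-congʳ (ι-* s p)) ⟩
          ι s * ι p * y * u k        ≈⟨ solve 4 (λ a b y u → a ⊗ b ⊗ y ⊗ u ⊜ a ⊗ (b ⊗ y ⊗ u)) refl (ι s)
              (ι p) y (u k) ⟩
          ι s * (ι p * y * u k)      ≈⟨ *-congˡ
              (trans (*-congʳ (sym (×≈ι* p y))) (trans (p×y*u k) (×≈ι* k x))) ⟩
          ι s * (ι k * x)            ≈⟨ *-assoc _ _ _ ⟨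
          ι s * ι k * x              ≈⟨ *-congʳ (ι-* s k) ⟨
          ι (s ℕ.* k) * x            ∎

      -- For odd p both `κ` and `middle p` are 0. For even p, `κ` is 1/2 and turns s p into the
      -- exponent s p / 2 of the unpaired eigenvalue.
      y*middleTerm : ∀ m → - (y * ι (s ℕ.* p) * middleTerm (suc m)) ≈ middlePower p (suc m)
      y*middleTerm m with parity p
      ... | odd middle≈0 sign = begin
        - (y * ι (s ℕ.* p) * (κ * (- y) ^ (⌊ s ℕ.* p /2⌋ ℕ.* suc m ∸ 1)))
          ≈⟨ -‿cong (*-congˡ (*-congʳ κ≈0)) ⟩
        - (y * ι (s ℕ.* p) * (0# * (- y) ^ (⌊ s ℕ.* p /2⌋ ℕ.* suc m ∸ 1)))
          ≈⟨ solve 5 (λ a b c d e → ⊝ (a ⊗ (con (+ 0) ⊗ b)) ⊜ c ⊗ con (+ 1) ⊗ (con (+ 0) ⊗ d)) refl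
               (y * ι (s ℕ.* p)) ((- y) ^ (⌊ s ℕ.* p /2⌋ ℕ.* suc m ∸ 1)) (ι (s ℕ.* ⌊ p /2⌋))
                   (middle p ^ m) 0# ⟩
        ι (s ℕ.* ⌊ p /2⌋) * 1# * (0# * middle p ^ m)
          ≈⟨ *-congˡ (*-congʳ middle≈0) ⟨
        middlePower p (suc m) ∎
        where
        κ≈0 : κ ≈ 0#
        κ≈0 = 4-cancelˡ (trans 4×κ (trans (+-congˡ sign) (trans (-‿inverseʳ 1#) (sym (zeroʳ _)))))
      ... | even p≡2h middle≈ sign = begin
        - (y * ι (s ℕ.* p) * (κ * (- y) ^ (⌊ s ℕ.* p /2⌋ ℕ.* suc m ∸ 1)))
          ≈⟨ solve 4 (λ y a κ z → ⊝ (y ⊗ a ⊗ (κ ⊗ z)) ⊜ a ⊗ κ ⊗ (⊝ y ⊗ z)) refl y (ι (s ℕ.* p)) κ _ ⟩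
        -- The minus sign of the last term in the theorem is absorbed here: - y restores the power
        -- of - y lowered by one.
        ι (s ℕ.* p) * κ * (- y * (- y) ^ (⌊ s ℕ.* p /2⌋ ℕ.* suc m ∸ 1))
          ≈⟨ *-cong sp*κ (trans (reflexive (≡.cong (λ j → - y * (- y) ^ (j ℕ.* suc m ∸ 1)) half))
               (^-congʳ (- y) (ℕ.suc-pred (s ℕ.* h ℕ.* suc m) {{ℕ.m*n≢0 (s ℕ.* h) (suc m) {{sh≢0}}}}))) ⟩
        ι (s ℕ.* h) * 1# * (- y) ^ (s ℕ.* h ℕ.* suc m)
          ≈⟨ *-congˡ (trans (^-congˡ (suc m) (trans middle≈ (^-assocʳ (- y) s h)))
              (^-assocʳ (- y) (s ℕ.* h) (suc m))) ⟨
        middlePower p (suc m) ∎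
        where
        h = ⌊ p /2⌋
        s*p≡ : s ℕ.* p ≡ s ℕ.* h ℕ.+ s ℕ.* h
        s*p≡ = ≡.trans (≡.cong (s ℕ.*_) (≡.trans p≡2h (≡.cong (h ℕ.+_) (ℕ.+-identityʳ h))))
            (ℕ.*-distribˡ-+ s h h)
        half : ⌊ s ℕ.* p /2⌋ ≡ s ℕ.* h
        half = ≡.trans (≡.cong ⌊_/2⌋ s*p≡) (≡.sym (ℕ.n≡⌊n+n/2⌋ (s ℕ.* h)))
        sh≢0 : ℕ.NonZero (s ℕ.* h)
        sh≢0 = ℕ.m*n≢0 s h {{it}} {{ℕ.m*n≢0⇒n≢0 2 {{≡.subst ℕ.NonZero p≡2h it}}}}
        κ+κ : κ + κ ≈ 1#
        κ+κ = 4-cancelˡ (begin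
          (4 × 1#) * (κ + κ)                        ≈⟨ distribˡ _ _ _ ⟩
          (4 × 1#) * κ + (4 × 1#) * κ               ≈⟨ +-cong e e ⟩
          1# + 1# + (1# + 1#)                       ≈⟨ solve 0 (con (+ 1) ⊕ con (+ 1) ⊕ (con (+ 1) ⊕ con (+ 1))
                                                         ⊜ (con (+ 1) ⊕ (con (+ 1) ⊕ (con (+ 1)
                                                             ⊕ (con (+ 1) ⊕ con (+ 0))))) ⊗ con (+ 1)) refl ⟩
          (4 × 1#) * 1#                             ∎)
          where
          e : (4 × 1#) * κ ≈ 1# + 1#
          e = trans 4×κ (+-congˡ sign)
        sp*κ : ι (s ℕ.* p) * κ ≈ ι (s ℕ.* h) * 1#
        sp*κ = begin
          ι (s ℕ.* p) * κ                        ≈⟨ *-congʳ (trans (ι-≡ s*p≡) (ι-+ (s ℕ.* h) (s ℕ.* h))) ⟩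
          (ι (s ℕ.* h) + ι (s ℕ.* h)) * κ        ≈⟨ solve 2 (λ a κ → (a ⊕ a) ⊗ κ ⊜ a ⊗ (κ ⊕ κ)) refl
              (ι (s ℕ.* h)) κ ⟩
          ι (s ℕ.* h) * (κ + κ)                  ≈⟨ *-congˡ κ+κ ⟩
          ι (s ℕ.* h) * 1#                       ∎

      y*coefficient : ∀ m → y * ((s ℕ.* p) × coefficient (suc m)) ≈ logSeries p (suc m)
      y*coefficient m = begin
        y * ((s ℕ.* p) × coefficient (suc m))
          ≈⟨ trans (*-congˡ (×≈ι* (s ℕ.* p) _)) (sym (*-assoc _ _ _)) ⟩
        y * ι (s ℕ.* p) * (sum {⌊ p ℕ.+ 1 /2⌋} (λ i → summand (suc m) (toℕ i)) - middleTerm (suc m))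
          ≈⟨ solve 3 (λ a b c → a ⊗ (b ⊕ ⊝ c) ⊜ a ⊗ b ⊕ ⊝ (a ⊗ c)) refl (y * ι (s ℕ.* p)) _
              (middleTerm (suc m)) ⟩
        y * ι (s ℕ.* p) * sum {⌊ p ℕ.+ 1 /2⌋} (λ i → summand (suc m) (toℕ i))
            - y * ι (s ℕ.* p) * middleTerm (suc m)
          ≈⟨ +-cong (trans (*-distribˡ-sum ⌊ p ℕ.+ 1 /2⌋ _ (summand (suc m)))
                 (sum-cong ⌊ p ℕ.+ 1 /2⌋ (y*summand m)))
               (y*middleTerm m) ⟩
        sum {⌊ p ℕ.+ 1 /2⌋} (λ i → power p (toℕ i) (suc m)) + middlePower p (suc m)
          ≈⟨ logSeries-suc p m ⟨
        logSeries p (suc m) ∎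

      -- The closed form is matched with `logSeries` at positive indices. In the convolution at n +
      -- 1 the product with the vanishing constant term of `logSeries` drops out, which leaves a
      -- convolution at n with the shifted closed form; y is cancelled last.
      ∂-C : ∀ n → ∂ (C (n ℕ.+ 1) p) ≈ sum {suc n}
          (λ i → ((s ℕ.* p) × C (toℕ i) p) * coefficient (n ∸ toℕ i ℕ.+ 1))
      ∂-C n = y-cancelˡ (begin
        y * ∂ (C (n ℕ.+ 1) p)
          ≡⟨ ≡.cong (λ m → y * ∂ (C m p)) (ℕ.+-comm n 1) ⟩
        y * ∂ (C (suc n) p)
          ≈⟨ at (D-C p) (suc n) ⟩
        (G p ∗ logSeries p) (suc n)
          ≈⟨ trans (∗-suc (G p) (logSeries p) n)
              (trans (+-congˡ (trans (*-congˡ (logSeries-0 p)) (zeroʳ _))) (+-identityʳ _)) ⟩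
        (G p ∗ tail (logSeries p)) n
          ≈⟨ trans (∗-cong-at {y • b} {tail (logSeries p)} {G p} {G p} y•b≈ (λ _ → refl) n)
              (∗-comm-at (tail (logSeries p)) (G p) n) ⟨
        ((y • b) ∗ G p) n
          ≈⟨ trans (•-∗-at y b (G p) n) (*-congˡ (∗-comm-at b (G p) n)) ⟩
        y * (G p ∗ b) n
          ≈⟨ *-congˡ (scalar-∗ (s ℕ.* p) (λ m → coefficient (m ℕ.+ 1)) p (λ _ → refl) n) ⟩
        y * sum {suc n} (λ i → ((s ℕ.* p) × C (toℕ i) p) * coefficient (n ∸ toℕ i ℕ.+ 1)) ∎)
        where
        b : Series
        b m = (s ℕ.* p) × coefficient (m ℕ.+ 1)
        y•b≈ : ∀ m → (y • b) m ≈ logSeries p (suc m)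
        y•b≈ m = trans (reflexive (≡.cong (λ j → y * ((s ℕ.* p) × coefficient j)) (ℕ.+-comm m 1)))
            (y*coefficient m)

-- Derivations of polynomial rings.

module PolynomialDerivations {c ℓ} (R : CommutativeRing c ℓ) where
  open CommutativeRing R
  open Polynomial R
  open RawSemiringDefs (Semiring.rawSemiring semiring) using (_×_)
  open CommutativeMonoidMult +-commutativeMonoid using (×-congʳ; ×-distrib-+)
  private
    module P = CommutativeRing polynomialRing
    module PS = CommutativeSemigroupProperties P.+-commutativeSemigroup
  open SetoidReasoning P.setoid
  open IntegerCoefficients polynomialRing

  -- The recursive definition depends on the list; this formula shows that trailing zeros do not
  -- matter, and congruence and additivity follow from it.
  coeff-derivative : ∀ p i → coeff (derivative p) i ≈ suc i × coeff p (suc i)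
  coeff-derivative []      i       = sym (×-zeroʳ (suc i))
    where
    ×-zeroʳ : ∀ n → n × 0# ≈ 0#
    ×-zeroʳ zero    = refl
    ×-zeroʳ (suc n) = trans (+-identityˡ _) (×-zeroʳ n)
  coeff-derivative (a ∷ p) zero    = coeff-+ p (0# ∷ derivative p) 0
  coeff-derivative (a ∷ p) (suc i) = trans (coeff-+ p (0# ∷ derivative p) (suc i))
      (+-congˡ (coeff-derivative p i))

  derivative-cong : ∀ {p q} → p ≈ᵖ q → derivative p ≈ᵖ derivative q
  derivative-cong {p} {q} e = mk≈ᵖ λ i →
    trans (coeff-derivative p i) (trans (×-congʳ (suc i) (coeff-≈ e (suc i))) (sym (coeff-derivative q i)))

  derivative-+ : ∀ p q → derivative (p +ᵖ q) ≈ᵖ derivative p +ᵖ derivative q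
  derivative-+ p q = mk≈ᵖ λ i → trans (coeff-derivative (p +ᵖ q) i)
    (trans (×-congʳ (suc i) (coeff-+ p q (suc i))) (trans (×-distrib-+ _ _ (suc i))
      (sym (trans (coeff-+ (derivative p) (derivative q) i)
          (+-cong (coeff-derivative p i) (coeff-derivative q i))))))

  derivative-· : ∀ a p → derivative (a ·ᵖ p) ≈ᵖ a ·ᵖ derivative p
  derivative-· a []      = P.refl
  derivative-· a (b ∷ p) = P.trans
      (P.+-congˡ (P.trans (∷-cong refl (derivative-· a p)) (P.sym (·-0∷ a (derivative p)))))
    (P.sym (·-distribˡ a p (0# ∷ derivative p)))

  derivative-* : ∀ p q → derivative (p *ᵖ q) ≈ᵖ derivative p *ᵖ q +ᵖ p *ᵖ derivative q
  derivative-* []      q = P.refl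
  derivative-* (a ∷ p) q = begin
    derivative (a ·ᵖ q +ᵖ (0# ∷ p *ᵖ q))
      ≈⟨ derivative-+ (a ·ᵖ q) (0# ∷ p *ᵖ q) ⟩
    derivative (a ·ᵖ q) +ᵖ (p *ᵖ q +ᵖ (0# ∷ derivative (p *ᵖ q)))
      ≈⟨ P.+-cong (derivative-· a q)
          (P.+-congˡ (P.trans (∷-cong refl (derivative-* p q))
          (0∷-+ (derivative p *ᵖ q) (p *ᵖ derivative q)))) ⟩
    a ·ᵖ derivative q +ᵖ (p *ᵖ q +ᵖ ((0# ∷ derivative p *ᵖ q) +ᵖ (0# ∷ p *ᵖ derivative q)))
      ≈⟨ solve 4 (λ A B C D → A ⊕ (B ⊕ (C ⊕ D)) ⊜ B ⊕ C ⊕ (A ⊕ D)) P.refl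
           (a ·ᵖ derivative q) (p *ᵖ q) (0# ∷ derivative p *ᵖ q) (0# ∷ p *ᵖ derivative q) ⟩
    (p *ᵖ q +ᵖ (0# ∷ derivative p *ᵖ q)) +ᵖ (a ∷ p) *ᵖ derivative q
      ≈⟨ P.+-congʳ {(a ∷ p) *ᵖ derivative q}
          -- The product of the list `0# ∷ derivative p` with q unfolds to a sum that begins with
          -- the zero multiple of q, which is inserted here.
          (P.+-congˡ {p *ᵖ q} (P.+-congʳ {0# ∷ derivative p *ᵖ q} (·-zero q))) ⟨
    (p *ᵖ q +ᵖ (0# ∷ derivative p) *ᵖ q) +ᵖ (a ∷ p) *ᵖ derivative q
      ≈⟨ P.+-congʳ (*ᵖ-distribʳ q p (0# ∷ derivative p)) ⟨
    (p +ᵖ (0# ∷ derivative p)) *ᵖ q +ᵖ (a ∷ p) *ᵖ derivative q ∎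

  derivative-isDerivation : IsDerivation polynomialRing derivative
  derivative-isDerivation = record { D-cong = derivative-cong ; D-+ = derivative-+ ; D-* = derivative-* }

  module _ {D : Carrier → Carrier} (isDerivation : IsDerivation R D) where
    open IsDerivation isDerivation

    coeff-map : ∀ p i → coeff (map D p) i ≈ D (coeff p i)
    coeff-map []      i       = sym D-0
    coeff-map (a ∷ p) zero    = refl
    coeff-map (a ∷ p) (suc i) = coeff-map p i

    map-+ : ∀ p q → map D (p +ᵖ q) ≈ᵖ map D p +ᵖ map D q
    map-+ p q = mk≈ᵖ λ i → trans (coeff-map (p +ᵖ q) i) (trans (D-cong (coeff-+ p q i)) (trans (D-+ _ _)
      (sym (trans (coeff-+ (map D p) (map D q) i) (+-cong (coeff-map p i) (coeff-map q i))))))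

    map-· : ∀ a p → map D (a ·ᵖ p) ≈ᵖ D a ·ᵖ p +ᵖ a ·ᵖ map D p
    map-· a []      = P.refl
    map-· a (b ∷ p) = ∷-cong (D-* a b) (map-· a p)

    map-* : ∀ p q → map D (p *ᵖ q) ≈ᵖ map D p *ᵖ q +ᵖ p *ᵖ map D q
    map-* []      q = P.refl
    map-* (a ∷ p) q = begin
      map D (a ·ᵖ q +ᵖ (0# ∷ p *ᵖ q))
        ≈⟨ P.trans (map-+ (a ·ᵖ q) (0# ∷ p *ᵖ q)) (P.+-cong (map-· a q)
             (P.trans (∷-cong D-0 (map-* p q)) (0∷-+ (map D p *ᵖ q) (p *ᵖ map D q)))) ⟩
      (D a ·ᵖ q +ᵖ a ·ᵖ map D q) +ᵖ ((0# ∷ map D p *ᵖ q) +ᵖ (0# ∷ p *ᵖ map D q))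
        ≈⟨ PS.interchange (D a ·ᵖ q) (a ·ᵖ map D q) (0# ∷ map D p *ᵖ q) (0# ∷ p *ᵖ map D q) ⟩
      (D a ∷ map D p) *ᵖ q +ᵖ (a ∷ p) *ᵖ map D q ∎

    -- Acting on coefficients treats the indeterminate as a constant; on ℤ[x][y] this yields ∂/∂x.
    map-isDerivation : IsDerivation polynomialRing (map D)
    map-isDerivation = record
      { D-cong = λ {p} {q} e → mk≈ᵖ λ i → trans (coeff-map p i)
          (trans (D-cong (coeff-≈ e i)) (sym (coeff-map q i)))
      ; D-+    = map-+
      ; D-*    = map-*
      }

module PolynomialDomainDerivations {c ℓ} (𝔻 : IntegralDomain c ℓ) where
  private module PD = PolynomialDerivations (IntegralDomain.commutativeRing 𝔻)

  derivative-isDerivation : IsDerivation (IntegralDomain.commutativeRing (PolynomialDomain.polynomialDomain 𝔻))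
                                         (Polynomial.derivative (IntegralDomain.commutativeRing 𝔻))
  derivative-isDerivation = PD.derivative-isDerivation

  map-isDerivation : ∀ {D} → IsDerivation (IntegralDomain.commutativeRing 𝔻) D →
                     IsDerivation (IntegralDomain.commutativeRing (PolynomialDomain.polynomialDomain 𝔻))
                         (map D)
  map-isDerivation = PD.map-isDerivation

-- The fraction field and the quotient rule.

module FractionFieldProperties {c ℓ} (𝔻 : IntegralDomain c ℓ) where
  open IntegralDomain 𝔻
  open FractionField 𝔻
  private module K = CommutativeRing fractionField
  open RawSemiringDefs (Semiring.rawSemiring semiring) using (_×_; _^_; product)
  private module Kᴰ = RawSemiringDefs (Semiring.rawSemiring K.semiring)
  open GroupProperties +-group using (x∙y⁻¹≈ε⇒x≈y)
  open RingProperties ring using (x[y-z]≈xy-xz)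
  open SetoidReasoning setoid
  open IntegerCoefficients commutativeRing

  *-cancelˡ : ∀ {k a b} → k ≉ 0# → k * a ≈ k * b → a ≈ b
  *-cancelˡ {k} {a} {b} k≉0 e = [ (λ k≈0 → ⊥-elim (k≉0 k≈0)) , x∙y⁻¹≈ε⇒x≈y a b ]′
    (noZeroDivisors k (a - b) (trans (x[y-z]≈xy-xz k a b) (trans (+-congʳ e) (-‿inverseʳ _))))

  embed-cong : ∀ {a b} → a ≈ b → embed a ≃ embed b
  embed-cong e = mk≃ (*-congʳ e)

  embed-+ : ∀ a b → embed (a + b) ≃ embed a +ᶠ embed b
  embed-+ a b = mk≃ (solve 2 (λ a b → (a ⊕ b) ⊗ (con (+ 1) ⊗ con (+ 1))
      ⊜ (a ⊗ con (+ 1) ⊕ b ⊗ con (+ 1)) ⊗ con (+ 1)) refl a b)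

  embed-* : ∀ a b → embed (a * b) ≃ embed a *ᶠ embed b
  embed-* a b = mk≃ (*-congˡ (*-identityˡ 1#))

  embed-× : ∀ n a → embed (n × a) ≃ n Kᴰ.× embed a
  embed-× zero    a = K.refl
  embed-× (suc n) a = K.trans (embed-+ a (n × a)) (K.+-congˡ {embed a} (embed-× n a))

  embed-^ : ∀ a n → embed (a ^ n) ≃ embed a Kᴰ.^ n
  embed-^ a zero    = K.refl
  embed-^ a (suc n) = K.trans (embed-* a (a ^ n)) (K.*-congˡ {embed a} (embed-^ a n))

  embed-product : ∀ {n} (v : Vector Carrier n) → embed (product v) ≃ Kᴰ.product (embed ∘ v)
  embed-product {zero}  v = K.refl
  embed-product {suc n} v = K.trans (embed-* (v Fin.zero) (product (v ∘ Fin.suc)))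
      (K.*-congˡ {embed (v Fin.zero)} (embed-product (v ∘ Fin.suc)))

  embed-den-* : ∀ a b (b≉0 : b ≉ 0#) → embed b *ᶠ (a / b [ b≉0 ]) ≃ embed a
  embed-den-* a b b≉0 = mk≃ (solve 2 (λ a b → b ⊗ a ⊗ con (+ 1) ⊜ a ⊗ (con (+ 1) ⊗ b)) refl a b)

  embed-cancelˡ : ∀ {k} → k ≉ 0# → ∀ {u v} → embed k *ᶠ u ≃ embed k *ᶠ v → u ≃ v
  embed-cancelˡ {k} k≉0 {a / b [ _ ]} {c / d [ _ ]} (mk≃ e) = mk≃ (*-cancelˡ k≉0 (begin
    k * (a * d)         ≈⟨ solve 3 (λ k a d → k ⊗ (a ⊗ d) ⊜ k ⊗ a ⊗ (con (+ 1) ⊗ d)) refl k a d ⟩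
    k * a * (1# * d)    ≈⟨ e ⟩
    k * c * (1# * b)    ≈⟨ solve 3 (λ k a d → k ⊗ (a ⊗ d) ⊜ k ⊗ a ⊗ (con (+ 1) ⊗ d)) refl k c b ⟨
    k * (c * b)         ∎))

  module _ {D : Carrier → Carrier} (isDerivation : IsDerivation (IntegralDomain.commutativeRing 𝔻) D) where
    open IsDerivation isDerivation

    quotientRule-embed : ∀ a → quotientRule D (embed a) ≃ embed (D a)
    quotientRule-embed a = mk≃ (trans (*-congʳ (+-congˡ (-‿cong (*-congˡ D-1))))
      (solve 2 (λ a a′ → (a′ ⊗ con (+ 1) ⊕ ⊝ (a ⊗ con (+ 0))) ⊗ con (+ 1)
          ⊜ a′ ⊗ (con (+ 1) ⊗ con (+ 1))) refl a (D a)))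

    -- The cross-multiplied left side equals b d D(a d) - a d D(b d). It depends on a and c only
    -- through a d = c b, so the same expression arises from the other fraction.
    quotientRule-cong : ∀ {u v} → u ≃ v → quotientRule D u ≃ quotientRule D v
    quotientRule-cong {a / b [ _ ]} {c / d [ _ ]} (mk≃ ad≈cb) = mk≃ (begin
      (D a * b - a * D b) * (d * d)
        ≈⟨ solve 8 (λ a b c d a′ b′ c′ d′ → (a′ ⊗ b ⊕ ⊝ (a ⊗ b′)) ⊗ (d ⊗ d)
             ⊜ b ⊗ d ⊗ (a′ ⊗ d ⊕ a ⊗ d′) ⊕ ⊝ (a ⊗ d ⊗ (b ⊗ d′ ⊕ d ⊗ b′))) refl a b c d (D a) (D b) (D c)
                 (D d) ⟩
      b * d * (D a * d + a * D d) - a * d * (b * D d + d * D b)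
        ≈⟨ +-cong (*-congˡ (trans (sym (D-* a d)) (trans (D-cong ad≈cb) (D-* c b)))) (-‿cong (*-congʳ ad≈cb)) ⟩
      b * d * (D c * b + c * D b) - c * b * (b * D d + d * D b)
        ≈⟨ solve 8 (λ a b c d a′ b′ c′ d′ → b ⊗ d ⊗ (c′ ⊗ b ⊕ c ⊗ b′) ⊕ ⊝ (c ⊗ b ⊗ (b ⊗ d′ ⊕ d ⊗ b′))
             ⊜ (c′ ⊗ d ⊕ ⊝ (c ⊗ d′)) ⊗ (b ⊗ b)) refl a b c d (D a) (D b) (D c) (D d) ⟩
      (D c * d - c * D d) * (b * b) ∎)

    quotientRule-+ : ∀ u v → quotientRule D (u +ᶠ v) ≃ quotientRule D u +ᶠ quotientRule D v
    quotientRule-+ (a / b [ _ ]) (c / d [ _ ]) = mk≃ (trans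
      (*-congʳ (+-cong (*-congʳ (trans (D-+ _ _) (+-cong (D-* a d) (D-* c b)))) (-‿cong (*-congˡ (D-* b d)))))
      (solve 8 (λ a b c d a′ b′ c′ d′ →
         ((a′ ⊗ d ⊕ a ⊗ d′ ⊕ (c′ ⊗ b ⊕ c ⊗ b′)) ⊗ (b ⊗ d) ⊕ ⊝ ((a ⊗ d ⊕ c ⊗ b) ⊗ (b′ ⊗ d ⊕ b ⊗ d′)))
             ⊗ (b ⊗ b ⊗ (d ⊗ d))
         ⊜ ((a′ ⊗ b ⊕ ⊝ (a ⊗ b′)) ⊗ (d ⊗ d) ⊕ (c′ ⊗ d ⊕ ⊝ (c ⊗ d′)) ⊗ (b ⊗ b)) ⊗ (b ⊗ d ⊗ (b ⊗ d)))
         refl a b c d (D a) (D b) (D c) (D d)))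

    quotientRule-* : ∀ u v → quotientRule D (u *ᶠ v) ≃ quotientRule D u *ᶠ v +ᶠ u *ᶠ quotientRule D v
    quotientRule-* (a / b [ _ ]) (c / d [ _ ]) = mk≃ (trans
      (*-congʳ (+-cong (*-congʳ (D-* a c)) (-‿cong (*-congˡ (D-* b d)))))
      (solve 8 (λ a b c d a′ b′ c′ d′ →
         ((a′ ⊗ c ⊕ a ⊗ c′) ⊗ (b ⊗ d) ⊕ ⊝ (a ⊗ c ⊗ (b′ ⊗ d ⊕ b ⊗ d′))) ⊗ (b ⊗ b ⊗ d ⊗ (b ⊗ (d ⊗ d)))
         ⊜ ((a′ ⊗ b ⊕ ⊝ (a ⊗ b′)) ⊗ c ⊗ (b ⊗ (d ⊗ d)) ⊕ a ⊗ (c′ ⊗ d ⊕ ⊝ (c ⊗ d′)) ⊗ (b ⊗ b ⊗ d))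
             ⊗ (b ⊗ d ⊗ (b ⊗ d)))
         refl a b c d (D a) (D b) (D c) (D d)))

    quotientRule-isDerivation : IsDerivation (FractionField.fractionField 𝔻) (FractionField.quotientRule 𝔻 D)
    quotientRule-isDerivation = record
      { D-cong = quotientRule-cong ; D-+ = quotientRule-+ ; D-* = quotientRule-* }

-- Fibopolynomials as fractions over an integral domain.

module FractionFieldFibonomial {c ℓ} (𝔻 : IntegralDomain c ℓ)
                               (𝔽 : FibonacciSequence (IntegralDomain.commutativeRing 𝔻)) where
  open IntegralDomain 𝔻
  open FibonacciSequence 𝔽
  open RawSemiringDefs (Semiring.rawSemiring semiring) using (product; _^_; _×_)
  private
    module Frac = FractionField 𝔻
    module K = CommutativeRing (FractionField.fractionField 𝔻)
    module Kᴰ = RawSemiringDefs (Semiring.rawSemiring K.semiring)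
    open Frac using (embed; quotientRule; _/_[_])
    open FractionFieldProperties 𝔻

  𝔽ᴷ : FibonacciSequence (FractionField.fractionField 𝔻)
  𝔽ᴷ = record
    { x      = embed x
    ; y      = embed y
    ; F      = embed ∘ F
    ; F-0    = embed-cong F-0
    ; F-1    = embed-cong F-1
    ; F-suc² = λ n → K.trans (embed-cong (F-suc² n)) (K.trans (embed-+ (x * F (suc n)) (y * F n))
        (K.+-cong (embed-* x (F (suc n))) (embed-* y (F n))))
    }

  private module 𝔽ᴷ′ = FibonacciSequence 𝔽ᴷ

  module Fibopolynomial (y≉0 : y ≉ 0#) (s : ℕ) .{{_ : NonZero s}}
                        (den≉0 : ∀ k → product {k} (λ i → F (s ℕ.* suc (toℕ i))) ≉ 0#) where
    fibopolynomial : ℕ → ℕ → K.Carrier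
    fibopolynomial n k = product {k} (λ i → F (s ℕ.* (n ∸ toℕ i))) / product {k}
        (λ i → F (s ℕ.* suc (toℕ i))) [ den≉0 k ]

    open Fibonomial (FractionField.fractionField 𝔻) 𝔽ᴷ s
    open FallingProduct (FractionField.fractionField 𝔻) f f-0

    embed-den : ∀ k → embed (product {k} (λ i → F (s ℕ.* suc (toℕ i)))) K.≈ factorial k
    embed-den k = embed-product {k} (λ i → F (s ℕ.* suc (toℕ i)))

    factorial-cancelˡ : ∀ k {a b} → factorial k K.* a K.≈ factorial k K.* b → a K.≈ b
    factorial-cancelˡ k {a} {b} e = embed-cancelˡ (den≉0 k) {a} {b}
      (K.trans (K.*-congʳ {a} (embed-den k)) (K.trans e (K.*-congʳ {b} (K.sym (embed-den k)))))

    -- With its denominator cleared, the quotient has the form in which the generating function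
    -- argument uses it.
    factorial-* : ∀ n k → factorial k K.* fibopolynomial n k K.≈ falling n k
    factorial-* n k = K.trans (K.*-congʳ {fibopolynomial n k} (K.sym (embed-den k)))
      (K.trans (embed-den-* (product {k} (λ i → F (s ℕ.* (n ∸ toℕ i)))) _ (den≉0 k))
        (embed-product {k} (λ i → F (s ℕ.* (n ∸ toℕ i)))))

    open GeneratingFunction (λ {a} {b} → embed-cancelˡ y≉0 {a} {b}) factorial-cancelˡ fibopolynomial
        factorial-*

    module _ {D : Carrier → Carrier} (isDerivation : IsDerivation (IntegralDomain.commutativeRing 𝔻) D) where
      quotientRule-≈ : ∀ {a b} → D a ≈ b → quotientRule D (embed a) K.≈ embed b
      quotientRule-≈ {a} e = K.trans (quotientRule-embed isDerivation a) (embed-cong e)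

      ∂/∂x-fibopolynomial : D x ≈ 1# → D y ≈ 0# → ∀ p n →
        quotientRule D (fibopolynomial n p) K.≈
        Kᴰ.sum {suc n} (λ i → (s Kᴰ.× fibopolynomial (toℕ i) p) K.* Kᴰ.sum {⌊ p ℕ.+ 1 /2⌋} (λ j →
          (p ∸ 2 ℕ.* toℕ j) Kᴰ.× ((K.- 𝔽ᴷ′.y) Kᴰ.^ (s ℕ.* toℕ j ℕ.* (n ∸ toℕ i))
              K.* 𝔽ᴷ′.F (s ℕ.* (p ∸ 2 ℕ.* toℕ j) ℕ.* (n ∸ toℕ i)))))
      ∂/∂x-fibopolynomial D-x D-y =
        ∂x.∂-C (quotientRule D) (quotientRule-isDerivation isDerivation) (quotientRule-≈ D-x)
            (quotientRule-≈ D-y)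

      ∂/∂y-fibopolynomial : D x ≈ 0# → D y
          ≈ 1# → ∀ p .{{_ : NonZero p}} (p×y≉0 : p × y ≉ 0#) (4≉0 : 4 × 1# ≉ 0#) n →
        quotientRule D (fibopolynomial (n ℕ.+ 1) p) K.≈
        Kᴰ.sum {suc n} (λ i → ((s ℕ.* p) Kᴰ.× fibopolynomial (toℕ i) p) K.*
          ( Kᴰ.sum {⌊ p ℕ.+ 1 /2⌋} (λ j → (K.- 𝔽ᴷ′.y) Kᴰ.^ (s ℕ.* toℕ j ℕ.* (n ∸ toℕ i ℕ.+ 1))
              K.* ( 𝔽ᴷ′.F (s ℕ.* (p ∸ 2 ℕ.* toℕ j) ℕ.* (n ∸ toℕ i ℕ.+ 1) ∸ 1)
                K.+ ((toℕ j × x) / (p × y) [ p×y≉0 ])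
                    K.* 𝔽ᴷ′.F (s ℕ.* (p ∸ 2 ℕ.* toℕ j) ℕ.* (n ∸ toℕ i ℕ.+ 1))))
            K.- ((1# + (- 1#) ^ p) / (4 × 1#) [ 4≉0 ]) K.* (K.- 𝔽ᴷ′.y)
                Kᴰ.^ (⌊ s ℕ.* p /2⌋ ℕ.* (n ∸ toℕ i ℕ.+ 1) ∸ 1)))
      ∂/∂y-fibopolynomial D-x D-y p p×y≉0 4≉0 =
        ∂y.∂-C (quotientRule D) (quotientRule-isDerivation isDerivation) (quotientRule-≈ D-x)
            (quotientRule-≈ D-y) p
          u p×y*u (λ {a} {b} → 4-cancelˡ {a} {b}) κ 4×κ
        where
        u : ℕ → K.Carrier
        u k = (k × x) / (p × y) [ p×y≉0 ]

        κ : K.Carrier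
        κ = (1# + (- 1#) ^ p) / (4 × 1#) [ 4≉0 ]

        p×y*u : ∀ k → (p Kᴰ.× embed y) K.* u k K.≈ k Kᴰ.× embed x
        p×y*u k = K.trans (K.*-congʳ {u k} (K.sym (embed-× p y)))
          (K.trans (embed-den-* (k × x) (p × y) p×y≉0) (embed-× k x))

        4-cancelˡ : ∀ {a b} → (4 Kᴰ.× K.1#) K.* a K.≈ (4 Kᴰ.× K.1#) K.* b → a K.≈ b
        4-cancelˡ {a} {b} e = embed-cancelˡ 4≉0 {a} {b}
          (K.trans (K.*-congʳ {a} (embed-× 4 1#)) (K.trans e (K.*-congʳ {b} (K.sym (embed-× 4 1#)))))

        4×κ : (4 Kᴰ.× K.1#) K.* κ K.≈ K.1# K.+ (K.- K.1#) Kᴰ.^ p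
        4×κ = K.trans (K.*-congʳ {κ} (K.sym (embed-× 4 1#)))
          (K.trans (embed-den-* (1# + (- 1#) ^ p) (4 × 1#) 4≉0)
            (K.trans (embed-+ 1# ((- 1#) ^ p)) (K.+-congˡ {K.1#} (embed-^ (- 1#) p))))

-- Specialization to ℤ[x,y] and ℚ(x,y).

ℙ-∂/∂x-isDerivation : IsDerivation (IntegralDomain.commutativeRing ℤ[x,y].polynomialDomain) ℙ.∂/∂x
ℙ-∂/∂x-isDerivation = PolynomialDomainDerivations.map-isDerivation ℤ[x].polynomialDomain
  (PolynomialDomainDerivations.derivative-isDerivation ℤ-domain)

ℙ-∂/∂y-isDerivation : IsDerivation (IntegralDomain.commutativeRing ℤ[x,y].polynomialDomain) ℙ.∂/∂y
ℙ-∂/∂y-isDerivation = PolynomialDomainDerivations.derivative-isDerivation ℤ[x].polynomialDomain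

∂x/∂x≈1 : ℙ.∂/∂x ℙ.x ℙ.≈ ℙ.1#
∂x/∂x≈1 = ℙ.mk≈ᵖ λ where
  0       → ℤ[x].mk≈ᵖ λ where
    0             → ≡.refl
    1             → ≡.refl
    (suc (suc _)) → ≡.refl
  (suc _) → ℤ[x].mk≈ᵖ λ _ → ≡.refl

∂y/∂x≈0 : ℙ.∂/∂x ℙ.y ℙ.≈ ℙ.0#
∂y/∂x≈0 = ℙ.mk≈ᵖ λ where
  0             → ℤ[x].mk≈ᵖ λ _ → ≡.refl
  1             → ℤ[x].0∷[]≈0
  (suc (suc _)) → ℤ[x].mk≈ᵖ λ _ → ≡.refl

∂x/∂y≈0 : ℙ.∂/∂y ℙ.x ℙ.≈ ℙ.0#
∂x/∂y≈0 = ℙ.0∷[]≈0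

∂y/∂y≈1 : ℙ.∂/∂y ℙ.y ℙ.≈ ℙ.1#
∂y/∂y≈1 = ℙ.mk≈ᵖ λ where
  0             → ℤ[x].mk≈ᵖ λ where
    0       → ≡.refl
    (suc _) → ≡.refl
  1             → ℤ[x].mk≈ᵖ λ _ → ≡.refl
  (suc (suc _)) → ℤ[x].mk≈ᵖ λ _ → ≡.refl

fibonacciSequence : FibonacciSequence (IntegralDomain.commutativeRing ℤ[x,y].polynomialDomain)
fibonacciSequence = record
  { x      = ℙ.x
  ; y      = ℙ.y
  ; F      = ℙ.F
  ; F-0    = ℙ.mk≈ᵖ λ _ → ℤ[x].mk≈ᵖ λ _ → ≡.refl
  ; F-1    = ℙ.mk≈ᵖ λ _ → ℤ[x].mk≈ᵖ λ _ → ≡.refl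
  ; F-suc² = λ _ → ℙ.mk≈ᵖ λ _ → ℤ[x].mk≈ᵖ λ _ → ≡.refl
  }

-- Repeats the proof inside the definition of `fibopolynomial`, so that the two quotients agree by
-- computation.
fibopolynomial-den≉0 : ∀ s .{{_ : NonZero s}} k → ℙ.product {k} (λ i → ℙ.F (s ℕ.* suc (toℕ i))) ℙ.≉ ℙ.0#
fibopolynomial-den≉0 s k = ℙ.product≉0 {k} _ (λ i → ℙ.F≉0 (s ℕ.* suc (toℕ i)) {{ℕ.m*n≢0 s (suc (toℕ i))}})

module Fibo (s : ℕ) .{{_ : NonZero s}} =
  FractionFieldFibonomial.Fibopolynomial ℤ[x,y].polynomialDomain fibonacciSequence ℙ.y≉0 s
      (fibopolynomial-den≉0 s)

open import Data.Product.Base using (_×_)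
open ℚ⟨x,y⟩

proposition18 : (s p : ℕ) .{{_ : NonZero s}} .{{_ : NonZero p}} (n : ℕ) →
    ( ∂/∂x (fibopolynomial s n p)
    ≈ ( (λ m → s · fibopolynomial s m p)
    ∗ (λ m → ∑[ k < ⌊ p ℕ.+ 1 /2⌋ ]
    (p ∸ 2 ℕ.* k) · ((- y) ^ (s ℕ.* k ℕ.* m) * F (s ℕ.* (p ∸ 2 ℕ.* k) ℕ.* m)))
    ) n )
    ×
    ( ∂/∂y (fibopolynomial s (n ℕ.+ 1) p)
    ≈ ( (λ m → (s ℕ.* p) · fibopolynomial s m p)
    ∗ (λ m →
    (∑[ k < ⌊ p ℕ.+ 1 /2⌋ ]
    (- y) ^ (s ℕ.* k ℕ.* (m ℕ.+ 1))
    * ( F (s ℕ.* (p ∸ 2 ℕ.* k) ℕ.* (m ℕ.+ 1) ∸ 1)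
    + ((k ℙ.· ℙ.x) / (p ℙ.· ℙ.y) [ ℙ.·-≉0 p ℙ.y≉0 ])
    * F (s ℕ.* (p ∸ 2 ℕ.* k) ℕ.* (m ℕ.+ 1)) ))
    - ((ℙ.1# ℙ.+ (ℙ.- ℙ.1#) ℙ.^ p) / (4 ℙ.· ℙ.1#) [ ℙ.·-≉0 4 ℙ.1≉0 ])
    * (- y) ^ (⌊ s ℕ.* p /2⌋ ℕ.* (m ℕ.+ 1) ∸ 1))
    ) n )
proposition18 s p n =
    Fibo.∂/∂x-fibopolynomial s ℙ-∂/∂x-isDerivation ∂x/∂x≈1 ∂y/∂x≈0 p n
  , Fibo.∂/∂y-fibopolynomial s ℙ-∂/∂y-isDerivation ∂x/∂y≈0 ∂y/∂y≈1 p (ℙ.·-≉0 p ℙ.y≉0) (ℙ.·-≉0 4 ℙ.1≉0) n
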